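{- Let $a,b,c\in\mathbb{Z}$ be nonzero and suppose that $ac$ or $bc$ is a perfect square. Then the equation $ax^2+by^2=cz^2$ is partition regular with respect to $x,y$: for every finite coloring of $\mathbb{N}=\{1,2,\dots\}$ there exist distinct $x,y\in\mathbb{N}$ having the same color and some $z\in\mathbb{N}$ such that $ax^2+by^2=cz^2$. -}

module Defs where

open import Data.Nat using (ℕ)
open import Data.Fin using (Fin)
open import Data.Integer using (ℤ; _*_; _+_; +_)
open import Data.Product using (∃; _×_)
open import Relation.Binary.PropositionalEquality using (_≡_; _≢_)

IsSquare : ℤ → Set
IsSquare n = ∃ λ (t : ℤ) → n ≡ t * t

-- A finite coloring of ℕ⁺ = {1,2,...} with r colors: we color all of ℕ
-- with Fin r, but only values at positive arguments matter (all x,y,z are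
-- required to be ≥ 1 in the conclusion).
Coloring : ℕ → Set
Coloring r = ℕ → Fin r

Eqn : ℤ → ℤ → ℤ → ℕ → ℕ → ℕ → Set
Eqn a b c x y z =
  a * (+ x * + x) + b * (+ y * + y) ≡ c * (+ z * + z)

{-# OPTIONS --safe #-}
module Submission where

-- By symmetry ac = e²; put D = bc. For rational k, z, r the numbers x = (z²-D) r and y = β(k)(z+k)(z+D/k) r,
-- β(k) = 2ek/(k²-D), are solved by a rational third coordinate: with p = kz+D and q = k+z one has
-- x/y = (p²-Dq²)/(2epq) and (p²-Dq²)² + 4D p²q² = (p²+Dq²)². Suppose that x and y never share a colour,
-- let f be the indicator of a colour class, and average over finitely supported laws that are almost
-- invariant under affine maps, each parameter being enormous compared with the previous ones.
--
-- 1. When k is averaged over a long block of such laws, the root D/k of the vertex y, and then its root k, may be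
--    replaced by a random w ∈ {1,…,m}: in the second moment two summands with distinct roots are uncorrelated,
--    because an affine map carries any pair of shifts (a,b) of z to (0,1). Hence f(r) is almost uncorrelated with
--    v(β(k)r), where v is the average of f((z+w)(z+w′)r/(z²-D)) over z, w, w′.
-- 2. The laws of (z+w)(z+w′)/(z²-D) are almost multiplicative under z₁ ⊕ z₂ = (z₁z₂+D)/(z₁+z₂), so the energy of the
--    smoothed colouring v can be decreased repeatedly by ⊕. When it stops decreasing, v is almost invariant under
--    these multipliers, hence (by the affine invariance of the correlations) insensitive to k ↦ k+w, and step 1
--    yields that f(ρr) and f(ξr) are almost uncorrelated for every ρ in a prescribed finite set and a random ξ.
-- 3. Iterating step 2 produces 2q multipliers for which the classes are pairwise almost disjoint in the mean, which
--    for q colours contradicts the Cauchy–Schwarz inequality. Everything is finite, so a search finds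
--    a monochromatic pair, and clearing denominators gives natural numbers.

open import Defs

-- An affine substitution in z normalises two roots and no more, whereas a product of colour values
-- at two vertices of type y has four. For the replacement of D/k the substitution is therefore
-- spent on the two roots of the first factor. That factor then no longer depends on k and is
-- removed by Cauchy-Schwarz, while the second factors acquire a common root, which a dilation of r
-- cancels. Only at that point are the forms linear, so that pairs of distinct roots suffice.
--
-- The laws have to be chosen before the colouring of the rationals is known, because that colouring
-- is obtained by clearing a denominator which depends on all of them. Hence every alternative of
-- the energy iteration is prepared in advance: finite lists of possible outcomes are carried along,
-- and later laws are generic with respect to all of them.
--
-- All colour classes are treated together by averaging over a random colour as well; the indicator
-- then has the same mean at every point. Each Cauchy-Schwarz costs a square root and three are
-- nested, whence δ₂ = δ₁², δ₃ = δ₂², h = δ₃².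

module PartitionRegularity where
  open import Data.Nat as ℕ using (ℕ; zero; suc)
  import Data.Nat.Properties as ℕ
  import Data.Fin.Properties as FinP
  open import Data.Fin as Fin using (Fin; zero; suc; inject₁; fromℕ)
  open import Data.Rational hiding (_≟_)
  open import Data.Rational.Properties
  import Data.Rational.Properties as ℚ
  open import Data.Product using (Σ; ∃; _×_; _,_; proj₁; proj₂; Σ-syntax; ∃-syntax)
  open import Data.Sum using (_⊎_; inj₁; inj₂; [_,_]′)
  open import Data.Empty using (⊥; ⊥-elim)
  open import Data.Unit using (⊤; tt)
  open import Data.List using (List; []; _∷_; _++_; map; cartesianProductWith)
  open import Function using (_∘_; id)
  open import Relation.Nullary using (¬_; Dec; yes; no)
  open import Relation.Nullary.Decidable using (dec⇒maybe; True; toWitness; from-yes; from-no)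
  open import Relation.Binary.PropositionalEquality
    using (_≡_; _≢_; refl; sym; trans; cong; cong₂; subst; subst₂; module ≡-Reasoning)
  open import Tactic.RingSolver using (solve-∀)
  open import Tactic.RingSolver.Core.AlmostCommutativeRing using (AlmostCommutativeRing; fromCommutativeRing)
  open import Data.List using (concat; allFin; length)
  open import Data.List.Membership.Propositional using (_∈_)
  open import Data.List.Membership.Propositional.Properties
    using (∈-++⁺ˡ; ∈-++⁺ʳ; ∈-map⁺; ∈-concat⁺′; ∈-allFin; ∈-cartesianProductWith⁺; ∈-cartesianProductWith⁻; ∈-++⁻; ∈-map⁻; ∈-concat⁻′)
  open import Data.List.Relation.Unary.Any using (here; there)
  import Data.Integer as ℤ
  import Data.Integer.Properties as ℤ
  import Data.Rational.Unnormalised as ℚᵘ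
  import Data.Rational.Unnormalised.Properties as ℚᵘ
  import Data.Nat.Coprimality as Coprime

  private
    variable
      𝒳 𝒴 𝒵 : Set

  -- Arithmetic and inequalities in ℚ.

  ℚ-ring : AlmostCommutativeRing _ _
  ℚ-ring = fromCommutativeRing +-*-commutativeRing (λ x → dec⇒maybe (0ℚ ℚ.≟ x))

  opaque
    -- inv 0 = 0
    inv : ℚ → ℚ
    inv p with p ℚ.≟ 0ℚ
    ... | yes _ = 0ℚ
    ... | no p≢0 = (1/ p) {{≢-nonZero p≢0}}

    *-invʳ : ∀ {p} → p ≢ 0ℚ → p * inv p ≡ 1ℚ
    *-invʳ {p} p≢0 with p ℚ.≟ 0ℚ
    ... | yes p≡0 = ⊥-elim (p≢0 p≡0)
    ... | no q = *-inverseʳ p {{≢-nonZero q}}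

  *≢0 : ∀ {p q} → p ≢ 0ℚ → q ≢ 0ℚ → p * q ≢ 0ℚ
  *≢0 {p} {q} p≢0 q≢0 pq≡0 = p≢0 (begin
    p              ≡⟨ sym (*-identityʳ p) ⟩
    p * 1ℚ         ≡⟨ cong (p *_) (sym (*-invʳ q≢0)) ⟩
    p * (q * inv q) ≡⟨ sym (*-assoc p q (inv q)) ⟩
    p * q * inv q  ≡⟨ cong (_* inv q) pq≡0 ⟩
    0ℚ * inv q     ≡⟨ *-zeroˡ (inv q) ⟩
    0ℚ             ∎)
    where open ≡-Reasoning

  inv≢0 : ∀ {p} → p ≢ 0ℚ → inv p ≢ 0ℚ
  inv≢0 {p} p≢0 e = 1≢0 (trans (sym (*-invʳ p≢0)) (trans (cong (p *_) e) (*-zeroʳ p)))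

  inv-unique : ∀ {p q} → p * q ≡ 1ℚ → inv p ≡ q
  inv-unique {p} {q} pq≡1 = begin
    inv p           ≡⟨ sym (*-identityʳ (inv p)) ⟩
    inv p * 1ℚ      ≡⟨ cong (inv p *_) (sym pq≡1) ⟩
    inv p * (p * q) ≡⟨ reorder (inv p) p q ⟩
    p * inv p * q   ≡⟨ cong (_* q) (*-invʳ p≢0) ⟩
    1ℚ * q          ≡⟨ *-identityˡ q ⟩
    q               ∎
    where
    open ≡-Reasoning
    reorder : ∀ a b c → a * (b * c) ≡ b * a * c
    reorder = solve-∀ ℚ-ring
    p≢0 : p ≢ 0ℚ
    p≢0 refl = 1≢0 (trans (sym pq≡1) (*-zeroˡ q))

  inv-* : ∀ {p q} → p ≢ 0ℚ → q ≢ 0ℚ → inv (p * q) ≡ inv p * inv q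
  inv-* {p} {q} p≢0 q≢0 = inv-unique (begin
    p * q * (inv p * inv q)   ≡⟨ reorder p q (inv p) (inv q) ⟩
    p * inv p * (q * inv q)   ≡⟨ cong₂ _*_ (*-invʳ p≢0) (*-invʳ q≢0) ⟩
    1ℚ                        ∎)
    where
    open ≡-Reasoning
    reorder : ∀ a b c d → a * b * (c * d) ≡ a * c * (b * d)
    reorder = solve-∀ ℚ-ring

  *-cancelʳ : ∀ {p q r} → r ≢ 0ℚ → p * r ≡ q * r → p ≡ q
  *-cancelʳ {p} {q} {r} r≢0 e = begin
    p                ≡⟨ lem p ⟩
    p * r * inv r    ≡⟨ cong (_* inv r) e ⟩
    q * r * inv r    ≡⟨ sym (lem q) ⟩
    q                ∎
    where
    open ≡-Reasoning
    lem : ∀ x → x ≡ x * r * inv r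
    lem x = begin
      x               ≡⟨ sym (*-identityʳ x) ⟩
      x * 1ℚ          ≡⟨ cong (x *_) (sym (*-invʳ r≢0)) ⟩
      x * (r * inv r) ≡⟨ sym (*-assoc x r (inv r)) ⟩
      x * r * inv r   ∎

  -≢0 : ∀ {p q} → p ≢ q → p - q ≢ 0ℚ
  -≢0 {p} {q} p≢q e = p≢q (begin
    p          ≡⟨ lem p q ⟩
    p - q + q  ≡⟨ cong (_+ q) e ⟩
    0ℚ + q     ≡⟨ +-identityˡ q ⟩
    q          ∎)
    where
    open ≡-Reasoning
    lem : ∀ p q → p ≡ p - q + q
    lem = solve-∀ ℚ-ring

  -- Inequalities are mostly proved by exhibiting the nonnegative difference.
  ≤-by : ∀ {a b d} → 0ℚ ≤ d → b ≡ a + d → a ≤ b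
  ≤-by {a} {b} {d} 0≤d refl = subst (_≤ a + d) (+-identityʳ a) (+-monoʳ-≤ a 0≤d)

  0≤diff : ∀ {a b} → a ≤ b → 0ℚ ≤ b - a
  0≤diff {a} {b} a≤b = subst (_≤ b - a) (+-inverseʳ a) (+-monoˡ-≤ (- a) a≤b)

  0≤+ : ∀ {a b} → 0ℚ ≤ a → 0ℚ ≤ b → 0ℚ ≤ a + b
  0≤+ = +-mono-≤

  0≤* : ∀ {a b} → 0ℚ ≤ a → 0ℚ ≤ b → 0ℚ ≤ a * b
  0≤* {a} {b} 0≤a 0≤b = subst (_≤ a * b) (*-zeroʳ a) (*-monoˡ-≤-nonNeg a {{nonNegative 0≤a}} 0≤b)

  *-monoˡ : ∀ {a b c} → 0ℚ ≤ a → b ≤ c → a * b ≤ a * c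
  *-monoˡ {a} 0≤a = *-monoˡ-≤-nonNeg a {{nonNegative 0≤a}}

  *-monoʳ : ∀ {a b c} → 0ℚ ≤ a → b ≤ c → b * a ≤ c * a
  *-monoʳ {a} 0≤a = *-monoʳ-≤-nonNeg a {{nonNegative 0≤a}}

  *-mono-≤ : ∀ {a b c d} → 0ℚ ≤ a → 0ℚ ≤ d → a ≤ b → c ≤ d → a * c ≤ b * d
  *-mono-≤ 0≤a 0≤d a≤b c≤d = ≤-trans (*-monoˡ 0≤a c≤d) (*-monoʳ 0≤d a≤b)

  sq≥0 : ∀ a → 0ℚ ≤ a * a
  sq≥0 a with ≤-total 0ℚ a
  ... | inj₁ 0≤a = 0≤* 0≤a 0≤a
  ... | inj₂ a≤0 = subst (0ℚ ≤_) (lem a) (0≤* 0≤-a 0≤-a)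
    where
    lem : ∀ a → - a * - a ≡ a * a
    lem = solve-∀ ℚ-ring
    0≤-a : 0ℚ ≤ - a
    0≤-a = neg-antimono-≤ a≤0

  sq-cancel-≤ : ∀ {a b} → 0ℚ ≤ b → a * a ≤ b * b → a ≤ b
  sq-cancel-≤ {a} {b} 0≤b a²≤b² with ≤-total a b
  ... | inj₁ a≤b = a≤b
  ... | inj₂ b≤a with a ℚ.≟ b
  ...   | yes a≡b = ≤-reflexive a≡b
  ...   | no a≢b = ⊥-elim (<-irrefl refl (<-≤-trans b²<a² a²≤b²))
    where
    b<a : b < a
    b<a = ≰⇒> (λ a≤b → a≢b (≤-antisym a≤b b≤a))
    0<a : 0ℚ < a
    0<a = ≤-<-trans 0≤b b<a
    b²<a² : b * b < a * a
    b²<a² = ≤-<-trans (*-monoˡ 0≤b b≤a) (*-monoˡ-<-pos a {{positive 0<a}} b<a)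

  ∣∣-≤ : ∀ {x b} → - b ≤ x → x ≤ b → ∣ x ∣ ≤ b
  ∣∣-≤ {x} {b} lo hi with ∣p∣≡p∨∣p∣≡-p x
  ... | inj₁ e = subst (_≤ b) (sym e) hi
  ... | inj₂ e = subst (_≤ b) (sym e) (subst (- x ≤_) (neg-involutive b) (neg-antimono-≤ lo))
    where
    neg-involutive : ∀ p → - (- p) ≡ p
    neg-involutive = solve-∀ ℚ-ring

  x≤∣x∣ : ∀ x → x ≤ ∣ x ∣
  x≤∣x∣ x with ≤-total 0ℚ x
  ... | inj₁ 0≤x = ≤-reflexive (sym (0≤p⇒∣p∣≡p 0≤x))
  ... | inj₂ x≤0 = ≤-trans x≤0 (0≤∣p∣ x)

  -∣x∣≤x : ∀ x → - ∣ x ∣ ≤ x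
  -∣x∣≤x x = subst (- ∣ x ∣ ≤_) (lem x) (neg-antimono-≤ (subst (- x ≤_) (∣-p∣≡∣p∣ x) (x≤∣x∣ (- x))))
    where
    lem : ∀ p → - (- p) ≡ p
    lem = solve-∀ ℚ-ring

  ∣∣≤⇒≤ : ∀ {x b} → ∣ x ∣ ≤ b → x ≤ b
  ∣∣≤⇒≤ {x} = ≤-trans (x≤∣x∣ x)

  ∣∣-sq : ∀ x → ∣ x ∣ * ∣ x ∣ ≡ x * x
  ∣∣-sq x = trans (sym (∣p*q∣≡∣p∣*∣q∣ x x)) (0≤p⇒∣p∣≡p (sq≥0 x))

  ∣∣-sq≤ : ∀ {x b} → ∣ x ∣ ≤ b → x * x ≤ b * b
  ∣∣-sq≤ {x} {b} h = subst (_≤ b * b) (∣∣-sq x) (*-mono-≤ (0≤∣p∣ x) (≤-trans (0≤∣p∣ x) h) h h)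

  sq≤⇒∣∣≤ : ∀ {x b} → 0ℚ ≤ b → x * x ≤ b * b → ∣ x ∣ ≤ b
  sq≤⇒∣∣≤ {x} {b} 0≤b h = sq-cancel-≤ 0≤b (subst (_≤ b * b) (sym (∣∣-sq x)) h)

  ∣∣-*-≤ : ∀ x y {a b} → ∣ x ∣ ≤ a → ∣ y ∣ ≤ b → ∣ x * y ∣ ≤ a * b
  ∣∣-*-≤ x y {a} {b} hx hy =
    subst (_≤ a * b) (sym (∣p*q∣≡∣p∣*∣q∣ x y)) (*-mono-≤ (0≤∣p∣ x) (≤-trans (0≤∣p∣ y) hy) hx hy)

  ∣∣-+-≤ : ∀ x y {a b} → ∣ x ∣ ≤ a → ∣ y ∣ ≤ b → ∣ x + y ∣ ≤ a + b
  ∣∣-+-≤ x y hx hy = ≤-trans (∣p+q∣≤∣p∣+∣q∣ x y) (+-mono-≤ hx hy)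

  ∣∣-−-≤ : ∀ x y {a b} → ∣ x ∣ ≤ a → ∣ y ∣ ≤ b → ∣ x - y ∣ ≤ a + b
  ∣∣-−-≤ x y hx hy = ≤-trans (∣p-q∣≤∣p∣+∣q∣ x y) (+-mono-≤ hx hy)

  ∣-∣-comm : ∀ x y → ∣ x - y ∣ ≡ ∣ y - x ∣
  ∣-∣-comm x y = trans (cong ∣_∣ (lem x y)) (∣-p∣≡∣p∣ (y - x))
    where
    lem : ∀ x y → x - y ≡ - (y - x)
    lem = solve-∀ ℚ-ring

  ∣-∣-trans : ∀ x y z {a b} → ∣ x - y ∣ ≤ a → ∣ y - z ∣ ≤ b → ∣ x - z ∣ ≤ a + b
  ∣-∣-trans x y z {a} {b} h k = subst (λ t → ∣ t ∣ ≤ a + b) (lem x y z) (∣∣-+-≤ (x - y) (y - z) h k)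
    where
    lem : ∀ x y z → (x - y) + (y - z) ≡ x - z
    lem = solve-∀ ℚ-ring

  close-≤ : ∀ x y {b} → ∣ x - y ∣ ≤ b → x ≤ y + b
  close-≤ x y {b} h = subst (_≤ y + b) (lem x y) (+-monoʳ-≤ y (∣∣≤⇒≤ h))
    where
    lem : ∀ x y → y + (x - y) ≡ x
    lem = solve-∀ ℚ-ring

  0<1 : 0ℚ < 1ℚ
  0<1 = positive⁻¹ 1ℚ

  0≤1 : 0ℚ ≤ 1ℚ
  0≤1 = <⇒≤ 0<1

  -- Natural numbers in ℚ and finite sums.

  nat : ℕ → ℚ
  nat zero = 0ℚ
  nat (suc n) = nat n + 1ℚ

  0≤nat : ∀ n → 0ℚ ≤ nat n
  0≤nat zero = ≤-refl
  0≤nat (suc n) = 0≤+ (0≤nat n) 0≤1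

  0<nat : ∀ n → 0ℚ < nat (suc n)
  0<nat n = <-≤-trans 0<1 (≤-by (0≤nat n) (+-comm (nat n) 1ℚ))

  nat≢0 : ∀ n → nat (suc n) ≢ 0ℚ
  nat≢0 n e = <-irrefl (sym e) (0<nat n)

  0≤inv : ∀ {p} → 0ℚ < p → 0ℚ ≤ inv p
  0≤inv {p} 0<p = *-cancelˡ-≤-pos p {{positive 0<p}}
    (≤-trans (≤-reflexive (*-zeroʳ p)) (≤-trans 0≤1 (≤-reflexive (sym (*-invʳ (λ e → <-irrefl (sym e) 0<p))))))

  -- The last index is split off because, in a hierarchy of laws, the last one is chosen with
  -- knowledge of all the others.
  sumF : (n : ℕ) → (Fin n → ℚ) → ℚ
  sumF zero h = 0ℚ
  sumF (suc n) h = sumF n (h ∘ inject₁) + h (fromℕ n)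

  sumF-cong : ∀ n {g h : Fin n → ℚ} → (∀ i → g i ≡ h i) → sumF n g ≡ sumF n h
  sumF-cong zero e = refl
  sumF-cong (suc n) e = cong₂ _+_ (sumF-cong n (e ∘ inject₁)) (e (fromℕ n))

  sumF-mono : ∀ n {g h : Fin n → ℚ} → (∀ i → g i ≤ h i) → sumF n g ≤ sumF n h
  sumF-mono zero e = ≤-refl
  sumF-mono (suc n) e = +-mono-≤ (sumF-mono n (e ∘ inject₁)) (e (fromℕ n))

  sumF-+ : ∀ n (g h : Fin n → ℚ) → sumF n (λ i → g i + h i) ≡ sumF n g + sumF n h
  sumF-+ zero g h = refl
  sumF-+ (suc n) g h = trans (cong (_+ (g (fromℕ n) + h (fromℕ n))) (sumF-+ n (g ∘ inject₁) (h ∘ inject₁)))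
    (lem (sumF n (g ∘ inject₁)) (sumF n (h ∘ inject₁)) (g (fromℕ n)) (h (fromℕ n)))
    where
    lem : ∀ a b c d → a + b + (c + d) ≡ a + c + (b + d)
    lem = solve-∀ ℚ-ring

  sumF-* : ∀ n c (h : Fin n → ℚ) → sumF n (λ i → c * h i) ≡ c * sumF n h
  sumF-* zero c h = sym (*-zeroʳ c)
  sumF-* (suc n) c h = trans (cong (_+ c * h (fromℕ n)) (sumF-* n c (h ∘ inject₁)))
    (sym (*-distribˡ-+ c _ _))

  sumF-const : ∀ n c → sumF n (λ _ → c) ≡ nat n * c
  sumF-const zero c = sym (*-zeroˡ c)
  sumF-const (suc n) c = trans (cong (_+ c) (sumF-const n c)) (lem (nat n) c)
    where
    lem : ∀ a c → a * c + c ≡ (a + 1ℚ) * c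
    lem = solve-∀ ℚ-ring

  -- Expectations under finite laws.

  -- Finitely supported probability laws; they also serve as finite nonempty collections.
  data Law (𝒳 : Set) : Set where
    ret : 𝒳 → Law 𝒳
    avg : (n : ℕ) → (Fin (suc n) → Law 𝒳) → Law 𝒳

  Supp : {𝒳 : Set} → Law 𝒳 → 𝒳 → Set
  Supp (ret a) x = x ≡ a
  Supp (avg n ℓ) x = Σ[ i ∈ Fin (suc n) ] Supp (ℓ i) x

  bind : {𝒳 𝒴 : Set} → Law 𝒳 → (𝒳 → Law 𝒴) → Law 𝒴
  bind (ret a) h = h a
  bind (avg n ℓ) h = avg n (λ i → bind (ℓ i) h)

  swap-factors : ∀ a b c → a * (b * c) ≡ b * (a * c)
  swap-factors = solve-∀ ℚ-ring

  rotate-factors : ∀ a b c → a * (b * c) ≡ b * a * c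
  rotate-factors = solve-∀ ℚ-ring

  E : {𝒳 : Set} → Law 𝒳 → (𝒳 → ℚ) → ℚ
  E (ret a) g = g a
  E (avg n ℓ) g = inv (nat (suc n)) * sumF (suc n) (λ i → E (ℓ i) g)

  0≤wt : ∀ n → 0ℚ ≤ inv (nat (suc n))
  0≤wt n = 0≤inv (0<nat n)

  E-mono : (L : Law 𝒳) {g h : 𝒳 → ℚ} → (∀ a → Supp L a → g a ≤ h a) → E L g ≤ E L h
  E-mono (ret a) e = e a refl
  E-mono (avg n ℓ) e = *-monoˡ (0≤wt n) (sumF-mono (suc n) (λ i → E-mono (ℓ i) (λ a s → e a (i , s))))

  E-cong : (L : Law 𝒳) {g h : 𝒳 → ℚ} → (∀ a → Supp L a → g a ≡ h a) → E L g ≡ E L h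
  E-cong (ret a) e = e a refl
  E-cong (avg n ℓ) e = cong (inv (nat (suc n)) *_) (sumF-cong (suc n) (λ i → E-cong (ℓ i) (λ a s → e a (i , s))))

  E-ext : (L : Law 𝒳) {g h : 𝒳 → ℚ} → (∀ a → g a ≡ h a) → E L g ≡ E L h
  E-ext L e = E-cong L (λ a _ → e a)

  E-* : (L : Law 𝒳) (c : ℚ) (g : 𝒳 → ℚ) → E L (λ a → c * g a) ≡ c * E L g
  E-* (ret a) c g = refl
  E-* (avg n ℓ) c g = begin
    w * sumF (suc n) (λ i → E (ℓ i) (λ a → c * g a))  ≡⟨ cong (w *_) (sumF-cong (suc n) (λ i → E-* (ℓ i) c g)) ⟩
    w * sumF (suc n) (λ i → c * E (ℓ i) g)            ≡⟨ cong (w *_) (sumF-* (suc n) c (λ i → E (ℓ i) g)) ⟩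
    w * (c * S)                                      ≡⟨ swap-factors w c S ⟩
    c * (w * S)                                      ∎
    where
    open ≡-Reasoning
    w = inv (nat (suc n))
    S = sumF (suc n) (λ i → E (ℓ i) g)

  E-+ : (L : Law 𝒳) (g h : 𝒳 → ℚ) → E L (λ a → g a + h a) ≡ E L g + E L h
  E-+ (ret a) g h = refl
  E-+ (avg n ℓ) g h = begin
    w * sumF (suc n) (λ i → E (ℓ i) (λ a → g a + h a))  ≡⟨ cong (w *_) (sumF-cong (suc n) (λ i → E-+ (ℓ i) g h)) ⟩
    w * sumF (suc n) (λ i → E (ℓ i) g + E (ℓ i) h)      ≡⟨ cong (w *_) (sumF-+ (suc n) (λ i → E (ℓ i) g) (λ i → E (ℓ i) h)) ⟩
    w * (sumF (suc n) (λ i → E (ℓ i) g) + sumF (suc n) (λ i → E (ℓ i) h)) ≡⟨ *-distribˡ-+ w _ _ ⟩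
    E (avg n ℓ) g + E (avg n ℓ) h                      ∎
    where
    open ≡-Reasoning
    w = inv (nat (suc n))

  E-const : (L : Law 𝒳) (c : ℚ) → E L (λ _ → c) ≡ c
  E-const (ret a) c = refl
  E-const (avg n ℓ) c = begin
    w * sumF (suc n) (λ i → E (ℓ i) (λ _ → c)) ≡⟨ cong (w *_) (sumF-cong (suc n) (λ i → E-const (ℓ i) c)) ⟩
    w * sumF (suc n) (λ _ → c)                ≡⟨ cong (w *_) (sumF-const (suc n) c) ⟩
    w * (nat (suc n) * c)                     ≡⟨ rotate-factors w (nat (suc n)) c ⟩
    nat (suc n) * w * c                       ≡⟨ cong (_* c) (*-invʳ (nat≢0 n)) ⟩
    1ℚ * c                                    ≡⟨ *-identityˡ c ⟩
    c                                         ∎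
    where
    open ≡-Reasoning
    w = inv (nat (suc n))

  E-neg : (L : Law 𝒳) (g : 𝒳 → ℚ) → E L (λ a → - g a) ≡ - E L g
  E-neg L g = trans (E-ext L (λ a → lem (g a))) (trans (E-* L (- 1ℚ) g) (sym (lem (E L g))))
    where
    lem : ∀ x → - x ≡ - 1ℚ * x
    lem = solve-∀ ℚ-ring

  E-− : (L : Law 𝒳) (g h : 𝒳 → ℚ) → E L (λ a → g a - h a) ≡ E L g - E L h
  E-− L g h = trans (E-+ L g (λ a → - h a)) (cong (λ t → E L g + t) (E-neg L h))

  E-*ʳ : (L : Law 𝒳) (c : ℚ) (g : 𝒳 → ℚ) → E L (λ a → g a * c) ≡ E L g * c
  E-*ʳ L c g = trans (E-ext L (λ a → *-comm (g a) c)) (trans (E-* L c g) (*-comm c (E L g)))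

  sumF-E : (n : ℕ) (L : Law 𝒳) (g : Fin n → 𝒳 → ℚ) →
    sumF n (λ i → E L (g i)) ≡ E L (λ a → sumF n (λ i → g i a))
  sumF-E zero L g = sym (E-const L 0ℚ)
  sumF-E (suc n) L g = trans (cong (_+ E L (g (fromℕ n))) (sumF-E n L (g ∘ inject₁)))
    (sym (E-+ L (λ a → sumF n (λ i → g (inject₁ i) a)) (g (fromℕ n))))

  E-swap : (L : Law 𝒳) (M : Law 𝒴) (g : 𝒳 → 𝒴 → ℚ) →
    E L (λ a → E M (g a)) ≡ E M (λ b → E L (λ a → g a b))
  E-swap (ret a) M g = refl
  E-swap (avg n ℓ) M g = begin
    w * sumF (suc n) (λ i → E (ℓ i) (λ a → E M (g a)))         ≡⟨ cong (w *_) (sumF-cong (suc n) (λ i → E-swap (ℓ i) M g)) ⟩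
    w * sumF (suc n) (λ i → E M (λ b → E (ℓ i) (λ a → g a b))) ≡⟨ cong (w *_) (sumF-E (suc n) M (λ i b → E (ℓ i) (λ a → g a b))) ⟩
    w * E M (λ b → sumF (suc n) (λ i → E (ℓ i) (λ a → g a b))) ≡⟨ sym (E-* M w _) ⟩
    E M (λ b → E (avg n ℓ) (λ a → g a b))                     ∎
    where
    open ≡-Reasoning
    w = inv (nat (suc n))

  E-bind : (L : Law 𝒳) (h : 𝒳 → Law 𝒴) (g : 𝒴 → ℚ) → E (bind L h) g ≡ E L (λ a → E (h a) g)
  E-bind (ret a) h g = refl
  E-bind (avg n ℓ) h g = cong (inv (nat (suc n)) *_) (sumF-cong (suc n) (λ i → E-bind (ℓ i) h g))

  Supp-bind : (L : Law 𝒳) (h : 𝒳 → Law 𝒴) {b : 𝒴} → Supp (bind L h) b → Σ[ a ∈ 𝒳 ] Supp L a × Supp (h a) b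
  Supp-bind (ret a) h s = a , refl , s
  Supp-bind (avg n ℓ) h (i , s) with Supp-bind (ℓ i) h s
  ... | a , s₁ , s₂ = a , (i , s₁) , s₂

  E-≤ : (L : Law 𝒳) {g : 𝒳 → ℚ} {b : ℚ} → (∀ a → Supp L a → g a ≤ b) → E L g ≤ b
  E-≤ L {g} {b} e = subst (E L g ≤_) (E-const L b) (E-mono L e)

  E-≥ : (L : Law 𝒳) {g : 𝒳 → ℚ} {b : ℚ} → (∀ a → Supp L a → b ≤ g a) → b ≤ E L g
  E-≥ L {g} {b} e = subst (_≤ E L g) (E-const L b) (E-mono L e)

  E-0≤ : (L : Law 𝒳) {g : 𝒳 → ℚ} → (∀ a → 0ℚ ≤ g a) → 0ℚ ≤ E L g
  E-0≤ L e = E-≥ L (λ a _ → e a)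

  E-∣∣ : (L : Law 𝒳) {g : 𝒳 → ℚ} {b : ℚ} → (∀ a → Supp L a → ∣ g a ∣ ≤ b) → ∣ E L g ∣ ≤ b
  E-∣∣ L {g} {b} e = ∣∣-≤
    (E-≥ L (λ a s → ≤-trans (neg-antimono-≤ (e a s)) (-∣x∣≤x (g a))))
    (E-≤ L (λ a s → ∣∣≤⇒≤ (e a s)))

  E-close : (L : Law 𝒳) {g h : 𝒳 → ℚ} {b : ℚ} → (∀ a → Supp L a → ∣ g a - h a ∣ ≤ b) → ∣ E L g - E L h ∣ ≤ b
  E-close L {g} {h} {b} e = subst (λ t → ∣ t ∣ ≤ b) (E-− L g h) (E-∣∣ L e)

  E-∣∣≤E∣∣ : (L : Law 𝒳) (g : 𝒳 → ℚ) → ∣ E L g ∣ ≤ E L (λ a → ∣ g a ∣)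
  E-∣∣≤E∣∣ L g = ∣∣-≤
    (subst (_≤ E L g) (E-neg L (λ a → ∣ g a ∣)) (E-mono L (λ a _ → -∣x∣≤x (g a))))
    (E-mono L (λ a _ → x≤∣x∣ (g a)))

  -- From E (g - E g)² ≥ 0.
  jensen : (L : Law 𝒳) (g : 𝒳 → ℚ) → E L g * E L g ≤ E L (λ a → g a * g a)
  jensen L g = ≤-by 0≤var (sym (begin
    m * m + E L (λ a → (g a - m) * (g a - m))                 ≡⟨ cong (m * m +_) (E-ext L (λ a → lem (g a) m)) ⟩
    m * m + E L (λ a → g a * g a + (g a * (- (m + m)) + m * m)) ≡⟨ cong (m * m +_) (E-+ L _ _) ⟩
    m * m + (E L (λ a → g a * g a) + E L (λ a → g a * (- (m + m)) + m * m)) ≡⟨ cong (λ t → m * m + (q + t))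
        (trans (E-+ L _ _) (cong₂ _+_ (E-*ʳ L (- (m + m)) g) (E-const L (m * m)))) ⟩
    m * m + (q + (m * (- (m + m)) + m * m))                   ≡⟨ lem2 m q ⟩
    q                                                         ∎))
    where
    open ≡-Reasoning
    m = E L g
    q = E L (λ a → g a * g a)
    0≤var : 0ℚ ≤ E L (λ a → (g a - m) * (g a - m))
    0≤var = E-0≤ L (λ a → sq≥0 (g a - m))
    lem : ∀ x m → (x - m) * (x - m) ≡ x * x + (x * (- (m + m)) + m * m)
    lem = solve-∀ ℚ-ring
    lem2 : ∀ m q → m * m + (q + (m * (- (m + m)) + m * m)) ≡ q
    lem2 = solve-∀ ℚ-ring

  -- Kronecker delta; it carries the exceptional cost of coinciding roots through the averages.
  eq : ℚ → ℚ → ℚ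
  eq a b with a ℚ.≟ b
  ... | yes _ = 1ℚ
  ... | no _ = 0ℚ

  eq-≢ : ∀ {a b} → a ≢ b → eq a b ≡ 0ℚ
  eq-≢ {a} {b} a≢b with a ℚ.≟ b
  ... | yes e = ⊥-elim (a≢b e)
  ... | no _ = refl

  sumF-0 : ∀ n {g : Fin n → ℚ} → (∀ i → g i ≡ 0ℚ) → sumF n g ≡ 0ℚ
  sumF-0 n e = trans (sumF-cong n e) (trans (sumF-const n 0ℚ) (*-zeroʳ (nat n)))

  fromℕ≢inject₁ : ∀ {n} (i : Fin n) → fromℕ n ≢ inject₁ i
  fromℕ≢inject₁ {suc n} (suc i) e = fromℕ≢inject₁ i (FinP.suc-injective e)

  sumF-eq≤1 : ∀ n (a : ℚ) (g : Fin n → ℚ) → (∀ {i j} → g i ≡ g j → i ≡ j) → sumF n (λ i → eq a (g i)) ≤ 1ℚ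
  sumF-eq≤1 zero a g inj = 0≤1
  sumF-eq≤1 (suc n) a g inj with a ℚ.≟ g (fromℕ n)
  ... | yes e = ≤-reflexive (cong (_+ 1ℚ) (sumF-0 n (λ i → eq-≢ (λ e′ → fromℕ≢inject₁ i (inj (trans (sym e) e′))))))
  ... | no _ = subst (_≤ 1ℚ) (sym (+-identityʳ _)) (sumF-eq≤1 n a (g ∘ inject₁) (λ e → FinP.inject₁-injective (inj e)))

  infixl 6 _∪_
  _∪_ : (ℚ → Set) → (ℚ → Set) → ℚ → Set
  (S ∪ S′) x = S x ⊎ S′ x

  2ℚ 4ℚ : ℚ
  2ℚ = 1ℚ + 1ℚ
  4ℚ = 2ℚ + 2ℚ

  -- The second-moment method.

  -- Second moment of a sum of hierarchically ordered terms: only the correlations of each term with the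
  -- sum of its predecessors enter.
  module _ {𝒳 𝒵 : Set} (Σ′ : Law 𝒵) (g : 𝒳 → 𝒵 → ℚ) where

    partial : (n : ℕ) → (Fin n → Law 𝒳) → 𝒵 → ℚ
    partial n η t = sumF n (λ i → E (η i) (λ a → g a t))

    Cross : (b : ℚ) (n : ℕ) → (Fin n → Law 𝒳) → Set
    Cross b zero η = ⊤
    Cross b (suc n) η = Cross b n (η ∘ inject₁) ×
      E Σ′ (λ t → partial n (η ∘ inject₁) t * E (η (fromℕ n)) (λ a → g a t)) ≤ b

    second-moment : ∀ b n η → (∀ i a → Supp (η i) a → ∀ t → Supp Σ′ t → ∣ g a t ∣ ≤ 2ℚ) → Cross b n η →
      E Σ′ (λ t → partial n η t * partial n η t) ≤ nat n * (4ℚ + (b + b))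
    second-moment b zero η bd cr = ≤-reflexive (trans (E-const Σ′ 0ℚ) (sym (*-zeroˡ (4ℚ + (b + b)))))
    second-moment b (suc n) η bd (cr , c) = begin
      E Σ′ (λ t → (Y t + G t) * (Y t + G t))                             ≡⟨ E-ext Σ′ (λ t → sq (Y t) (G t)) ⟩
      E Σ′ (λ t → Y t * Y t + (Y t * G t + Y t * G t + G t * G t))       ≡⟨ E-+ Σ′ _ _ ⟩
      E Σ′ (λ t → Y t * Y t) + E Σ′ (λ t → Y t * G t + Y t * G t + G t * G t) ≡⟨ cong (E Σ′ (λ t → Y t * Y t) +_)
          (trans (E-+ Σ′ _ _) (cong (_+ E Σ′ (λ t → G t * G t)) (E-+ Σ′ _ _))) ⟩
      E Σ′ (λ t → Y t * Y t) + (E Σ′ (λ t → Y t * G t) + E Σ′ (λ t → Y t * G t) + E Σ′ (λ t → G t * G t)) ≤⟨ +-mono-≤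
          (second-moment b n (η ∘ inject₁) (λ i → bd (inject₁ i)) cr) (+-mono-≤ (+-mono-≤ c c) G²) ⟩
      nat n * (4ℚ + (b + b)) + (b + b + 4ℚ)                              ≡⟨ fin (nat n) b ⟩
      nat (suc n) * (4ℚ + (b + b))                                       ∎
      where
      open ≤-Reasoning
      Y = partial n (η ∘ inject₁)
      G : 𝒵 → ℚ
      G t = E (η (fromℕ n)) (λ a → g a t)
      sq : ∀ y g → (y + g) * (y + g) ≡ y * y + (y * g + y * g + g * g)
      sq = solve-∀ ℚ-ring
      fin : ∀ n b → n * (4ℚ + (b + b)) + (b + b + 4ℚ) ≡ (n + 1ℚ) * (4ℚ + (b + b))
      fin = solve-∀ ℚ-ring
      G² : E Σ′ (λ t → G t * G t) ≤ 4ℚ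
      G² = E-≤ Σ′ (λ t s → ∣∣-sq≤ (E-∣∣ (η (fromℕ n)) (λ a s′ → bd (fromℕ n) a s′ t s)))

    -- The simple source of cross-term bounds: pairwise almost orthogonality. For the replacement of
    -- D/k the correlation with the whole prefix is estimated at once instead.
    cross-termwise : ∀ b n (η : Fin n → Law 𝒳) (λ′ : Law 𝒳) →
      (∀ i k → Supp (η i) k → ∀ l → Supp λ′ l → E Σ′ (λ t → g k t * g l t) ≤ b) →
      E Σ′ (λ t → partial n η t * E λ′ (λ a → g a t)) ≤ nat n * b
    cross-termwise b n η λ′ hyp = begin
      E Σ′ (λ t → partial n η t * G t)                                   ≡⟨ E-ext Σ′
          (λ t → trans (*-comm (partial n η t) (G t)) (sym (sumF-* n (G t) _))) ⟩
      E Σ′ (λ t → sumF n (λ i → G t * E (η i) (λ k → g k t)))            ≡⟨ sym (sumF-E n Σ′ _) ⟩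
      sumF n (λ i → E Σ′ (λ t → G t * E (η i) (λ k → g k t)))            ≤⟨ sumF-mono n (λ i → term i) ⟩
      sumF n (λ _ → b)                                                   ≡⟨ sumF-const n b ⟩
      nat n * b                                                          ∎
      where
      open ≤-Reasoning
      G : 𝒵 → ℚ
      G t = E λ′ (λ a → g a t)
      term : ∀ i → E Σ′ (λ t → G t * E (η i) (λ k → g k t)) ≤ b
      term i = begin
        E Σ′ (λ t → G t * E (η i) (λ k → g k t))                         ≡⟨ E-ext Σ′ (λ t → sym (E-* (η i) (G t) (λ k → g k t))) ⟩
        E Σ′ (λ t → E (η i) (λ k → G t * g k t))                         ≡⟨ E-swap Σ′ (η i) _ ⟩
        E (η i) (λ k → E Σ′ (λ t → G t * g k t))                         ≤⟨ E-≤ (η i) (λ k s → inner k s) ⟩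
        b                                                                ∎
        where
        inner : ∀ k → Supp (η i) k → E Σ′ (λ t → G t * g k t) ≤ b
        inner k s = begin
          E Σ′ (λ t → G t * g k t)                                       ≡⟨ E-ext Σ′
              (λ t → trans (*-comm (G t) (g k t)) (sym (E-* λ′ (g k t) (λ l → g l t)))) ⟩
          E Σ′ (λ t → E λ′ (λ l → g k t * g l t))                        ≡⟨ E-swap Σ′ λ′ _ ⟩
          E λ′ (λ l → E Σ′ (λ t → g k t * g l t))                        ≤⟨ E-≤ λ′ (λ l s′ → hyp i k s l s′) ⟩
          b                                                              ∎

    second-moment-avg : ∀ n (η : Fin (suc n) → Law 𝒳) b → (∀ i a → Supp (η i) a → ∀ t → Supp Σ′ t → ∣ g a t ∣ ≤ 2ℚ) →
      Cross (nat (suc n) * b) (suc n) η →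
      E Σ′ (λ t → E (avg n η) (λ a → g a t) * E (avg n η) (λ a → g a t)) ≤ 4ℚ * inv (nat (suc n)) + (b + b)
    second-moment-avg n η b bd cr = begin
      E Σ′ (λ t → w * Y t * (w * Y t))      ≡⟨ E-ext Σ′ (λ t → sq w (Y t)) ⟩
      E Σ′ (λ t → w * w * (Y t * Y t))      ≡⟨ E-* Σ′ (w * w) _ ⟩
      w * w * E Σ′ (λ t → Y t * Y t)        ≤⟨ *-monoˡ (sq≥0 w) (second-moment (N * b) (suc n) η bd cr) ⟩
      w * w * (N * (4ℚ + (N * b + N * b)))  ≡⟨ re w N b ⟩
      w * (N * w) * 4ℚ + (N * w * (N * w) * b + N * w * (N * w) * b) ≡⟨ cong (λ t → w * t * 4ℚ + (t * t * b + t * t * b))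
          (*-invʳ (nat≢0 n)) ⟩
      w * 1ℚ * 4ℚ + (1ℚ * 1ℚ * b + 1ℚ * 1ℚ * b) ≡⟨ fin w b ⟩
      4ℚ * w + (b + b)                      ∎
      where
      open ≤-Reasoning
      w = inv (nat (suc n))
      N = nat (suc n)
      Y = partial (suc n) η
      sq : ∀ w y → w * y * (w * y) ≡ w * w * (y * y)
      sq = solve-∀ ℚ-ring
      re : ∀ w n b → w * w * (n * (4ℚ + (n * b + n * b))) ≡ w * (n * w) * 4ℚ + (n * w * (n * w) * b + n * w * (n * w) * b)
      re = solve-∀ ℚ-ring
      fin : ∀ w b → w * 1ℚ * 4ℚ + (1ℚ * 1ℚ * b + 1ℚ * 1ℚ * b) ≡ 4ℚ * w + (b + b)
      fin = solve-∀ ℚ-ring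

  -- Archimedean property and finite sets.

  nat-mono-suc : ∀ n → nat n ≤ nat (suc n)
  nat-mono-suc n = ≤-by 0≤1 refl

  inv-sym : ∀ {p} → p ≢ 0ℚ → inv p * p ≡ 1ℚ
  inv-sym {p} n = trans (*-comm (inv p) p) (*-invʳ n)

  archimedean : ∀ x → Σ[ n ∈ ℕ ] x ≤ nat n
  archimedean x@(mkℚ p d-1 _) = ℤ.∣ p ∣ , toℚᵘ-cancel-≤ (ℚᵘ.≤-respʳ-≃ (ℚᵘ.≃-sym (nat≃ ℤ.∣ p ∣)) (ℚᵘ.*≤* le))
    where
    nat≃ : ∀ n → toℚᵘ (nat n) ℚᵘ.≃ ℚᵘ.mkℚᵘ (ℤ.+ n) 0
    nat≃ zero = ℚᵘ.≃-refl
    nat≃ (suc n) = ℚᵘ.≃-trans (toℚᵘ-homo-+ (nat n) 1ℚ) (ℚᵘ.≃-trans (ℚᵘ.+-congˡ (toℚᵘ 1ℚ) (nat≃ n)) (ℚᵘ.*≡* (cong (ℤ._* (ℤ.+ 1)) eqn)))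
      where
      eqn : (ℤ.+ n) ℤ.* (ℤ.+ 1) ℤ.+ (ℤ.+ 1) ≡ ℤ.+ suc n
      eqn = trans (cong (ℤ._+ (ℤ.+ 1)) (ℤ.*-identityʳ (ℤ.+ n))) (cong ℤ.+_ (ℕ.+-comm n 1))
    le : p ℤ.* (ℤ.+ 1) ℤ.≤ (ℤ.+ ℤ.∣ p ∣) ℤ.* (ℤ.+ suc d-1)
    le = ℤ.≤-trans (ℤ.≤-reflexive (ℤ.*-identityʳ p)) (ℤ.≤-trans (≤∣∣ p)
        (ℤ.≤-trans (ℤ.+≤+ (ℕ.m≤m*n ℤ.∣ p ∣ (suc d-1))) (ℤ.≤-reflexive (ℤ.pos-* ℤ.∣ p ∣ (suc d-1)))))
      where
      ≤∣∣ : ∀ p → p ℤ.≤ ℤ.+ ℤ.∣ p ∣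
      ≤∣∣ (ℤ.+ n) = ℤ.≤-refl
      ≤∣∣ ℤ.-[1+ n ] = ℤ.-≤+

  -- The factor 4 pays for one multiplicative and one additive shift of a box, each of which changes
  -- an average at two ends.
  small-weight : ∀ {ε} → 0ℚ < ε → Σ[ M ∈ ℕ ] inv (nat (suc M)) * 4ℚ ≤ ε
  small-weight {ε} 0<ε with archimedean (4ℚ * inv ε)
  ... | M , le = M , subst₂ _≤_ (*-comm 4ℚ w) fin (*-monoʳ (0≤wt M) step)
    where
    w = inv (nat (suc M))
    ε≢0 : ε ≢ 0ℚ
    ε≢0 e = <-irrefl (sym e) 0<ε
    step : 4ℚ ≤ nat (suc M) * ε
    step = subst (_≤ nat (suc M) * ε) (trans (*-assoc 4ℚ (inv ε) ε) (trans (cong (4ℚ *_) (inv-sym ε≢0)) (*-identityʳ 4ℚ)))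
      (*-monoʳ (<⇒≤ 0<ε) (≤-trans le (nat-mono-suc M)))
    fin : nat (suc M) * ε * w ≡ ε
    fin = trans (lem (nat (suc M)) ε w) (trans (cong (_* ε) (*-invʳ (nat≢0 M))) (*-identityˡ ε))
      where
      lem : ∀ a b c → a * b * c ≡ a * c * b
      lem = solve-∀ ℚ-ring

  last-or-inject₁ : ∀ {n} (i : Fin (suc n)) → i ≡ fromℕ n ⊎ Σ[ j ∈ Fin n ] i ≡ inject₁ j
  last-or-inject₁ {zero} zero = inj₁ refl
  last-or-inject₁ {suc n} zero = inj₂ (zero , refl)
  last-or-inject₁ {suc n} (suc i) with last-or-inject₁ i
  ... | inj₁ e = inj₁ (cong suc e)
  ... | inj₂ (j , e) = inj₂ (suc j , cong suc e)

  Finite : {𝒳 : Set} → (𝒳 → Set) → Set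
  Finite {𝒳} S = Σ[ xs ∈ List 𝒳 ] (∀ {x} → S x → x ∈ xs)

  Finite-∪ : ∀ {S S′} → Finite S → Finite S′ → Finite (S ∪ S′)
  Finite-∪ (xs , i) (ys , j) = xs ++ ys , λ { (inj₁ s) → ∈-++⁺ˡ (i s) ; (inj₂ s) → ∈-++⁺ʳ xs (j s) }

  opaque
    support : {𝒳 : Set} → Law 𝒳 → List 𝒳
    support (ret a) = a ∷ []
    support (avg n ℓ) = concat (map (λ i → support (ℓ i)) (allFin (suc n)))

    Finite-Supp : {𝒳 : Set} (L : Law 𝒳) → Finite (Supp L)
    Finite-Supp {𝒳} L = support L , complete L
      where
      complete : (L : Law 𝒳) → ∀ {x} → Supp L x → x ∈ support L
      complete (ret a) refl = here refl
      complete (avg n ℓ) (i , s) = ∈-concat⁺′ (complete (ℓ i) s) (∈-map⁺ (λ i → support (ℓ i)) (∈-allFin i))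

  opaque
    unfolding Finite-Supp
    Supp-support : {𝒳 : Set} (L : Law 𝒳) → ∀ {x} → x ∈ proj₁ (Finite-Supp L) → Supp L x
    Supp-support (ret a) (here refl) = refl
    Supp-support (avg n ℓ) {x} i = locate (∈-concat⁻′ (map (λ i → support (ℓ i)) (allFin (suc n))) i)
      where
      locate : Σ[ ys ∈ List _ ] (x ∈ ys × ys ∈ map (λ i → support (ℓ i)) (allFin (suc n))) → Supp (avg n ℓ) x
      locate (ys , x∈ , ys∈) with ∈-map⁻ (λ i → support (ℓ i)) ys∈
      ... | j , _ , refl = j , Supp-support (ℓ j) x∈

  -- Parameters, definable numbers and almost invariant laws.

  record Setup : Set₁ where
    field
      D e : ℚ
      D≢0 : D ≢ 0ℚ
      e≢0 : e ≢ 0ℚ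
      δ₁ δ₂ δ₃ h : ℚ
      0≤δ₁ : 0ℚ ≤ δ₁
      δ₁≤1 : δ₁ ≤ 1ℚ
      δ₂-def : δ₂ ≡ δ₁ * δ₁
      δ₃-def : δ₃ ≡ δ₂ * δ₂
      h-def : h ≡ δ₃ * δ₃
      -- `suc m` is both the number of random shifts and the length of a block, so collisions of
      -- roots and diagonal terms are controlled by the same `h`.
      m : ℕ
      1/m≤h : inv (nat (suc m)) ≤ h
      C : Set
      𝒞 : Law C

    0≤δ₂ : 0ℚ ≤ δ₂
    0≤δ₂ = subst (0ℚ ≤_) (sym δ₂-def) (sq≥0 δ₁)

    0≤δ₃ : 0ℚ ≤ δ₃
    0≤δ₃ = subst (0ℚ ≤_) (sym δ₃-def) (sq≥0 δ₂)

    0≤h : 0ℚ ≤ h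
    0≤h = subst (0ℚ ≤_) (sym h-def) (sq≥0 δ₃)

    δ₂≤δ₁ : δ₂ ≤ δ₁
    δ₂≤δ₁ = subst₂ _≤_ (sym δ₂-def) (*-identityʳ δ₁) (*-monoˡ 0≤δ₁ δ₁≤1)

    δ₃≤δ₂ : δ₃ ≤ δ₂
    δ₃≤δ₂ = subst₂ _≤_ (sym δ₃-def) (*-identityʳ δ₂) (*-monoˡ 0≤δ₂ (≤-trans δ₂≤δ₁ δ₁≤1))

    h≤δ₃ : h ≤ δ₃
    h≤δ₃ = subst₂ _≤_ (sym h-def) (*-identityʳ δ₃) (*-monoˡ 0≤δ₃ (≤-trans δ₃≤δ₂ (≤-trans δ₂≤δ₁ δ₁≤1)))

  module Construction (setup : Setup) where
    open Setup setup

    wpt : Fin (suc m) → ℚ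
    wpt i = nat (suc (Fin.toℕ i))

    opaque
      𝒲 : Law ℚ
      𝒲 = avg m (λ i → ret (wpt i))

    -- "Enormous compared with the previous parameters" means larger than every number they can
    -- produce by an arithmetic expression of bounded depth; over a finite `S` these are finitely
    -- many (`Finite-Def`). Leaves are allowed at every index, so the index is an upper bound for
    -- the depth.
    data Def (S : ℚ → Set) : ℕ → ℚ → Set where
      var : ∀ {n x} → S x → Def S n x
      c0 : ∀ {n} → Def S n 0ℚ
      c1 : ∀ {n} → Def S n 1ℚ
      cD : ∀ {n} → Def S n D
      ce : ∀ {n} → Def S n e
      cw : ∀ {n} i → Def S n (wpt i)
      add : ∀ {n x y} → Def S n x → Def S n y → Def S (suc n) (x + y)
      ng : ∀ {n x} → Def S n x → Def S (suc n) (- x)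
      mul : ∀ {n x y} → Def S n x → Def S n y → Def S (suc n) (x * y)
      dinv : ∀ {n x} → Def S n x → Def S (suc n) (inv x)

    lift : ∀ {S n x} → Def S n x → Def S (suc n) x
    lift (var s) = var s
    lift c0 = c0
    lift c1 = c1
    lift cD = cD
    lift ce = ce
    lift (cw i) = cw i
    lift (add p q) = add (lift p) (lift q)
    lift (ng p) = ng (lift p)
    lift (mul p q) = mul (lift p) (lift q)
    lift (dinv p) = dinv (lift p)

    sub : ∀ {S n x y} → Def S n x → Def S n y → Def S (suc (suc n)) (x - y)
    sub p q = add (lift p) (ng q)

    _⊆_ : (ℚ → Set) → (ℚ → Set) → Set
    S ⊆ S′ = ∀ {x} → S x → S′ x

    Def-mono : ∀ {S S′} → S ⊆ S′ → ∀ {n x} → Def S n x → Def S′ n x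
    Def-mono inc (var s) = var (inc s)
    Def-mono inc c0 = c0
    Def-mono inc c1 = c1
    Def-mono inc cD = cD
    Def-mono inc ce = ce
    Def-mono inc (cw i) = cw i
    Def-mono inc (add p q) = add (Def-mono inc p) (Def-mono inc q)
    Def-mono inc (ng p) = ng (Def-mono inc p)
    Def-mono inc (mul p q) = mul (Def-mono inc p) (Def-mono inc q)
    Def-mono inc (dinv p) = dinv (Def-mono inc p)

    Def-≤ : ∀ {S k n x} → k ℕ.≤ n → Def S k x → Def S n x
    Def-≤ le (var s) = var s
    Def-≤ le c0 = c0
    Def-≤ le c1 = c1
    Def-≤ le cD = cD
    Def-≤ le ce = ce
    Def-≤ le (cw i) = cw i
    Def-≤ (ℕ.s≤s le) (add p q) = add (Def-≤ le p) (Def-≤ le q)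
    Def-≤ (ℕ.s≤s le) (ng p) = ng (Def-≤ le p)
    Def-≤ (ℕ.s≤s le) (mul p q) = mul (Def-≤ le p) (Def-≤ le q)
    Def-≤ (ℕ.s≤s le) (dinv p) = dinv (Def-≤ le p)

    raise : ∀ {S k n x} {le : True (k ℕ.≤? n)} → Def S k x → Def S n x
    raise {le = le} = Def-≤ (toWitness le)

    infixl 6 _⊕_ _⊖_
    infixl 7 _⊗_

    _⊕_ : ∀ {S k n x y} → Def S k x → Def S n y → Def S (suc (k ℕ.⊔ n)) (x + y)
    _⊕_ {k = k} {n} p q = add (Def-≤ (ℕ.m≤m⊔n k n) p) (Def-≤ (ℕ.m≤n⊔m k n) q)

    _⊗_ : ∀ {S k n x y} → Def S k x → Def S n y → Def S (suc (k ℕ.⊔ n)) (x * y)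
    _⊗_ {k = k} {n} p q = mul (Def-≤ (ℕ.m≤m⊔n k n) p) (Def-≤ (ℕ.m≤n⊔m k n) q)

    _⊖_ : ∀ {S k n x y} → Def S k x → Def S n y → Def S (suc (k ℕ.⊔ suc n)) (x - y)
    p ⊖ q = p ⊕ ng q

    1ᵈ : ∀ {S} → Def S 0 1ℚ
    1ᵈ = c1

    Dᵈ : ∀ {S} → Def S 0 D
    Dᵈ = cD

    eᵈ : ∀ {S} → Def S 0 e
    eᵈ = ce

    varᵈ : ∀ {S x} → S x → Def S 0 x
    varᵈ = var

    opaque
      unfolding 𝒲
      def-w : ∀ {S n w} → Supp 𝒲 w → Def S n w
      def-w (i , refl) = cw i

    -- The depth 20 merely has to exceed that of every expression to which goodness is applied.
    record GoodAt (ε : ℚ) (S : ℚ → Set) (L : Law ℚ) : Set where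
      field
        invariant : ∀ {α β} → Def S 20 α → Def S 20 β → α ≢ 0ℚ → ∀ b (G : ℚ → ℚ) → (∀ x → ∣ G x ∣ ≤ b) →
          ∣ E L (λ z → G (α * z + β)) - E L G ∣ ≤ b * ε
        big : ∀ {z} → Supp L z → ∀ {s} → Def S 20 s → ∣ s ∣ < ∣ z ∣

    open GoodAt public

    Good : (ℚ → Set) → Law ℚ → Set
    Good = GoodAt h

    Good-mono : ∀ {S S′ ε L} → S ⊆ S′ → GoodAt ε S′ L → GoodAt ε S L
    Good-mono inc g .invariant dα dβ = invariant g (Def-mono inc dα) (Def-mono inc dβ)
    Good-mono inc g .big s d = big g s (Def-mono inc d)

    Good-≤ : ∀ {S ε ε′ L} → ε ≤ ε′ → GoodAt ε S L → GoodAt ε′ S L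
    Good-≤ ε≤ε′ g .invariant dα dβ α≢0 b G bd = ≤-trans (invariant g dα dβ α≢0 b G bd) (*-monoˡ (≤-trans (0≤∣p∣ (G 0ℚ)) (bd 0ℚ)) ε≤ε′)
    Good-≤ ε≤ε′ g .big = big g

    big≢ : ∀ {S ε L} → GoodAt ε S L → ∀ {z} → Supp L z → ∀ {s} → Def S 20 s → z ≢ s
    big≢ g s d refl = <-irrefl refl (big g s d)

    big+≢0 : ∀ {S ε L} → GoodAt ε S L → ∀ {z} → Supp L z → ∀ {s} → Def S 19 s → z + s ≢ 0ℚ
    big+≢0 g {z} s {a} d z+a≡0 = big≢ g s (ng d) (trans (lem z a) (trans (cong (_- a) z+a≡0) (+-identityˡ (- a))))
      where
      lem : ∀ z a → z ≡ z + a - a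
      lem = solve-∀ ℚ-ring

    big≢0 : ∀ {S ε L} → GoodAt ε S L → ∀ {z} → Supp L z → z ≢ 0ℚ
    big≢0 g s = big≢ g s c0

    EΩ : Law ℚ → (ℚ → C → ℚ) → ℚ
    EΩ ℛ g = E ℛ (λ r → E 𝒞 (g r))

    Bd : ℚ → (ℚ → C → ℚ) → Set
    Bd b g = ∀ r k → ∣ g r k ∣ ≤ b

    -- All vertices are homogeneous in `r`, so a common factor of their arguments may be changed at
    -- the cost `h`. Denominators and common roots are cancelled in this way throughout.
    dilate : ∀ {S ℛ} → Good S ℛ → ∀ {a} → Def S 20 a → a ≢ 0ℚ → ∀ b g → Bd b g →
      ∣ EΩ ℛ (λ r → g (a * r)) - EΩ ℛ g ∣ ≤ b * h
    dilate {ℛ = ℛ} gℛ {a} da a≢0 b g bd =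
      subst (λ t → ∣ t - EΩ ℛ g ∣ ≤ b * h) (E-ext ℛ (λ r → cong (λ t → E 𝒞 (g t)) (+-identityʳ (a * r))))
        (invariant gℛ da c0 a≢0 b (λ r → E 𝒞 (g r)) (λ r → E-∣∣ 𝒞 (λ k _ → bd r k)))

    sample : Law ℚ → Law ℚ → Law (ℚ × ℚ × C)
    sample ζ ℛ = bind ζ (λ z → bind ℛ (λ r → bind 𝒞 (λ k → ret (z , r , k))))

    E-sample : ∀ ζ ℛ (g : ℚ × ℚ × C → ℚ) → E (sample ζ ℛ) g ≡ E ζ (λ z → EΩ ℛ (λ r k → g (z , r , k)))
    E-sample ζ ℛ g = trans (E-bind ζ _ g) (E-ext ζ (λ z → trans (E-bind ℛ _ g) (E-ext ℛ (λ r → E-bind 𝒞 _ g))))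

    Supp-sample : ∀ ζ ℛ {z r k} → Supp (sample ζ ℛ) (z , r , k) → Supp ζ z × Supp ℛ r
    Supp-sample ζ ℛ s with Supp-bind ζ _ s
    ... | z , s₁ , t with Supp-bind ℛ _ t
    ...   | r , s₂ , u with Supp-bind 𝒞 _ u
    ...     | k , _ , refl = s₁ , s₂

    wpt-injective : ∀ {i j} → wpt i ≡ wpt j → i ≡ j
    wpt-injective e = FinP.toℕ-injective (ℕ.suc-injective (nat-injective _ _ e))
      where
      lem : ∀ x → x ≡ x + 1ℚ - 1ℚ
      lem = solve-∀ ℚ-ring
      nat-injective : ∀ i j → nat i ≡ nat j → i ≡ j
      nat-injective zero zero _ = refl
      nat-injective zero (suc j) e = ⊥-elim (nat≢0 j (sym e))
      nat-injective (suc i) zero e = ⊥-elim (nat≢0 i e)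
      nat-injective (suc i) (suc j) e = cong suc (nat-injective i j (trans (lem (nat i)) (trans (cong (_- 1ℚ) e) (sym (lem (nat j))))))

    -- An injective root map meets `a` at no more than one of the `suc m` shifts, each of weight at
    -- most `h`.
    avg-collision : ∀ a (y : ℚ → ℚ) → (∀ {u v} → y u ≡ y v → u ≡ v) → E (avg m (λ i → ret (wpt i))) (λ w → eq a (y w)) ≤ h
    avg-collision a y inj = ≤-trans
      (≤-trans (*-monoˡ (0≤wt m) (sumF-eq≤1 (suc m) a (y ∘ wpt) (wpt-injective ∘ inj)))
               (≤-reflexive (*-identityʳ _))) 1/m≤h

    opaque
      unfolding 𝒲
      E𝒲-collision : ∀ a (y : ℚ → ℚ) → (∀ {u v} → y u ≡ y v → u ≡ v) → E 𝒲 (λ w → eq a (y w)) ≤ h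
      E𝒲-collision = avg-collision

    -- Decoupling of linear forms with distinct roots.

    0≤2 : 0ℚ ≤ 2ℚ
    0≤2 = 0≤+ 0≤1 0≤1

    -- `h + h` for the pair of unaveraged roots, and for each of the three averaged pairs another
    -- `h + h` together with the collision cost `2ℚ * h`.
    14h : ℚ
    14h = h + h + (h + h + 2ℚ * h) + (h + h + 2ℚ * h) + (h + h + 2ℚ * h)

    module Pair {S ζ ℛ} (gζ : Good S ζ) (gℛ : Good S ℛ) (V : ℚ → C → ℚ) (V≤1 : Bd 1ℚ V) where

      Q : (c a c̃ b : ℚ) → ℚ
      Q c a c̃ b = E ζ (λ z → EΩ ℛ (λ r k → V (c * (z + a) * r) k * V (c̃ * (z + b) * r) k))

      B₀ : (c c̃ : ℚ) → ℚ
      B₀ c c̃ = E ζ (λ z → EΩ ℛ (λ r k → V (c * z * r) k * V (c̃ * (z + 1ℚ) * r) k))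

      VV≤1 : ∀ x y k → ∣ V x k * V y k ∣ ≤ 1ℚ
      VV≤1 x y k = ∣∣-*-≤ (V x k) (V y k) (V≤1 x k) (V≤1 y k)

      -- The affine map z ↦ (b-a)z - a carries the pair of shifts (0,1) to (a,b).
      correlation : ∀ {a b} → Def S 18 a → Def S 18 b → a ≢ b → ∀ c c̃ → ∣ Q c a c̃ b - B₀ c c̃ ∣ ≤ h + h
      correlation {a} {b} da db a≢b c c̃ = ∣-∣-trans (Q c a c̃ b) (E ζ (λ z → G (A * z + - a))) (B₀ c c̃) step₁ step₂
        where
        G : ℚ → ℚ
        G z = EΩ ℛ (λ r k → V (c * (z + a) * r) k * V (c̃ * (z + b) * r) k)
        G≤1 : ∀ z → ∣ G z ∣ ≤ 1ℚ
        G≤1 z = E-∣∣ ℛ (λ r _ → E-∣∣ 𝒞 (λ k _ → VV≤1 _ _ k))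
        A = b - a
        A≢0 : A ≢ 0ℚ
        A≢0 = -≢0 (a≢b ∘ sym)
        step₁ : ∣ Q c a c̃ b - E ζ (λ z → G (A * z + - a)) ∣ ≤ h
        step₁ = subst₂ _≤_ (∣-∣-comm (E ζ (λ z → G (A * z + - a))) (E ζ G)) (*-identityˡ h)
          (invariant gζ (sub db da) (ng (lift da)) A≢0 1ℚ G G≤1)
        lem₁ : ∀ c a b z r → c * ((b - a) * z + - a + a) * r ≡ c * z * ((b - a) * r)
        lem₁ = solve-∀ ℚ-ring
        lem₂ : ∀ c a b z r → c * ((b - a) * z + - a + b) * r ≡ c * (z + 1ℚ) * ((b - a) * r)
        lem₂ = solve-∀ ℚ-ring
        step₂ : ∣ E ζ (λ z → G (A * z + - a)) - B₀ c c̃ ∣ ≤ h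
        step₂ = E-close ζ (λ z _ → subst₂ _≤_
          (cong (λ t → ∣ t - EΩ ℛ (λ r k → V (c * z * r) k * V (c̃ * (z + 1ℚ) * r) k) ∣)
            (E-ext ℛ (λ r → E-ext 𝒞 (λ k → sym (cong₂ (λ s t → V s k * V t k) (lem₁ c a b z r) (lem₂ c̃ a b z r))))))
          (*-identityˡ h)
          (dilate gℛ (sub db da) A≢0 1ℚ (λ r k → V (c * z * r) k * V (c̃ * (z + 1ℚ) * r) k) (λ r k → VV≤1 _ _ k)))

      -- For coinciding shifts the trivial bound 2 is charged to `eq a b`, which becomes small once
      -- a shift is averaged.
      correlation′ : ∀ {a b} → Def S 18 a → Def S 18 b → ∀ c c̃ → ∣ Q c a c̃ b - B₀ c c̃ ∣ ≤ h + h + 2ℚ * eq a b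
      correlation′ {a} {b} da db c c̃ with a ℚ.≟ b
      ... | no a≢b = ≤-trans (correlation da db a≢b c c̃) (≤-reflexive (sym (trans (cong (h + h +_) (*-zeroʳ 2ℚ)) (+-identityʳ (h + h)))))
      ... | yes _ = ≤-trans (∣∣-−-≤ (Q c a c̃ b) (B₀ c c̃) {1ℚ} {1ℚ} (E-∣∣ ζ (λ z _ → E-∣∣ ℛ (λ r _ → E-∣∣ 𝒞 (λ k _ → VV≤1 _ _ k))))
                                      (E-∣∣ ζ (λ z _ → E-∣∣ ℛ (λ r _ → E-∣∣ 𝒞 (λ k _ → VV≤1 _ _ k)))))
                            (≤-by (0≤+ 0≤h 0≤h) (+-comm (h + h) 2ℚ))

      Decoupled : (c x : ℚ) (y : ℚ → ℚ) → ℚ → ℚ → C → ℚ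
      Decoupled c x y z r k = V (c * (z + x) * r) k - E 𝒲 (λ w → V (c * (z + y w) * r) k)

      Decoupled≤2 : ∀ c x y z r k → ∣ Decoupled c x y z r k ∣ ≤ 2ℚ
      Decoupled≤2 c x y z r k = ∣∣-−-≤ (V (c * (z + x) * r) k) (E 𝒲 (λ w → V (c * (z + y w) * r) k)) (V≤1 _ k) (E-∣∣ 𝒲 (λ w _ → V≤1 _ k))

      -- The four correlations in the expanded product are all close to the same number `B₀ c c̃`,
      -- and their signs cancel. The roots have to be definable, but the coefficients `c` and `c̃`
      -- are arbitrary, since the affine normalisation leaves them alone.
      pair-bound : ∀ c c̃ {x x̃} {y ỹ : ℚ → ℚ} → Def S 18 x → Def S 18 x̃ →
        (∀ {w} → Supp 𝒲 w → Def S 18 (y w)) → (∀ {w} → Supp 𝒲 w → Def S 18 (ỹ w)) →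
        (∀ {u v} → y u ≡ y v → u ≡ v) → (∀ {u v} → ỹ u ≡ ỹ v → u ≡ v) → x ≢ x̃ →
        E ζ (λ z → EΩ ℛ (λ r k → Decoupled c x y z r k * Decoupled c̃ x̃ ỹ z r k)) ≤ 14h
      pair-bound c c̃ {x} {x̃} {y} {ỹ} dx dx̃ dy dỹ y-inj ỹ-inj x≢x̃ = begin
        E ζ (λ z → EΩ ℛ (λ r k → (v z r k - E 𝒲 (λ w → u w z r k)) * (ṽ z r k - E 𝒲 (λ w → ũ w z r k))))
          ≡⟨ expand ⟩
        Q₀ - Q₁ - (Q₂ - Q₃)
          ≡⟨ re Q₀ Q₁ Q₂ Q₃ (B₀ c c̃) ⟩
        (Q₀ - β) - (Q₁ - β) - (Q₂ - β) + (Q₃ - β)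
          ≤⟨ ∣∣≤⇒≤ (∣∣-+-≤ ((Q₀ - β) - (Q₁ - β) - (Q₂ - β)) (Q₃ - β) (∣∣-−-≤ ((Q₀ - β) - (Q₁ - β)) (Q₂ - β)
              (∣∣-−-≤ (Q₀ - β) (Q₁ - β) b₀ b₁) b₂) b₃) ⟩
        14h ∎
        where
        open ≤-Reasoning
        β = B₀ c c̃
        v ṽ : ℚ → ℚ → C → ℚ
        v z r k = V (c * (z + x) * r) k
        ṽ z r k = V (c̃ * (z + x̃) * r) k
        u ũ : ℚ → ℚ → ℚ → C → ℚ
        u w z r k = V (c * (z + y w) * r) k
        ũ w z r k = V (c̃ * (z + ỹ w) * r) k
        Q₀ = Q c x c̃ x̃
        Q₁ = E 𝒲 (λ w → Q c x c̃ (ỹ w))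
        Q₂ = E 𝒲 (λ w → Q c (y w) c̃ x̃)
        Q₃ = E 𝒲 (λ w → E 𝒲 (λ w̃ → Q c (y w) c̃ (ỹ w̃)))
        re : ∀ a b c d e → a - b - (c - d) ≡ (a - e) - (b - e) - (c - e) + (d - e)
        re = solve-∀ ℚ-ring
        mulsub : ∀ a b c d → (a - b) * (c - d) ≡ a * c - a * d - (b * c - b * d)
        mulsub = solve-∀ ℚ-ring
        EE : (ℚ → ℚ → C → ℚ) → ℚ
        EE g = E ζ (λ z → EΩ ℛ (g z))
        EE-− : ∀ g g′ → EE (λ z r k → g z r k - g′ z r k) ≡ EE g - EE g′
        EE-− g g′ = trans (E-ext ζ (λ z → trans (E-ext ℛ (λ r → E-− 𝒞 (g z r) (g′ z r))) (E-− ℛ _ _))) (E-− ζ _ _)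
        EE-swap : ∀ (g : ℚ → ℚ → ℚ → C → ℚ) → EE (λ z r k → E 𝒲 (λ w → g w z r k)) ≡ E 𝒲 (λ w → EE (g w))
        EE-swap g = sym (trans (E-swap 𝒲 ζ _) (E-ext ζ (λ z → trans (E-swap 𝒲 ℛ _) (E-ext ℛ (λ r → E-swap 𝒲 𝒞 _)))))
        EE-ext : ∀ {g g′ : ℚ → ℚ → C → ℚ} → (∀ z r k → g z r k ≡ g′ z r k) → EE g ≡ EE g′
        EE-ext e = E-ext ζ (λ z → E-ext ℛ (λ r → E-ext 𝒞 (e z r)))
        expand : EE (λ z r k → (v z r k - E 𝒲 (λ w → u w z r k)) * (ṽ z r k - E 𝒲 (λ w → ũ w z r k))) ≡ Q₀ - Q₁ - (Q₂ - Q₃)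
        expand = trans (EE-ext (λ z r k → trans (mulsub (v z r k) _ _ _)
            (cong₂ (λ s t → v z r k * ṽ z r k - s - t) (sym (E-* 𝒲 (v z r k) (λ w → ũ w z r k)))
              (cong₂ _-_ (sym (E-*ʳ 𝒲 (ṽ z r k) (λ w → u w z r k)))
                (trans (sym (E-*ʳ 𝒲 _ (λ w → u w z r k))) (E-ext 𝒲 (λ w → sym (E-* 𝒲 (u w z r k) (λ w → ũ w z r k)))))))))
          (trans (EE-− _ _) (cong₂ _-_ (trans (EE-− _ _) (cong (λ t → Q₀ - t) (EE-swap _)))
            (trans (EE-− _ _) (cong₂ _-_ (EE-swap _) (trans (EE-swap _) (E-ext 𝒲 (λ w → EE-swap _)))))))
        b₀ : ∣ Q₀ - β ∣ ≤ h + h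
        b₀ = correlation dx dx̃ x≢x̃ c c̃
        near : (g bd : ℚ → ℚ) → (∀ w → Supp 𝒲 w → ∣ g w - β ∣ ≤ bd w) → ∣ E 𝒲 g - β ∣ ≤ E 𝒲 bd
        near g bd hyp = ≤-trans
          (subst (λ t → ∣ t ∣ ≤ E 𝒲 (λ w → ∣ g w - β ∣)) (trans (E-− 𝒲 g (λ _ → β)) (cong (λ t → E 𝒲 g - t) (E-const 𝒲 β)))
              (E-∣∣≤E∣∣ 𝒲 (λ w → g w - β)))
          (E-mono 𝒲 hyp)
        avg-bd : ∀ (q : ℚ → ℚ) → E 𝒲 q ≤ h → E 𝒲 (λ w → h + h + 2ℚ * q w) ≤ h + h + 2ℚ * h
        avg-bd q hq = subst (_≤ h + h + 2ℚ * h) (sym (trans (E-+ 𝒲 _ _) (cong₂ _+_ (E-const 𝒲 (h + h)) (E-* 𝒲 2ℚ q))))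
          (+-monoʳ-≤ (h + h) (*-monoˡ 0≤2 hq))
        eq-sym : ∀ a b → eq a b ≡ eq b a
        eq-sym a b with a ℚ.≟ b
        ... | yes refl with a ℚ.≟ a
        ...   | yes _ = refl
        ...   | no n = ⊥-elim (n refl)
        eq-sym a b | no n = sym (eq-≢ (n ∘ sym))
        b₁ : ∣ Q₁ - β ∣ ≤ h + h + 2ℚ * h
        b₁ = ≤-trans (near _ (λ w → h + h + 2ℚ * eq x (ỹ w)) (λ w s → correlation′ dx (dỹ s) c c̃)) (avg-bd _ (E𝒲-collision x ỹ ỹ-inj))
        b₂ : ∣ Q₂ - β ∣ ≤ h + h + 2ℚ * h
        b₂ = ≤-trans (near _ (λ w → h + h + 2ℚ * eq x̃ (y w)) (λ w s → subst (λ t → ∣ Q c (y w) c̃ x̃ - β ∣ ≤ h + h + 2ℚ * t)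
            (eq-sym (y w) x̃) (correlation′ (dy s) dx̃ c c̃))) (avg-bd _ (E𝒲-collision x̃ y y-inj))
        b₃ : ∣ Q₃ - β ∣ ≤ h + h + 2ℚ * h
        b₃ = ≤-trans (near _ (λ _ → h + h + 2ℚ * h) (λ w s → ≤-trans (near _ (λ w̃ → h + h + 2ℚ * eq (y w) (ỹ w̃))
            (λ w̃ s̃ → correlation′ (dy s) (dỹ s̃) c c̃)) (avg-bd _ (E𝒲-collision (y w) ỹ ỹ-inj)))) (≤-reflexive (E-const 𝒲 _))

    -- Hierarchies of laws.

    pre : (n : ℕ) → (Fin n → Law ℚ) → ℚ → Set
    pre n η x = Σ[ i ∈ Fin n ] Supp (η i) x

    pre-init : ∀ n (η : Fin (suc n) → Law ℚ) → pre n (η ∘ inject₁) ⊆ pre (suc n) η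
    pre-init n η (i , s) = inject₁ i , s

    -- Values are separated only between different laws of the list: two points of the same law meet
    -- in a diagonal term, which is bounded trivially.
    Sep : (ℚ → ℚ) → (n : ℕ) → (Fin n → Law ℚ) → Set
    Sep X zero η = ⊤
    Sep X (suc n) η = Sep X n (η ∘ inject₁) × (∀ k → pre n (η ∘ inject₁) k → ∀ l → Supp (η (fromℕ n)) l → X k ≢ X l)

    Hier : (ℚ → Set) → (n : ℕ) → (Fin n → Law ℚ) → Set
    Hier S zero η = ⊤
    Hier S (suc n) η = Hier S n (η ∘ inject₁) × Good (S ∪ pre n (η ∘ inject₁)) (η (fromℕ n))

    -- Points of a later law exceed those of the earlier ones in absolute value, so only pairs with
    -- `∣ k ∣ < ∣ l ∣` have to be compared.
    Hier-sep : ∀ {S} n η → Hier S n η → ∀ (X : ℚ → ℚ) → (∀ k l → pre n η k → pre n η l → ∣ k ∣ < ∣ l ∣ → X k ≢ X l) → Sep X n η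
    Hier-sep zero η hi X d = tt
    Hier-sep (suc n) η (hi , g) X d =
      Hier-sep n (η ∘ inject₁) hi X (λ k l p q → d k l (pre-init n η p) (pre-init n η q)) ,
      λ k p l s → d k l (pre-init n η p) (fromℕ n , s) (big g s (var (inj₂ p)))

    Hier-big : ∀ {S} n η → Hier S n η → ∀ {k} → pre n η k → ∀ {a} → Def S 20 a → ∣ a ∣ < ∣ k ∣
    Hier-big (suc n) η (hi , g) (i , s) d with last-or-inject₁ i
    ... | inj₁ refl = big g s (Def-mono inj₁ d)
    ... | inj₂ (j , refl) = Hier-big n (η ∘ inject₁) hi (j , s) d

    N̄ : ℚ
    N̄ = nat (suc m)

    0≤14h : 0ℚ ≤ 14h
    0≤14h = 0≤+ (0≤+ (0≤+ (0≤+ 0≤h 0≤h) b) b) b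
      where b = 0≤+ (0≤+ 0≤h 0≤h) (0≤* 0≤2 0≤h)

    -- The second-moment estimate for linear forms, with coefficient `cf`, root `X` and randomised
    -- roots `Y` left open. It is applied to the normalised roots of `PrefixBound`, to the root k
    -- itself, and to the Möbius images of the shifts.
    module Core {S ζ ℛ} (gζ : Good S ζ) (gℛ : Good S ℛ) (V : ℚ → C → ℚ) (V≤1 : Bd 1ℚ V)
      (cf X : ℚ → ℚ) (Y : ℚ → ℚ → ℚ) where
      open Pair gζ gℛ V V≤1 public

      term : ℚ → ℚ × ℚ × C → ℚ
      term k (z , r , c) = Decoupled (cf k) (X k) (Y k) z r c

      term≤2 : ∀ k t → ∣ term k t ∣ ≤ 2ℚ
      term≤2 k (z , r , c) = Decoupled≤2 (cf k) (X k) (Y k) z r c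

      Admissible : ℚ → Set
      Admissible k = Def S 18 (X k) × (∀ {w} → Supp 𝒲 w → Def S 18 (Y k w)) × (∀ {u v} → Y k u ≡ Y k v → u ≡ v)

      cross : ∀ n (η : Fin n → Law ℚ) → nat n ≤ N̄ → (∀ k → pre n η k → Admissible k) → Sep X n η →
        Cross (sample ζ ℛ) term (N̄ * 14h) n η
      cross zero η n≤N ad sep = tt
      cross (suc n) η n≤N ad (sep , d) =
        cross n (η ∘ inject₁) (≤-trans (nat-mono-suc n) n≤N) (λ k p → ad k (pre-init n η p)) sep ,
        ≤-trans (cross-termwise (sample ζ ℛ) term 14h n (η ∘ inject₁) (η (fromℕ n)) one)
                (*-monoʳ 0≤14h (≤-trans (nat-mono-suc n) n≤N))
        where
        one : ∀ i k → Supp (η (inject₁ i)) k → ∀ l → Supp (η (fromℕ n)) l → E (sample ζ ℛ) (λ t → term k t * term l t) ≤ 14h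
        one i k s l s′ with ad k (inject₁ i , s) | ad l (fromℕ n , s′)
        ... | dX , dY , inj | dX′ , dY′ , inj′ = subst (_≤ 14h) (sym (E-sample ζ ℛ (λ t → term k t * term l t)))
          (pair-bound (cf k) (cf l) {X k} {X l} {Y k} {Y l} dX dX′ dY dY′ inj inj′ (d k (i , s) l s′))

      bound-sum : ∀ n (η : Fin n → Law ℚ) → nat n ≤ N̄ → (∀ k → pre n η k → Admissible k) → Sep X n η →
        E (sample ζ ℛ) (λ t → partial (sample ζ ℛ) term n η t * partial (sample ζ ℛ) term n η t) ≤ nat n * (4ℚ + (N̄ * 14h + N̄ * 14h))
      bound-sum n η n≤N ad sep = second-moment (sample ζ ℛ) term (N̄ * 14h) n η (λ i k s t _ → term≤2 k t) (cross n η n≤N ad sep)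

      bound-avg : ∀ (η : Fin (suc m) → Law ℚ) → (∀ k → pre (suc m) η k → Admissible k) → Sep X (suc m) η →
        E (sample ζ ℛ) (λ t → E (avg m η) (λ k → term k t) * E (avg m η) (λ k → term k t)) ≤ 4ℚ * h + (14h + 14h)
      bound-avg η ad sep = ≤-trans
        (second-moment-avg (sample ζ ℛ) term m η 14h (λ i k s t _ → term≤2 k t) (cross (suc m) η ≤-refl ad sep))
        (+-monoˡ-≤ (14h + 14h) (*-monoˡ (0≤+ 0≤2 0≤2) 1/m≤h))

    -- Edges, and the normalisation of two of four roots.

    2e : ℚ
    2e = e + e

    β : ℚ → ℚ
    β k = 2e * k * inv (k * k - D)

    -- The vertices (z²-D)r and β(k)(z+k)(z+D/k)r are joined by an edge.
    form : (V : ℚ → C → ℚ) → ℚ → ℚ → ℚ → ℚ → ℚ → C → ℚ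
    form V b x s z r c = V (b * ((z + x) * (z + s)) * r) c

    smooth : (V : ℚ → C → ℚ) → ℚ → ℚ → ℚ → ℚ → C → ℚ
    smooth V b x z r c = E 𝒲 (λ w → form V b x w z r c)

    Δ : (V : ℚ → C → ℚ) → ℚ → ℚ → ℚ → C → ℚ
    Δ V k z r c = form V (β k) k (D * inv k) z r c - smooth V (β k) k z r c

    -- One summand of the cross terms ⟨form, Δ⟩: the affine substitutions z ↦ Az - k, l ↦ Ao + k (A = k - s)
    -- carry the roots of the first form to 0 and 1, so that the second form acquires a root o that no longer
    -- depends on k.
    module CrossTerm {Sη ηₗ Sζ ζ ℛ} (gη : Good Sη ηₗ) (gζ : Good Sζ ζ) (gℛ : Good (Sζ ∪ Supp ζ) ℛ)
      (η⊆ζ : Sη ⊆ Sζ) (ηₗ⊆ζ : Supp ηₗ ⊆ Sζ) (V : ℚ → C → ℚ) (V≤1 : Bd 1ℚ V) where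

      -- With A = k - s, this is the root into which z ↦ A z - k turns the root t. For l = A o + k,
      -- `root` is the image of D/l, and `coef` is the coefficient of the second form relative to
      -- that of the first.
      shift : ℚ → ℚ → ℚ → ℚ
      shift k s t = (t - k) * inv (k - s)

      root : ℚ → ℚ → ℚ → ℚ
      root k s o = shift k s (D * inv ((k - s) * o + k))

      coef : ℚ → ℚ → ℚ → ℚ
      coef k s o = β ((k - s) * o + k) * inv (β k)

      Δ′ : ℚ → ℚ → ℚ → ℚ → ℚ → C → ℚ
      Δ′ k s o z r c = V (coef k s o * ((z + o) * (z + root k s o)) * r) c
                     - E 𝒲 (λ w → V (coef k s o * ((z + o) * (z + shift k s w)) * r) c)

      P P′ : ℚ → ℚ → ℚ
      P k s = E ηₗ (λ l → E ζ (λ z → EΩ ℛ (λ r c → form V (β k) k s z r c * Δ V l z r c)))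
      P′ k s = E ηₗ (λ o → E ζ (λ z → EΩ ℛ (λ r c → V (z * (z - 1ℚ) * r) c * Δ′ k s o z r c)))

      Δ≤2 : ∀ l z r c → ∣ Δ V l z r c ∣ ≤ 2ℚ
      Δ≤2 l z r c = ∣∣-−-≤ (form V (β l) l (D * inv l) z r c) (smooth V (β l) l z r c) (V≤1 _ c) (E-∣∣ 𝒲 (λ w _ → V≤1 _ c))

      fΔ≤2 : ∀ k s l z r c → ∣ form V (β k) k s z r c * Δ V l z r c ∣ ≤ 2ℚ
      fΔ≤2 k s l z r c = ∣∣-*-≤ (form V (β k) k s z r c) (Δ V l z r c) {1ℚ} {2ℚ} (V≤1 _ c) (Δ≤2 l z r c)

      substitute : ∀ {k s} → Def Sη 6 k → Def Sη 6 s → k - s ≢ 0ℚ → β k ≢ 0ℚ →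
        ∣ P k s - P′ k s ∣ ≤ 2ℚ * h + (2ℚ * h + 2ℚ * h)
      substitute {k} {s} dk ds A≢0 β≢0 = ∣-∣-trans (P k s) (E ηₗ G₂) (P′ k s) step-z
        (∣-∣-trans (E ηₗ G₂) (E ηₗ (λ o → G₂ (A * o + k))) (P′ k s) step-l step-r)
        where
        A = k - s
        -- The substitution turns the first form into β(k) A² z(z - 1) r; dilating `r` by `L`
        -- removes the factor that still depends on k and s.
        L = inv (A * A * β k)
        G : ℚ → ℚ → ℚ
        G l z = EΩ ℛ (λ r c → form V (β k) k s z r c * Δ V l z r c)
        G≤2 : ∀ l z → ∣ G l z ∣ ≤ 2ℚ
        G≤2 l z = E-∣∣ ℛ (λ r _ → E-∣∣ 𝒞 (λ c _ → fΔ≤2 k s l z r c))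
        G₂ : ℚ → ℚ
        G₂ l = E ζ (λ z → G l (A * z + - k))
        dA : Def Sη 8 A
        dA = sub dk ds
        dA⁺ : Def Sζ 8 A
        dA⁺ = Def-mono η⊆ζ dA
        dk⁺ : Def Sζ 6 k
        dk⁺ = Def-mono η⊆ζ dk
        step-z : ∣ P k s - E ηₗ G₂ ∣ ≤ 2ℚ * h
        step-z = E-close ηₗ (λ l _ → subst (_≤ 2ℚ * h) (∣-∣-comm (E ζ (λ z → G l (A * z + - k))) (E ζ (G l)))
          (invariant gζ (raise dA⁺) (raise (ng dk⁺)) A≢0 2ℚ (G l) (G≤2 l)))
        step-l : ∣ E ηₗ G₂ - E ηₗ (λ o → G₂ (A * o + k)) ∣ ≤ 2ℚ * h
        step-l = subst (_≤ 2ℚ * h) (∣-∣-comm (E ηₗ (λ o → G₂ (A * o + k))) (E ηₗ G₂))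
          (invariant gη (raise dA) (raise dk) A≢0 2ℚ G₂ (λ l → E-∣∣ ζ (λ z _ → G≤2 l (A * z + - k))))
        dL : Def (Sζ ∪ Supp ζ) 20 L
        dL = raise (dinv (Aᵈ ⊗ Aᵈ ⊗ ((eᵈ ⊕ eᵈ) ⊗ kᵈ ⊗ dinv (kᵈ ⊗ kᵈ ⊖ Dᵈ))))
          where
          Aᵈ = Def-mono {S′ = Sζ ∪ Supp ζ} inj₁ dA⁺
          kᵈ = Def-mono {S′ = Sζ ∪ Supp ζ} inj₁ dk⁺
        AAβ≢0 : A * A * β k ≢ 0ℚ
        AAβ≢0 = *≢0 (*≢0 A≢0 A≢0) β≢0
        AAL : A * A * L ≡ inv (β k)
        AAL = begin
          A * A * L                             ≡⟨ cong (A * A *_) (inv-* (*≢0 A≢0 A≢0) β≢0) ⟩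
          A * A * (inv (A * A) * inv (β k))     ≡⟨ sym (*-assoc (A * A) _ _) ⟩
          A * A * inv (A * A) * inv (β k)       ≡⟨ cong (_* inv (β k)) (*-invʳ (*≢0 A≢0 A≢0)) ⟩
          1ℚ * inv (β k)                        ≡⟨ *-identityˡ _ ⟩
          inv (β k)                             ∎
          where open ≡-Reasoning
        id₁ : ∀ z r → β k * ((A * z + - k + k) * (A * z + - k + s)) * (L * r) ≡ z * (z - 1ℚ) * r
        id₁ z r = trans (lem k s (β k) z L r) (trans (cong (_* (z * (z - 1ℚ) * r)) (*-invʳ AAβ≢0)) (*-identityˡ _))
          where
          lem : ∀ k s b z L r → b * (((k - s) * z + - k + k) * ((k - s) * z + - k + s)) * (L * r)
                               ≡ (k - s) * (k - s) * b * L * (z * (z - 1ℚ) * r)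
          lem = solve-∀ ℚ-ring
        id₂ : ∀ b o t z r → b * ((A * z + - k + (A * o + k)) * (A * z + - k + t)) * (L * r)
                           ≡ b * inv (β k) * ((z + o) * (z + shift k s t)) * r
        id₂ b o t z r = begin
          b * ((A * z + - k + (A * o + k)) * (A * z + - k + t)) * (L * r)
            ≡⟨ cong (λ u → b * ((A * z + - k + (A * o + k)) * (A * z + - k + u)) * (L * r)) (sym t≡) ⟩
          b * ((A * z + - k + (A * o + k)) * (A * z + - k + (A * x + k))) * (L * r)
            ≡⟨ lem b A z k o x L r ⟩
          b * (A * A * L) * ((z + o) * (z + x)) * r
            ≡⟨ cong (λ u → b * u * ((z + o) * (z + x)) * r) AAL ⟩
          b * inv (β k) * ((z + o) * (z + x)) * r ∎
          where
          open ≡-Reasoning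
          x = shift k s t
          lem : ∀ b A z k o x L r → b * ((A * z + - k + (A * o + k)) * (A * z + - k + (A * x + k))) * (L * r)
                                 ≡ b * (A * A * L) * ((z + o) * (z + x)) * r
          lem = solve-∀ ℚ-ring
          lem₂ : ∀ A t k i → A * ((t - k) * i) + k ≡ (t - k) * (A * i) + k
          lem₂ = solve-∀ ℚ-ring
          lem₃ : ∀ t k → (t - k) * 1ℚ + k ≡ t
          lem₃ = solve-∀ ℚ-ring
          t≡ : A * x + k ≡ t
          t≡ = trans (lem₂ A t k (inv A)) (trans (cong (λ u → (t - k) * u + k) (*-invʳ A≢0)) (lem₃ t k))
        step-r : ∣ E ηₗ (λ o → G₂ (A * o + k)) - P′ k s ∣ ≤ 2ℚ * h
        step-r = E-close ηₗ (λ o _ → E-close ζ (λ z _ →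
          subst (λ t → ∣ G (A * o + k) (A * z + - k) - t ∣ ≤ 2ℚ * h)
            (E-ext ℛ (λ r → E-ext 𝒞 (λ c → cong₂ _*_ (cong (λ u → V u c) (id₁ z r))
              (cong₂ _-_ (cong (λ u → V u c) (id₂ (β (A * o + k)) o _ z r))
                (E-ext 𝒲 (λ w → cong (λ u → V u c) (id₂ (β (A * o + k)) o w z r)))))))
            (subst (_≤ 2ℚ * h) (∣-∣-comm (EΩ ℛ (λ r → g o z (L * r))) (EΩ ℛ (g o z)))
              (dilate gℛ dL (inv≢0 AAβ≢0) 2ℚ (g o z) (λ r c → fΔ≤2 k s (A * o + k) (A * z + - k) r c)))))
          where
          g : ℚ → ℚ → ℚ → C → ℚ
          g o z r c = form V (β k) k s (A * z + - k) r c * Δ V (A * o + k) (A * z + - k) r c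

    sumF-close : ∀ n {f g : Fin n → ℚ} {b} → (∀ i → ∣ f i - g i ∣ ≤ b) → ∣ sumF n f - sumF n g ∣ ≤ nat n * b
    sumF-close zero {b = b} e = ≤-reflexive (sym (*-zeroˡ b))
    sumF-close (suc n) {f} {g} {b} e = subst₂ (λ s t → ∣ s ∣ ≤ t) (lem₁ F G a c) (lem₂ (nat n) b)
      (∣∣-+-≤ (F - G) (a - c) (sumF-close n (e ∘ inject₁)) (e (fromℕ n)))
      where
      F = sumF n (f ∘ inject₁)
      G = sumF n (g ∘ inject₁)
      a = f (fromℕ n)
      c = g (fromℕ n)
      lem₁ : ∀ F G a c → F - G + (a - c) ≡ F + a - (G + c)
      lem₁ = solve-∀ ℚ-ring
      lem₂ : ∀ n b → n * b + b ≡ (n + 1ℚ) * b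
      lem₂ = solve-∀ ℚ-ring

    sumF-∣∣ : ∀ n {f : Fin n → ℚ} {b} → (∀ i → ∣ f i ∣ ≤ b) → ∣ sumF n f ∣ ≤ nat n * b
    sumF-∣∣ zero {b = b} e = ≤-reflexive (sym (*-zeroˡ b))
    sumF-∣∣ (suc n) {f} {b} e = subst (λ t → ∣ sumF (suc n) f ∣ ≤ t) (lem₂ (nat n) b)
      (∣∣-+-≤ (sumF n (f ∘ inject₁)) (f (fromℕ n)) (sumF-∣∣ n (e ∘ inject₁)) (e (fromℕ n)))
      where
      lem₂ : ∀ n b → n * b + b ≡ (n + 1ℚ) * b
      lem₂ = solve-∀ ℚ-ring

    -- Jensen for the product gives (E uy)² ≤ E u²y² ≤ E y². Taking the bound in the form `b * b`
    -- avoids square roots.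
    cauchy-schwarz : ∀ {T : Set} (Σ′ : Law T) (u y : T → ℚ) {b} → 0ℚ ≤ b → (∀ t → ∣ u t ∣ ≤ 1ℚ) →
      E Σ′ (λ t → y t * y t) ≤ b * b → ∣ E Σ′ (λ t → u t * y t) ∣ ≤ b
    cauchy-schwarz Σ′ u y {b} 0≤b hu hy = sq≤⇒∣∣≤ 0≤b
      (≤-trans (jensen Σ′ (λ t → u t * y t)) (≤-trans (E-mono Σ′ (λ t _ → pt (u t) (y t) (hu t))) hy))
      where
      pt : ∀ u y → ∣ u ∣ ≤ 1ℚ → u * y * (u * y) ≤ y * y
      pt u y h₁ = subst₂ _≤_ (lem u y) (*-identityˡ (y * y)) (*-monoʳ (sq≥0 y) (∣∣-sq≤ h₁))
        where
        lem : ∀ u y → u * u * (y * y) ≡ u * y * (u * y)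
        lem = solve-∀ ℚ-ring

    0≤N̄ : 0ℚ ≤ N̄
    0≤N̄ = 0≤nat (suc m)

    -- Absorbs the diagonal contribution, 4 per summand, into a bound of order N̄²h that holds for
    -- prefixes of every length.
    N̄h≥1 : 1ℚ ≤ N̄ * h
    N̄h≥1 = subst (_≤ N̄ * h) (*-invʳ (nat≢0 m)) (*-monoˡ 0≤N̄ 1/m≤h)

    6ℚ 6h : ℚ
    6ℚ = 4ℚ + 2ℚ
    6h = 2ℚ * h + (2ℚ * h + 2ℚ * h)

    0≤6h : 0ℚ ≤ 6h
    0≤6h = 0≤+ a (0≤+ a a) where a = 0≤* 0≤2 0≤h

    -- After normalisation the first form is `u` for every k, so the sum over the prefix can be
    -- taken inside and `u` discarded by Cauchy-Schwarz. In the remaining sum `Y o` every argument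
    -- has the factor z + o; dilating by its inverse leaves linear forms with roots
    -- `root k (σ k) o`. The second root `σ k` of the first form is D/k or a fixed shift.
    module PrefixBound {Sη ηₗ Sζ ζ ℛ} (gη : Good Sη ηₗ) (gζ : Good Sζ ζ) (gℛ : Good (Sζ ∪ Supp ζ) ℛ)
      (η⊆ζ : Sη ⊆ Sζ) (ηₗ⊆ζ : Supp ηₗ ⊆ Sζ) (V : ℚ → C → ℚ) (V≤1 : Bd 1ℚ V)
      (n : ℕ) (n≤N : nat n ≤ N̄) (η₀ : Fin n → Law ℚ) (η₀⊆ : pre n η₀ ⊆ Sη) (σ : ℚ → ℚ)
      (admit : ∀ {k} → pre n η₀ k → Def Sη 6 (σ k) × k - σ k ≢ 0ℚ × β k ≢ 0ℚ) where
      open CrossTerm gη gζ gℛ η⊆ζ ηₗ⊆ζ V V≤1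

      τ : Law (ℚ × ℚ × C)
      τ = sample ζ ℛ

      u : ℚ × ℚ × C → ℚ
      u (z , r , c) = V (z * (z - 1ℚ) * r) c

      d : ℚ → ℚ → ℚ × ℚ × C → ℚ
      d o k (z , r , c) = Δ′ k (σ k) o z r c

      Y : ℚ → ℚ × ℚ × C → ℚ
      Y o t = sumF n (λ i → E (η₀ i) (λ k → d o k t))

      Y≤ : ∀ o t → ∣ Y o t ∣ ≤ N̄ * 2ℚ
      Y≤ o (z , r , c) = ≤-trans (sumF-∣∣ n (λ i → E-∣∣ (η₀ i) (λ k _ →
          ∣∣-−-≤ (V (coef k (σ k) o * ((z + o) * (z + root k (σ k) o)) * r) c) _ (V≤1 _ c) (E-∣∣ 𝒲 (λ w _ → V≤1 _ c)))))
        (*-monoʳ 0≤2 n≤N)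

      P′-sum : sumF n (λ i → E (η₀ i) (λ k → P′ k (σ k))) ≡ E ηₗ (λ o → E τ (λ t → u t * Y o t))
      P′-sum = begin
        sumF n (λ i → E (η₀ i) (λ k → P′ k (σ k)))
          ≡⟨ sumF-cong n (λ i → E-ext (η₀ i) (λ k → E-ext ηₗ (λ o → sym (E-sample ζ ℛ (λ t → u t * d o k t))))) ⟩
        sumF n (λ i → E (η₀ i) (λ k → E ηₗ (λ o → E τ (λ t → u t * d o k t))))
          ≡⟨ sumF-cong n (λ i → E-swap (η₀ i) ηₗ _) ⟩
        sumF n (λ i → E ηₗ (λ o → E (η₀ i) (λ k → E τ (λ t → u t * d o k t))))
          ≡⟨ sumF-E n ηₗ _ ⟩
        E ηₗ (λ o → sumF n (λ i → E (η₀ i) (λ k → E τ (λ t → u t * d o k t))))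
          ≡⟨ E-ext ηₗ (λ o → trans (sumF-cong n (λ i → trans (E-swap (η₀ i) τ _) (E-ext τ (λ t → E-* (η₀ i) (u t) (λ k → d o k t)))))
               (trans (sumF-E n τ _) (E-ext τ (λ t → sumF-* n (u t) _)))) ⟩
        E ηₗ (λ o → E τ (λ t → u t * Y o t)) ∎
        where open ≡-Reasoning

      module _ (o : ℚ) (so : Supp ηₗ o) (sep : Sep (λ k → root k (σ k) o) n η₀) where
        open Core gζ (Good-mono inj₁ gℛ) V V≤1 (λ k → coef k (σ k) o) (λ k → root k (σ k) o) (λ k w → shift k (σ k) w)

        admissible : ∀ k → pre n η₀ k → Admissible k
        admissible k p with admit p
        ... | dσ , A≢0 , _ = raise (dshift (Dᵈ ⊗ dinv (A ⊗ oᵈ ⊕ kᵈ))) , (λ s → raise (dshift (def-w {n = 0} s))) , inj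
          where
          kᵈ = varᵈ {Sζ} (η⊆ζ (η₀⊆ p))
          oᵈ = varᵈ {Sζ} (ηₗ⊆ζ so)
          A = kᵈ ⊖ Def-mono η⊆ζ dσ
          dshift : ∀ {n t} → Def Sζ n t → Def Sζ _ (shift k (σ k) t)
          dshift d = (d ⊖ kᵈ) ⊗ dinv A
          inj : ∀ {v w} → shift k (σ k) v ≡ shift k (σ k) w → v ≡ w
          inj {v} {w} e = trans (lem v k) (trans (cong (_+ k) (*-cancelʳ {v - k} {w - k} (inv≢0 A≢0) e)) (sym (lem w k)))
            where
            lem : ∀ v k → v ≡ v - k + k
            lem = solve-∀ ℚ-ring

        YY : ℚ → ℚ → C → ℚ
        YY z r c = Y o (z , r , c) * Y o (z , r , c)

        YY≤ : ∀ z → Bd (N̄ * 2ℚ * (N̄ * 2ℚ)) (YY z)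
        YY≤ z r c = ∣∣-*-≤ (Y o (z , r , c)) (Y o (z , r , c)) (Y≤ o (z , r , c)) (Y≤ o (z , r , c))

        dilated : ∀ z → Supp ζ z → ∣ EΩ ℛ (λ r → YY z (inv (z + o) * r)) - EΩ ℛ (YY z) ∣ ≤ N̄ * 2ℚ * (N̄ * 2ℚ) * h
        dilated z sz = dilate gℛ (raise (dinv (varᵈ (inj₂ sz) ⊕ varᵈ (inj₁ (ηₗ⊆ζ so))))) (inv≢0 (big+≢0 gζ sz (var (ηₗ⊆ζ so)))) _
            (YY z) (YY≤ z)

        dilated≡ : ∀ z → Supp ζ z → ∀ r c → YY z (inv (z + o) * r) c ≡ partial τ term n η₀ (z , r , c) * partial τ term n η₀ (z , r , c)
        dilated≡ z sz r c = cong₂ _*_ same same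
          where
          lem : ∀ q a x i r → q * (a * x) * (i * r) ≡ a * i * (q * x * r)
          lem = solve-∀ ℚ-ring
          arg : ∀ q x → q * ((z + o) * x) * (inv (z + o) * r) ≡ q * x * r
          arg q x = trans (lem q (z + o) x (inv (z + o)) r)
            (trans (cong (_* (q * x * r)) (*-invʳ (big+≢0 gζ sz (var (ηₗ⊆ζ so))))) (*-identityˡ (q * x * r)))
          same : Y o (z , inv (z + o) * r , c) ≡ partial τ term n η₀ (z , r , c)
          same = sumF-cong n (λ i → E-ext (η₀ i) (λ k → cong₂ _-_ (cong (λ t → V t c) (arg (coef k (σ k) o) (z + root k (σ k) o)))
            (E-ext 𝒲 (λ w → cong (λ t → V t c) (arg (coef k (σ k) o) (z + shift k (σ k) w))))))

        EYY≤ : E τ (λ t → Y o t * Y o t) ≤ N̄ * (6ℚ * δ₃) * (N̄ * (6ℚ * δ₃))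
        EYY≤ = begin
          E τ (λ t → Y o t * Y o t)                       ≡⟨ E-sample ζ ℛ _ ⟩
          E ζ (λ z → EΩ ℛ (YY z))                        ≤⟨ close-≤ (E ζ (λ z → EΩ ℛ (YY z)))
              (E ζ (λ z → EΩ ℛ (λ r → YY z (inv (z + o) * r))))
                                                              (E-close ζ
                                                                  (λ z sz → subst (_≤ err)
                                                                      (∣-∣-comm (EΩ ℛ (λ r → YY z (inv (z + o) * r)))
                                                                          (EΩ ℛ (YY z))) (dilated z sz))) ⟩
          E ζ (λ z → EΩ ℛ (λ r → YY z (inv (z + o) * r))) + err ≡⟨ cong (_+ err)
              (trans (E-cong ζ (λ z sz → E-ext ℛ (λ r → E-ext 𝒞 (dilated≡ z sz r)))) (sym (E-sample ζ ℛ _))) ⟩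
          E τ (λ t → partial τ term n η₀ t * partial τ term n η₀ t) + err ≤⟨ +-monoˡ-≤ err (bound-sum n η₀ n≤N admissible sep) ⟩
          nat n * (4ℚ + (N̄ * 14h + N̄ * 14h)) + err       ≤⟨ +-monoˡ-≤ err
              (*-mono-≤ (0≤nat n) (0≤+ (0≤* 0≤N̄ (0≤* 0≤4 0≤h)) (0≤+ 0≤N14h 0≤N14h)) n≤N (+-monoˡ-≤ (N̄ * 14h + N̄ * 14h) four)) ⟩
          -- In units of N̄²h: 4 from the diagonal, 28 from the cross terms and 4 from the dilation,
          -- hence the perfect square 36.
          N̄ * (N̄ * (4ℚ * h) + (N̄ * 14h + N̄ * 14h)) + err ≡⟨ fin N̄ h ⟩
          N̄ * N̄ * (6ℚ * 6ℚ * h)                          ≡⟨ trans (cong (λ t → N̄ * N̄ * (6ℚ * 6ℚ * t)) h-def) (fin₂ N̄ δ₃) ⟩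
          N̄ * (6ℚ * δ₃) * (N̄ * (6ℚ * δ₃))                ∎
          where
          open ≤-Reasoning

          err = N̄ * 2ℚ * (N̄ * 2ℚ) * h
          0≤4 : 0ℚ ≤ 4ℚ
          0≤4 = 0≤+ 0≤2 0≤2
          0≤N14h : 0ℚ ≤ N̄ * 14h
          0≤N14h = 0≤* 0≤N̄ 0≤14h
          four : 4ℚ ≤ N̄ * (4ℚ * h)
          four = subst₂ _≤_ (*-identityʳ 4ℚ) (swap-factors 4ℚ N̄ h) (*-monoˡ 0≤4 N̄h≥1)
          fin : ∀ N h → let two = 1ℚ + 1ℚ; four = two + two; six = four + two in N *
              (N * (four * h) + (N * (h + h + (h + h + two * h) + (h + h + two * h) + (h + h + two * h)) + N *
                  (h + h + (h + h + two * h) + (h + h + two * h) + (h + h + two * h)))) + N * two * (N * two) * h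
            ≡ N * N * (six * six * h)
          fin = solve-∀ ℚ-ring
          fin₂ : ∀ N s → let two = 1ℚ + 1ℚ; four = two + two; six = four + two in N * N * (six * six * (s * s)) ≡ N * (six * s) *
              (N * (six * s))
          fin₂ = solve-∀ ℚ-ring

        uY≤ : ∣ E τ (λ t → u t * Y o t) ∣ ≤ N̄ * (6ℚ * δ₃)
        uY≤ = cauchy-schwarz τ u (Y o) (0≤* 0≤N̄ (0≤* (0≤+ (0≤+ 0≤2 0≤2) 0≤2) 0≤δ₃)) (λ { (z , r , c) → V≤1 _ c }) EYY≤

      prefix-bound : (∀ o → Supp ηₗ o → Sep (λ k → root k (σ k) o) n η₀) →
        ∣ sumF n (λ i → E (η₀ i) (λ k → P k (σ k))) ∣ ≤ N̄ * (6ℚ * δ₃ + 6h)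
      prefix-bound sep = begin
        ∣ X ∣                                   ≡⟨ cong ∣_∣ (lem X X′) ⟩
        ∣ X′ + (X - X′) ∣                       ≤⟨ ∣∣-+-≤ X′ (X - X′) X′≤ near ⟩
        N̄ * (6ℚ * δ₃) + N̄ * 6h                  ≡⟨ sym (*-distribˡ-+ N̄ (6ℚ * δ₃) 6h) ⟩
        N̄ * (6ℚ * δ₃ + 6h)                     ∎
        where
        open ≤-Reasoning
        X = sumF n (λ i → E (η₀ i) (λ k → P k (σ k)))
        X′ = sumF n (λ i → E (η₀ i) (λ k → P′ k (σ k)))
        lem : ∀ x y → x ≡ y + (x - y)
        lem = solve-∀ ℚ-ring
        X′≤ : ∣ X′ ∣ ≤ N̄ * (6ℚ * δ₃)
        X′≤ = subst (λ t → ∣ t ∣ ≤ N̄ * (6ℚ * δ₃)) (sym P′-sum) (E-∣∣ ηₗ (λ o so → uY≤ o so (sep o so)))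
        near : ∣ X - X′ ∣ ≤ N̄ * 6h
        near = ≤-trans (sumF-close n (λ i → E-close (η₀ i) (λ k s → sub₁ k (i , s)))) (*-monoʳ 0≤6h n≤N)
          where
          sub₁ : ∀ k → pre n η₀ k → ∣ P k (σ k) - P′ k (σ k) ∣ ≤ 6h
          sub₁ k p with admit p
          ... | dσ , A≢0 , β≢0 = substitute (var (η₀⊆ p)) dσ A≢0 β≢0

    -- Large points avoid definable roots.

    0≤4 : 0ℚ ≤ 4ℚ
    0≤4 = 0≤+ 0≤2 0≤2

    0≤6 : 0ℚ ≤ 6ℚ
    0≤6 = 0≤+ 0≤4 0≤2

    -- Absolute values are not among the operations of `Def`; this polynomial majorant is, and so
    -- can be compared with large points.
    ∣∣≤sq+1 : ∀ b → ∣ b ∣ ≤ b * b + 1ℚ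
    ∣∣≤sq+1 b = subst (λ t → ∣ b ∣ ≤ t + 1ℚ) (∣∣-sq b) (at-nonneg ∣ b ∣ (0≤∣p∣ b))
      where
      at-nonneg : ∀ b → 0ℚ ≤ b → b ≤ b * b + 1ℚ
      at-nonneg b 0≤b with ≤-total b 1ℚ
      ... | inj₁ b≤1 = ≤-trans b≤1 (≤-by (sq≥0 b) (+-comm (b * b) 1ℚ))
      ... | inj₂ 1≤b = ≤-trans (subst (_≤ b * b) (*-identityʳ b) (*-monoˡ 0≤b 1≤b)) (≤-by 0≤1 refl)

    sq≢ : ∀ {k a} → ∣ 1ℚ ∣ < ∣ k ∣ → ∣ a ∣ < ∣ k ∣ → k * k ≢ a
    sq≢ {k} {a} 1<k a<k e = <-irrefl refl (<-≤-trans a<k (subst₂ _≤_ (*-identityʳ ∣ k ∣)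
        (trans (sym (∣p*q∣≡∣p∣*∣q∣ k k)) (cong ∣_∣ e)) (*-monoˡ (0≤∣p∣ k) (<⇒≤ 1<k))))

    -- A root satisfies ∣o∣ ≤ ∣b∣ + ∣c∣ once ∣o∣ ≥ 1, and the right-hand side is at most the
    -- definable number `q`, which every point of the support exceeds.
    no-big-root : ∀ {S ε L} → GoodAt ε S L → ∀ {o} → Supp L o → ∀ {b c} → Def S 10 b → Def S 10 c → o * o ≢ b * o + c
    no-big-root g {o} s {b} {c} db dc e = <-irrefl refl (≤-<-trans le lt)
      where
      q = b * b + 1ℚ + (c * c + 1ℚ)
      q<o : q < ∣ o ∣
      q<o = ≤-<-trans (x≤∣x∣ q) (big g s (raise (db ⊗ db ⊕ 1ᵈ ⊕ (dc ⊗ dc ⊕ 1ᵈ))))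
      1≤o : 1ℚ ≤ ∣ o ∣
      1≤o = ≤-trans (x≤∣x∣ 1ℚ) (<⇒≤ (big g s c1))
      lt : q * ∣ o ∣ < ∣ o ∣ * ∣ o ∣
      lt = *-monoˡ-<-pos ∣ o ∣ {{positive (<-≤-trans 0<1 1≤o)}} q<o
      le : ∣ o ∣ * ∣ o ∣ ≤ q * ∣ o ∣
      le = begin
        ∣ o ∣ * ∣ o ∣                    ≡⟨ trans (sym (∣p*q∣≡∣p∣*∣q∣ o o)) (cong ∣_∣ e) ⟩
        ∣ b * o + c ∣                    ≤⟨ ∣∣-+-≤ (b * o) c (∣∣-*-≤ b o (∣∣≤sq+1 b) ≤-refl) (∣∣≤sq+1 c) ⟩
        (b * b + 1ℚ) * ∣ o ∣ + (c * c + 1ℚ) ≡⟨ cong ((b * b + 1ℚ) * ∣ o ∣ +_) (sym (*-identityʳ (c * c + 1ℚ))) ⟩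
        (b * b + 1ℚ) * ∣ o ∣ + (c * c + 1ℚ) * 1ℚ ≤⟨ +-monoʳ-≤ ((b * b + 1ℚ) * ∣ o ∣) (*-monoˡ (0≤+ (sq≥0 c) 0≤1) 1≤o) ⟩
        (b * b + 1ℚ) * ∣ o ∣ + (c * c + 1ℚ) * ∣ o ∣ ≡⟨ sym (*-distribʳ-+ ∣ o ∣ (b * b + 1ℚ) (c * c + 1ℚ)) ⟩
        q * ∣ o ∣                        ∎
        where open ≤-Reasoning

    e+e≢0 : 2e ≢ 0ℚ
    e+e≢0 e≡ = *≢0 e≢0 two≢0 (trans (lem e) e≡)
      where
      lem : ∀ e → e * (1ℚ + 1ℚ) ≡ e + e
      lem = solve-∀ ℚ-ring
      two≢0 : 1ℚ + 1ℚ ≢ 0ℚ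
      two≢0 ()

    β≢0 : ∀ {k} → k ≢ 0ℚ → k * k ≢ D → β k ≢ 0ℚ
    β≢0 k≢0 k²≢D = *≢0 (*≢0 e+e≢0 k≢0) (inv≢0 (-≢0 k²≢D))

    x-y≡0⇒x≡y : ∀ {x y} → x - y ≡ 0ℚ → x ≡ y
    x-y≡0⇒x≡y {x} {y} e with x ℚ.≟ y
    ... | yes p = p
    ... | no n = ⊥-elim (-≢0 n e)

    opaque
      unfolding 𝒲
      𝒲-≢0 : ∀ {w} → Supp 𝒲 w → w ≢ 0ℚ
      𝒲-≢0 (i , refl) = nat≢0 (Fin.toℕ i)

    module RootEquation (k s o : ℚ) (A≢0 : k - s ≢ 0ℚ) (l≢0 : (k - s) * o + k ≢ 0ℚ) where
      private
        A = k - s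
        l = A * o + k
        ρ = (D * inv l - k) * inv A

      -- Adding 1 to the root replaces k by s in its numerator, because A = k - s; this makes the
      -- comparison of two roots linear in l.
      root-equation : (ρ + 1ℚ) * (l * A) ≡ D - s * l
      root-equation = begin
        (ρ + 1ℚ) * (l * A)                            ≡⟨ lem₁ D (inv l) k (inv A) l A ⟩
        (D * (l * inv l) - k * l) * (A * inv A) + l * A ≡⟨ cong₂ (λ x y → (D * x - k * l) * y + l * A) (*-invʳ l≢0) (*-invʳ A≢0) ⟩
        (D * 1ℚ - k * l) * 1ℚ + l * A                  ≡⟨ lem₂ D k l s ⟩
        D - s * l                                     ∎
        where
        open ≡-Reasoning
        lem₁ : ∀ D i k a l A → ((D * i - k) * a + 1ℚ) * (l * A) ≡ (D * (l * i) - k * l) * (A * a) + l * A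
        lem₁ = solve-∀ ℚ-ring
        lem₂ : ∀ D k l s → (D * 1ℚ - k * l) * 1ℚ + l * (k - s) ≡ D - s * l
        lem₂ = solve-∀ ℚ-ring

    -- Cross terms along a block.

    module BlockCorrelation {S Sζ ζ ℛ} (gζ : Good Sζ ζ) (gℛ : Good (Sζ ∪ Supp ζ) ℛ) (S⊆ζ : S ⊆ Sζ)
      (V : ℚ → C → ℚ) (V≤1 : Bd 1ℚ V) where

      τ : Law (ℚ × ℚ × C)
      τ = sample ζ ℛ

      Δτ : ℚ → ℚ × ℚ × C → ℚ
      Δτ k (z , r , c) = Δ V k z r c

      Δτ≤2 : ∀ k t → ∣ Δτ k t ∣ ≤ 2ℚ
      Δτ≤2 l (z , r , c) = ∣∣-−-≤ (form V (β l) l (D * inv l) z r c) (smooth V (β l) l z r c) (V≤1 _ c) (E-∣∣ 𝒲 (λ w _ → V≤1 _ c))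

      cb : ℚ
      cb = (6ℚ * δ₃ + 6h) + (6ℚ * δ₃ + 6h)

      -- The newest law supplies the random root l. Expanding Δ for its predecessors gives one
      -- prefix sum with second root D/k and an average over w of prefix sums with second root w,
      -- each within reach of `PrefixBound`.
      module Step (n : ℕ) (η : Fin (suc n) → Law ℚ) (n≤N : nat n ≤ N̄) (hi : Hier S n (η ∘ inject₁))
        (gη : Good (S ∪ pre n (η ∘ inject₁)) (η (fromℕ n))) (η⊆ζ : pre (suc n) η ⊆ Sζ) where

        η₀ : Fin n → Law ℚ
        η₀ = η ∘ inject₁

        ηₗ : Law ℚ
        ηₗ = η (fromℕ n)

        Sη : ℚ → Set
        Sη = S ∪ pre n η₀

        Sη⊆ζ : Sη ⊆ Sζ
        Sη⊆ζ (inj₁ s) = S⊆ζ s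
        Sη⊆ζ (inj₂ p) = η⊆ζ (pre-init n η p)

        open CrossTerm gη gζ gℛ Sη⊆ζ (λ s → η⊆ζ (fromℕ n , s)) V V≤1

        module _ {k} (p : pre n η₀ k) where
          k≢0 : k ≢ 0ℚ
          k≢0 refl = <-irrefl refl (Hier-big n η₀ hi p c0)

          k²≢D : k * k ≢ D
          k²≢D = sq≢ (Hier-big n η₀ hi p c1) (Hier-big n η₀ hi p cD)

          k≢D/k : k - D * inv k ≢ 0ℚ
          k≢D/k e = k²≢D (trans (cong (_* k) (x-y≡0⇒x≡y {k} {D * inv k} e))
              (trans (*-assoc D (inv k) k) (trans (cong (D *_) (inv-sym k≢0)) (*-identityʳ D))))

          k≢w : ∀ {w} → Supp 𝒲 w → k - w ≢ 0ℚ
          k≢w {w} s e = <-irrefl (cong ∣_∣ (sym (x-y≡0⇒x≡y {k} {w} e))) (Hier-big n η₀ hi p (def-w s))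

          l≢0 : ∀ {s} → Def Sη 6 s → k - s ≢ 0ℚ → ∀ {o} → Supp ηₗ o → (k - s) * o + k ≢ 0ℚ
          l≢0 {s} ds A≢0 {o} so e = big≢ gη so (raise (ng (varᵈ (inj₂ p) ⊗ dinv (varᵈ (inj₂ p) ⊖ ds)))) (begin
            o                                   ≡⟨ lem₁ o ⟩
            1ℚ * o                              ≡⟨ cong (_* o) (sym (*-invʳ A≢0)) ⟩
            (k - s) * inv (k - s) * o           ≡⟨ lem₂ (k - s) (inv (k - s)) o k ⟩
            inv (k - s) * ((k - s) * o + k) + - (k * inv (k - s)) ≡⟨ cong (λ t → inv (k - s) * t + - (k * inv (k - s))) e ⟩
            inv (k - s) * 0ℚ + - (k * inv (k - s)) ≡⟨ lem₃ (inv (k - s)) (- (k * inv (k - s))) ⟩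
            - (k * inv (k - s))                 ∎)
            where
            open ≡-Reasoning
            lem₁ : ∀ o → o ≡ 1ℚ * o
            lem₁ = solve-∀ ℚ-ring
            lem₂ : ∀ A i o k → A * i * o ≡ i * (A * o + k) + - (k * i)
            lem₂ = solve-∀ ℚ-ring
            lem₃ : ∀ i x → i * 0ℚ + x ≡ x
            lem₃ = solve-∀ ℚ-ring

        k²-distinct : ∀ {k k̃} → ∣ k ∣ < ∣ k̃ ∣ → k * k ≢ k̃ * k̃
        k²-distinct {k} {k̃} lt e = <-irrefl refl (<-≤-trans lt (sq-cancel-≤ (0≤∣p∣ k)
            (≤-reflexive (trans (∣∣-sq k̃) (trans (sym e) (sym (∣∣-sq k)))))))

        -- By `eqn` the root determines the product l k, and l k = k²(o + 1) - D o determines k²;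
        -- points of different laws have different squares.
        sep-D/k : ∀ o → Supp ηₗ o → Sep (λ k → root k (D * inv k) o) n η₀
        sep-D/k o so = Hier-sep n η₀ hi _ distinct
          where
          dD/k : ∀ {k} → pre n η₀ k → Def Sη 6 (D * inv k)
          dD/k p = raise (Dᵈ ⊗ dinv (varᵈ (inj₂ p)))
          eqn : ∀ k → pre n η₀ k → (root k (D * inv k) o + 1ℚ) * (((k - D * inv k) * o + k) * k) ≡ - (D * o)
          eqn k p = *-cancelʳ (k≢D/k p) (begin
            (ρ + 1ℚ) * (l * k) * A     ≡⟨ lem₁ (ρ + 1ℚ) l k A ⟩
            (ρ + 1ℚ) * (l * A) * k     ≡⟨ cong (_* k) (RootEquation.root-equation k (D * inv k) o (k≢D/k p) (l≢0 p (dD/k p) (k≢D/k p) so)) ⟩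
            (D - D * inv k * l) * k    ≡⟨ lem₂ D (inv k) l k ⟩
            D * k - D * (k * inv k) * l ≡⟨ cong (λ t → D * k - D * t * l) (*-invʳ (k≢0 p)) ⟩
            D * k - D * 1ℚ * l         ≡⟨ lem₃ D k A o ⟩
            - (D * o) * A              ∎)
            where
            open ≡-Reasoning
            ρ = root k (D * inv k) o
            A = k - D * inv k
            l = A * o + k
            lem₁ : ∀ a b c d → a * (b * c) * d ≡ a * (b * d) * c
            lem₁ = solve-∀ ℚ-ring
            lem₂ : ∀ D i l k → (D - D * i * l) * k ≡ D * k - D * (k * i) * l
            lem₂ = solve-∀ ℚ-ring
            lem₃ : ∀ D k A o → D * k - D * 1ℚ * (A * o + k) ≡ - (D * o) * A
            lem₃ = solve-∀ ℚ-ring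
          lk : ∀ k → pre n η₀ k → ((k - D * inv k) * o + k) * k ≡ k * k * (o + 1ℚ) - D * o
          lk k p = trans (lem D (inv k) k o) (trans (cong (λ t → k * k * (o + 1ℚ) - D * t * o) (*-invʳ (k≢0 p)))
              (cong (λ t → k * k * (o + 1ℚ) - t * o) (*-identityʳ D)))
            where
            lem : ∀ D i k o → ((k - D * i) * o + k) * k ≡ k * k * (o + 1ℚ) - D * (k * i) * o
            lem = solve-∀ ℚ-ring
          distinct : ∀ k l → pre n η₀ k → pre n η₀ l → ∣ k ∣ < ∣ l ∣ → root k (D * inv k) o ≢ root l (D * inv l) o
          distinct k k̃ p p̃ lt e = k²-distinct lt (*-cancelʳ o+1≢0 (begin
            k * k * (o + 1ℚ)                   ≡⟨ lem (k * k * (o + 1ℚ)) (D * o) ⟩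
            k * k * (o + 1ℚ) - D * o + D * o   ≡⟨ cong (_+ D * o) (sym (lk k p)) ⟩
            l * k + D * o                      ≡⟨ cong (_+ D * o) lk≡ ⟩
            l̃ * k̃ + D * o                      ≡⟨ cong (_+ D * o) (lk k̃ p̃) ⟩
            k̃ * k̃ * (o + 1ℚ) - D * o + D * o   ≡⟨ sym (lem (k̃ * k̃ * (o + 1ℚ)) (D * o)) ⟩
            k̃ * k̃ * (o + 1ℚ)                   ∎))
            where
            open ≡-Reasoning
            l = (k - D * inv k) * o + k
            l̃ = (k̃ - D * inv k̃) * o + k̃
            ρ = root k (D * inv k) o
            o+1≢0 : o + 1ℚ ≢ 0ℚ
            o+1≢0 = big+≢0 gη so c1
            lem : ∀ a b → a ≡ a - b + b
            lem = solve-∀ ℚ-ring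
            -Do≢0 : - (D * o) ≢ 0ℚ
            -Do≢0 e′ = *≢0 D≢0 (big≢0 gη so) (trans (lem₂ (D * o)) (cong -_ e′))
              where
              lem₂ : ∀ a → a ≡ - (- a)
              lem₂ = solve-∀ ℚ-ring
            ρ+1≢0 : ρ + 1ℚ ≢ 0ℚ
            ρ+1≢0 e′ = -Do≢0 (trans (sym (eqn k p)) (trans (cong (_* (l * k)) e′) (*-zeroˡ (l * k))))
            lk≡ : l * k ≡ l̃ * k̃
            lk≡ = *-cancelʳ ρ+1≢0 (begin
              l * k * (ρ + 1ℚ)       ≡⟨ *-comm (l * k) (ρ + 1ℚ) ⟩
              (ρ + 1ℚ) * (l * k)     ≡⟨ trans (eqn k p) (sym (eqn k̃ p̃)) ⟩
              (root k̃ (D * inv k̃) o + 1ℚ) * (l̃ * k̃) ≡⟨ cong (λ t → (t + 1ℚ) * (l̃ * k̃)) (sym e) ⟩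
              (ρ + 1ℚ) * (l̃ * k̃)     ≡⟨ *-comm (ρ + 1ℚ) (l̃ * k̃) ⟩
              l̃ * k̃ * (ρ + 1ℚ)       ∎)

        sep-w : ∀ {w} → Supp 𝒲 w → ∀ o → Supp ηₗ o → Sep (λ k → root k w o) n η₀
        sep-w {w} sw o so = Hier-sep n η₀ hi _ distinct
          where
          -- With O = o + 1, equality of the roots forces the quadratic relation (D-w²)(A+Ã)O + (D-w²)w = wAÃO².
          distinct : ∀ k l → pre n η₀ k → pre n η₀ l → ∣ k ∣ < ∣ l ∣ → root k w o ≢ root l w o
          distinct k k̃ p p̃ lt e = no-big-root gη so (raise dB) (raise dG) quadratic
            where
            A = k - w
            Ã = k̃ - w
            l = A * o + k
            l̃ = Ã * o + k̃
            ρ = root k w o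
            dA : Def Sη 2 A
            dA = varᵈ (inj₂ p) ⊖ def-w {n = 0} sw
            dÃ : Def Sη 2 Ã
            dÃ = varᵈ (inj₂ p̃) ⊖ def-w {n = 0} sw
            i = inv (w * A * Ã)
            c = D - w * w
            wᵈ = def-w {Sη} {n = 0} sw
            dI : Def Sη 5 i
            dI = dinv (wᵈ ⊗ dA ⊗ dÃ)
            dc : Def Sη 3 c
            dc = Dᵈ ⊖ wᵈ ⊗ wᵈ
            B = c * (A + Ã) * i - (1ℚ + 1ℚ)
            G = (c * (A + Ã) + c * w) * i - 1ℚ
            dB = dc ⊗ (dA ⊕ dÃ) ⊗ dI ⊖ (1ᵈ ⊕ 1ᵈ)
            dG = (dc ⊗ (dA ⊕ dÃ) ⊕ dc ⊗ wᵈ) ⊗ dI ⊖ 1ᵈ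
            k≢k̃ : k̃ - k ≢ 0ℚ
            k≢k̃ = -≢0 (λ e′ → <-irrefl (cong ∣_∣ (sym e′)) lt)
            wAÃ≢0 : w * A * Ã ≢ 0ℚ
            wAÃ≢0 = *≢0 (*≢0 (𝒲-≢0 sw) (k≢w p sw)) (k≢w p̃ sw)
            eqn = RootEquation.root-equation k w o (k≢w p sw) (l≢0 p (def-w sw) (k≢w p sw) so)
            eqñ = RootEquation.root-equation k̃ w o (k≢w p̃ sw) (l≢0 p̃ (def-w sw) (k≢w p̃ sw) so)
            crossed : (D - w * l) * (l̃ * Ã) ≡ (D - w * l̃) * (l * A)
            crossed = begin
              (D - w * l) * (l̃ * Ã)             ≡⟨ cong (_* (l̃ * Ã)) (sym eqn) ⟩
              (ρ + 1ℚ) * (l * A) * (l̃ * Ã)      ≡⟨ cong (λ t → (t + 1ℚ) * (l * A) * (l̃ * Ã)) e ⟩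
              (root k̃ w o + 1ℚ) * (l * A) * (l̃ * Ã) ≡⟨ lem (root k̃ w o + 1ℚ) (l * A) (l̃ * Ã) ⟩
              (root k̃ w o + 1ℚ) * (l̃ * Ã) * (l * A) ≡⟨ cong (_* (l * A)) eqñ ⟩
              (D - w * l̃) * (l * A)             ∎
              where
              open ≡-Reasoning
              lem : ∀ a b c → a * b * c ≡ a * c * b
              lem = solve-∀ ℚ-ring
            O = o + 1ℚ
            reduced : c * (A + Ã) * O + c * w ≡ w * A * Ã * (O * O)
            reduced = *-cancelʳ k≢k̃ (x-y≡0⇒x≡y (trans (sym (lem D w k k̃ o))
                (trans (cong (_- (D - w * l̃) * (l * A)) crossed) (+-inverseʳ ((D - w * l̃) * (l * A))))))
              where
              lem : ∀ D w k k̃ o →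
                (D - w * ((k - w) * o + k)) * (((k̃ - w) * o + k̃) * (k̃ - w)) - (D - w * ((k̃ - w) * o + k̃)) *
                    (((k - w) * o + k) * (k - w))
                ≡ ((D - w * w) * ((k - w) + (k̃ - w)) * (o + 1ℚ) + (D - w * w) * w) * (k̃ - k) - w * (k - w) * (k̃ - w) *
                    ((o + 1ℚ) * (o + 1ℚ)) * (k̃ - k)
              lem = solve-∀ ℚ-ring
            quadratic : o * o ≡ B * o + G
            quadratic = begin
              o * o                                               ≡⟨ lem₁ o ⟩
              1ℚ * (O * O) - (1ℚ + 1ℚ) * o - 1ℚ                   ≡⟨ cong (λ t → t * (O * O) - (1ℚ + 1ℚ) * o - 1ℚ) (sym (*-invʳ wAÃ≢0)) ⟩
              w * A * Ã * i * (O * O) - (1ℚ + 1ℚ) * o - 1ℚ        ≡⟨ lem₂ (w * A * Ã) i (O * O) o ⟩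
              w * A * Ã * (O * O) * i - (1ℚ + 1ℚ) * o - 1ℚ        ≡⟨ cong (λ t → t * i - (1ℚ + 1ℚ) * o - 1ℚ) (sym reduced) ⟩
              (c * (A + Ã) * O + c * w) * i - (1ℚ + 1ℚ) * o - 1ℚ  ≡⟨ lem₃ (c * (A + Ã)) (c * w) i o ⟩
              B * o + G                                           ∎
              where
              open ≡-Reasoning
              lem₁ : ∀ o → o * o ≡ 1ℚ * ((o + 1ℚ) * (o + 1ℚ)) - (1ℚ + 1ℚ) * o - 1ℚ
              lem₁ = solve-∀ ℚ-ring
              lem₂ : ∀ a i q o → a * i * q - (1ℚ + 1ℚ) * o - 1ℚ ≡ a * q * i - (1ℚ + 1ℚ) * o - 1ℚ
              lem₂ = solve-∀ ℚ-ring
              lem₃ : ∀ x y i o → (x * (o + 1ℚ) + y) * i - (1ℚ + 1ℚ) * o - 1ℚ ≡ (x * i - (1ℚ + 1ℚ)) * o + ((x + y) * i - 1ℚ)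
              lem₃ = solve-∀ ℚ-ring

        cross-step : E τ (λ t → partial τ Δτ n η₀ t * E ηₗ (λ l → Δτ l t)) ≤ N̄ * cb
        cross-step = begin
          E τ (λ t → partial τ Δτ n η₀ t * G t)                ≡⟨ E-ext τ
              (λ t → trans (*-comm (partial τ Δτ n η₀ t) (G t)) (sym (sumF-* n (G t) _))) ⟩
          E τ (λ t → sumF n (λ i → G t * E (η₀ i) (λ k → Δτ k t))) ≡⟨ sym (sumF-E n τ _) ⟩
          sumF n (λ i → E τ (λ t → G t * E (η₀ i) (λ k → Δτ k t))) ≡⟨ sumF-cong n
              (λ i → trans (E-ext τ (λ t → sym (E-* (η₀ i) (G t) (λ k → Δτ k t)))) (E-swap τ (η₀ i) _)) ⟩
          sumF n (λ i → E (η₀ i) (λ k → E τ (λ t → G t * Δτ k t))) ≡⟨ sumF-cong n (λ i → E-ext (η₀ i) split) ⟩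
          sumF n (λ i → E (η₀ i) (λ k → P k (D * inv k) - E 𝒲 (λ w → P k w))) ≡⟨ sumF-cong n
              (λ i → trans (E-− (η₀ i) _ _) (cong (λ t → E (η₀ i) (λ k → P k (D * inv k)) - t) (E-swap (η₀ i) 𝒲 _))) ⟩
          sumF n (λ i → E (η₀ i) (λ k → P k (D * inv k)) - E 𝒲 (λ w → E (η₀ i) (λ k → P k w))) ≡⟨ sumF-− n _ _ ⟩
          X - sumF n (λ i → E 𝒲 (λ w → E (η₀ i) (λ k → P k w))) ≡⟨ cong (λ t → X - t) (sumF-E n 𝒲 _) ⟩
          X - E 𝒲 Z                                            ≤⟨ ∣∣≤⇒≤ (∣∣-−-≤ X (E 𝒲 Z) X≤ (E-∣∣ 𝒲 Z≤)) ⟩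
          N̄ * (6ℚ * δ₃ + 6h) + N̄ * (6ℚ * δ₃ + 6h)              ≡⟨ sym (*-distribˡ-+ N̄ _ _) ⟩
          N̄ * cb                                               ∎
          where
          open ≤-Reasoning
          G : ℚ × ℚ × C → ℚ
          G t = E ηₗ (λ l → Δτ l t)
          fm : ℚ → ℚ → ℚ × ℚ × C → ℚ
          fm k s (z , r , c) = form V (β k) k s z r c
          X = sumF n (λ i → E (η₀ i) (λ k → P k (D * inv k)))
          Z : ℚ → ℚ
          Z w = sumF n (λ i → E (η₀ i) (λ k → P k w))
          sumF-− : ∀ n (f g : Fin n → ℚ) → sumF n (λ i → f i - g i) ≡ sumF n f - sumF n g
          sumF-− n f g = trans (sumF-+ n f (λ i → - g i)) (cong (λ t → sumF n f + t)
            (trans (sumF-cong n (λ i → neg-* (g i))) (trans (sumF-* n (- 1ℚ) g) (sym (neg-* (sumF n g))))))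
            where
            neg-* : ∀ x → - x ≡ - 1ℚ * x
            neg-* = solve-∀ ℚ-ring
          P≡ : ∀ k s → E τ (λ t → G t * fm k s t) ≡ P k s
          P≡ k s = trans (E-ext τ (λ t → trans (*-comm (G t) (fm k s t)) (sym (E-* ηₗ (fm k s t) (λ l → Δτ l t)))))
            (trans (E-swap τ ηₗ _) (E-ext ηₗ (λ l → E-sample ζ ℛ (λ t → fm k s t * Δτ l t))))
          split : ∀ k → E τ (λ t → G t * Δτ k t) ≡ P k (D * inv k) - E 𝒲 (λ w → P k w)
          split k = trans (E-ext τ (λ t → trans (distrib (G t) (fm k (D * inv k) t) _)
              (cong (λ x → G t * fm k (D * inv k) t - x) (sym (E-* 𝒲 (G t) (λ w → fm k w t))))))
            (trans (E-− τ _ _) (cong₂ _-_ (P≡ k (D * inv k)) (trans (E-swap τ 𝒲 _) (E-ext 𝒲 (λ w → P≡ k w)))))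
            where
            distrib : ∀ a b c → a * (b - c) ≡ a * b - a * c
            distrib = solve-∀ ℚ-ring
          X≤ : ∣ X ∣ ≤ N̄ * (6ℚ * δ₃ + 6h)
          X≤ = PrefixBound.prefix-bound gη gζ gℛ Sη⊆ζ (λ s → η⊆ζ (fromℕ n , s)) V V≤1 n n≤N η₀ inj₂ (λ k → D * inv k)
            (λ p → raise (Dᵈ ⊗ dinv (varᵈ (inj₂ p))) , k≢D/k p , β≢0 (k≢0 p) (k²≢D p)) sep-D/k
          Z≤ : ∀ w → Supp 𝒲 w → ∣ Z w ∣ ≤ N̄ * (6ℚ * δ₃ + 6h)
          Z≤ w sw = PrefixBound.prefix-bound gη gζ gℛ Sη⊆ζ (λ s → η⊆ζ (fromℕ n , s)) V V≤1 n n≤N η₀ inj₂ (λ k → w)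
            (λ p → def-w sw , k≢w p sw , β≢0 (k≢0 p) (k²≢D p)) (sep-w sw)

      block-cross : ∀ n (η : Fin n → Law ℚ) → nat n ≤ N̄ → Hier S n η → pre n η ⊆ Sζ → Cross τ Δτ (N̄ * cb) n η
      block-cross zero η n≤N hi η⊆ = tt
      block-cross (suc n) η n≤N (hi , g) η⊆ = block-cross n (η ∘ inject₁) n≤N′ hi (λ p → η⊆ (pre-init n η p)) , Step.cross-step n
          η n≤N′ hi g η⊆
        where
        n≤N′ : nat n ≤ N̄
        n≤N′ = ≤-trans (nat-mono-suc n) n≤N

    -- Correlations in the absence of monochromatic edges.

    conv-factors : ∀ a x i r → a * x * (i * r) ≡ i * x * (a * r)
    conv-factors = solve-∀ ℚ-ring

    N : ℚ → ℚ
    N z = z * z - D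

    -- The averaging operator whose kernel is the law of (z+w)(z+w′)/(z²-D).
    smoothing : Law ℚ → (ℚ → C → ℚ) → ℚ → C → ℚ
    smoothing ζ V r c = E ζ (λ z → E 𝒲 (λ w′ → E 𝒲 (λ w → form V (inv (N z)) w w′ z r c)))

    smoothing-bd : ∀ ζ V {b} → Bd b V → Bd b (smoothing ζ V)
    smoothing-bd ζ V V≤ r c = E-∣∣ ζ (λ z _ → E-∣∣ 𝒲 (λ w′ _ → E-∣∣ 𝒲 (λ w _ → V≤ _ c)))

    good-N≢0 : ∀ {S ε L} → GoodAt ε S L → ∀ {z} → Supp L z → N z ≢ 0ℚ
    good-N≢0 g s = -≢0 (sq≢ (big g s c1) (big g s cD))

    -- Diagonal, cross terms and one dilation again give 4 + 28 + 4 = 36 = 6². Passing from δ₃ to δ₂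
    -- puts the error on the scale of the replacement of D/k.
    replacement-error : 4ℚ * h + (14h + 14h) + 2ℚ * 2ℚ * h ≤ 6ℚ * δ₂ * (6ℚ * δ₂)
    replacement-error = begin
      4ℚ * h + (14h + 14h) + 2ℚ * 2ℚ * h  ≡⟨ fin h ⟩
      6ℚ * 6ℚ * h                         ≡⟨ cong (6ℚ * 6ℚ *_) h-def ⟩
      6ℚ * 6ℚ * (δ₃ * δ₃)                 ≤⟨ *-monoˡ (0≤* 0≤6 0≤6) (*-mono-≤ 0≤δ₃ 0≤δ₂ δ₃≤δ₂ δ₃≤δ₂) ⟩
      6ℚ * 6ℚ * (δ₂ * δ₂)                 ≡⟨ fin₂ 6ℚ δ₂ ⟩
      6ℚ * δ₂ * (6ℚ * δ₂)                 ∎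
      where
      open ≤-Reasoning
      fin : ∀ h → let two = 1ℚ + 1ℚ; four = two + two; six = four + two in four * h +
          ((h + h + (h + h + two * h) + (h + h + two * h) + (h + h + two * h)) +
              (h + h + (h + h + two * h) + (h + h + two * h) + (h + h + two * h))) + two * two * h
        ≡ six * six * h
      fin = solve-∀ ℚ-ring
      fin₂ : ∀ a s → a * a * (s * s) ≡ a * s * (a * s)
      fin₂ = solve-∀ ℚ-ring

    -- In units of δ₂: 8 for replacing D/k, 6 for replacing k, and 1 for the final dilation.
    15δ : ℚ
    15δ = (6ℚ + 2ℚ) * δ₂ + 6ℚ * δ₂ + δ₂

    module EdgeFree {S Sζ ζ ℛ} (gζ : Good Sζ ζ) (gℛ : Good (Sζ ∪ Supp ζ) ℛ) (S⊆ζ : S ⊆ Sζ)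
      (V : ℚ → C → ℚ) (V≤1 : Bd 1ℚ V) (η : Fin (suc m) → Law ℚ) (hi : Hier S (suc m) η) (η⊆ζ : pre (suc m) η ⊆ Sζ) where
      open BlockCorrelation gζ gℛ S⊆ζ V V≤1

      μ : Law ℚ
      μ = avg m η

      M₁ : ℚ × ℚ × C → ℚ
      M₁ t = E μ (λ k → Δτ k t)

      EM₁² : E τ (λ t → M₁ t * M₁ t) ≤ (6ℚ + 2ℚ) * δ₂ * ((6ℚ + 2ℚ) * δ₂)
      EM₁² = begin
        E τ (λ t → M₁ t * M₁ t)             ≤⟨ second-moment-avg τ Δτ m η cb (λ i k s t _ → Δτ≤2 k t)
            (block-cross (suc m) η ≤-refl hi η⊆ζ) ⟩
        4ℚ * inv (nat (suc m)) + (cb + cb)  ≤⟨ +-mono-≤ (*-monoˡ 0≤4 (≤-trans 1/m≤h h≤δ₃)) (+-mono-≤ cb≤ cb≤) ⟩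
        4ℚ * δ₃ + (4ℚ * (6ℚ * δ₃) + 4ℚ * (6ℚ * δ₃)) ≤⟨ ≤-by (0≤* (0≤+ 0≤6 0≤6) 0≤δ₃) (lem δ₃) ⟩
        (6ℚ + 2ℚ) * (6ℚ + 2ℚ) * δ₃          ≡⟨ trans (cong ((6ℚ + 2ℚ) * (6ℚ + 2ℚ) *_) δ₃-def) (lem₂ (6ℚ + 2ℚ) δ₂) ⟩
        (6ℚ + 2ℚ) * δ₂ * ((6ℚ + 2ℚ) * δ₂)   ∎
        where
        open ≤-Reasoning
        6h≤ : 6h ≤ 6ℚ * δ₃
        6h≤ = subst (_≤ 6ℚ * δ₃) (lem₀ h) (*-monoˡ 0≤6 h≤δ₃)
          where
          lem₀ : ∀ h → (1ℚ + 1ℚ + (1ℚ + 1ℚ) + (1ℚ + 1ℚ)) * h ≡ (1ℚ + 1ℚ) * h + ((1ℚ + 1ℚ) * h + (1ℚ + 1ℚ) * h)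
          lem₀ = solve-∀ ℚ-ring
        cb≤ : cb ≤ 4ℚ * (6ℚ * δ₃)
        cb≤ = ≤-trans (+-mono-≤ (+-monoʳ-≤ (6ℚ * δ₃) 6h≤) (+-monoʳ-≤ (6ℚ * δ₃) 6h≤)) (≤-reflexive (lem₀ (6ℚ * δ₃)))
          where
          lem₀ : ∀ x → x + x + (x + x) ≡ (1ℚ + 1ℚ + (1ℚ + 1ℚ)) * x
          lem₀ = solve-∀ ℚ-ring
        lem : ∀ s → let two = 1ℚ + 1ℚ; four = two + two; six = four + two; eight = four + four; twelve = six + six in eight * eight * s
          ≡ four * s + (four * (six * s) + four * (six * s))
            + twelve * s
        lem = solve-∀ ℚ-ring
        lem₂ : ∀ a s → a * a * (s * s) ≡ a * s * (a * s)
        lem₂ = solve-∀ ℚ-ring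

      M₂ : ℚ → ℚ × ℚ × C → ℚ
      M₂ w′ (z , r , c) = E μ (λ k → form V (β k) k w′ z r c - E 𝒲 (λ w → form V (β k) w w′ z r c))

      M₂≤2 : ∀ w′ t → ∣ M₂ w′ t ∣ ≤ 2ℚ
      M₂≤2 w′ (z , r , c) = E-∣∣ μ (λ k _ → ∣∣-−-≤ (form V (β k) k w′ z r c) (E 𝒲 (λ w → form V (β k) w w′ z r c)) (V≤1 _ c)
          (E-∣∣ 𝒲 (λ w _ → V≤1 _ c)))

      -- Once D/k has been replaced, z + w′ is a factor of all arguments. Dilating it away leaves
      -- linear forms whose roots are the points k themselves, so `Core` applies directly.
      EM₂² : ∀ w′ → Supp 𝒲 w′ → E τ (λ t → M₂ w′ t * M₂ w′ t) ≤ 6ℚ * δ₂ * (6ℚ * δ₂)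
      EM₂² w′ sw = begin
        E τ (λ t → M₂ w′ t * M₂ w′ t)        ≡⟨ E-sample ζ ℛ _ ⟩
        E ζ (λ z → EΩ ℛ (MM z))              ≤⟨ close-≤ (E ζ (λ z → EΩ ℛ (MM z))) (E ζ (λ z → EΩ ℛ (λ r → MM z (inv (z + w′) * r))))
                                                  (E-close ζ (λ z sz → subst (_≤ err)
                                                      (∣-∣-comm (EΩ ℛ (λ r → MM z (inv (z + w′) * r))) (EΩ ℛ (MM z)))
                                                    (dilate gℛ (raise (dinv (varᵈ (inj₂ sz) ⊕ def-w {n = 0} sw)))
                                                        (inv≢0 (z+w≢0 sz)) (2ℚ * 2ℚ) (MM z)
                                                            (λ r c → ∣∣-*-≤ (M₂ w′ (z , r , c)) (M₂ w′ (z , r , c))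
                                                                (M₂≤2 w′ (z , r , c)) (M₂≤2 w′ (z , r , c)))))) ⟩
        E ζ (λ z → EΩ ℛ (λ r → MM z (inv (z + w′) * r))) + err ≡⟨ cong (_+ err)
            (trans (E-cong ζ (λ z sz → E-ext ℛ (λ r → E-ext 𝒞 (λ c → cong₂ _*_ (same z sz r c) (same z sz r c)))))
                (sym (E-sample ζ ℛ (λ t → E μ (λ k → term k t) * E μ (λ k → term k t))))) ⟩
        E τ (λ t → E μ (λ k → term k t) * E μ (λ k → term k t)) + err ≤⟨ +-monoˡ-≤ err
            (bound-avg η (λ k p → var (η⊆ζ p) , def-w , id) sep) ⟩
        4ℚ * h + (14h + 14h) + err           ≤⟨ replacement-error ⟩
        6ℚ * δ₂ * (6ℚ * δ₂)                  ∎
        where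
        open ≤-Reasoning
        open Core gζ (Good-mono inj₁ gℛ) V V≤1 β (λ k → k) (λ k w → w)
        err = 2ℚ * 2ℚ * h
        MM : ℚ → ℚ → C → ℚ
        MM z r c = M₂ w′ (z , r , c) * M₂ w′ (z , r , c)
        z+w≢0 : ∀ {z} → Supp ζ z → z + w′ ≢ 0ℚ
        z+w≢0 sz = big+≢0 gζ sz (def-w sw)
        sep : Sep (λ k → k) (suc m) η
        sep = Hier-sep (suc m) η hi (λ k → k) (λ k l _ _ lt e → <-irrefl (cong ∣_∣ e) lt)
        arg : ∀ z → Supp ζ z → ∀ b x r → b * ((z + x) * (z + w′)) * (inv (z + w′) * r) ≡ b * (z + x) * r
        arg z sz b x r = trans (lem b (z + x) (z + w′) (inv (z + w′)) r)
          (trans (cong (_* (b * (z + x) * r)) (*-invʳ (z+w≢0 sz))) (*-identityˡ (b * (z + x) * r)))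
          where
          lem : ∀ b x a i r → b * (x * a) * (i * r) ≡ a * i * (b * x * r)
          lem = solve-∀ ℚ-ring
        same : ∀ z → Supp ζ z → ∀ r c → M₂ w′ (z , inv (z + w′) * r , c) ≡ E μ (λ k → term k (z , r , c))
        same z sz r c = E-ext μ (λ k → cong₂ _-_ (cong (λ t → V t c) (arg z sz (β k) k r))
            (E-ext 𝒲 (λ w → cong (λ t → V t c) (arg z sz (β k) w r))))
      module _ (free : ∀ {k z r} → Supp μ k → Supp ζ z → Supp ℛ r → ∀ c →
          V (N z * r) c * form V (β k) k (D * inv k) z r c ≡ 0ℚ) where

        u : ℚ × ℚ × C → ℚ
        u (z , r , c) = V (N z * r) c

        -- The true vertices, those with D/k replaced, and those with both roots replaced. `M₁` and
        -- `M₂′` are the successive differences.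
        A₀ A₁ A₂ M₂′ : ℚ × ℚ × C → ℚ
        A₀ (z , r , c) = E μ (λ k → form V (β k) k (D * inv k) z r c)
        A₁ (z , r , c) = E μ (λ k → E 𝒲 (λ w′ → form V (β k) k w′ z r c))
        A₂ (z , r , c) = E μ (λ k → E 𝒲 (λ w′ → E 𝒲 (λ w → form V (β k) w w′ z r c)))
        M₂′ t = E 𝒲 (λ w′ → M₂ w′ t)

        A₂≡ : ∀ t → A₂ t ≡ A₀ t - M₁ t - M₂′ t
        A₂≡ t@(z , r , c) = trans (lem (A₀ t) (A₁ t) (A₂ t)) (sym (cong₂ (λ x y → A₀ t - x - y) (E-− μ _ _) M₂′≡))
          where
          lem : ∀ a b c → c ≡ a - (a - b) - (b - c)
          lem = solve-∀ ℚ-ring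
          M₂′≡ : M₂′ t ≡ A₁ t - A₂ t
          M₂′≡ = trans (E-swap 𝒲 μ _) (trans (E-ext μ (λ k → E-− 𝒲 _ _)) (E-− μ _ _))

        u≤1 : ∀ t → ∣ u t ∣ ≤ 1ℚ
        u≤1 (z , r , c) = V≤1 _ c

        uA₀≡0 : E τ (λ t → u t * A₀ t) ≡ 0ℚ
        uA₀≡0 = trans (E-cong τ (λ t@(z , r , c) s → trans (sym (E-* μ (u t) _))
          (trans (E-cong μ (λ k sk → free sk (proj₁ (Supp-sample ζ ℛ s)) (proj₂ (Supp-sample ζ ℛ s)) c)) (E-const μ 0ℚ)))) (E-const τ 0ℚ)

        0≤6δ : 0ℚ ≤ 6ℚ * δ₂
        0≤6δ = 0≤* 0≤6 0≤δ₂

        uA₂≤ : ∣ E τ (λ t → u t * A₂ t) ∣ ≤ (6ℚ + 2ℚ) * δ₂ + 6ℚ * δ₂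
        uA₂≤ = subst (λ x → ∣ x ∣ ≤ (6ℚ + 2ℚ) * δ₂ + 6ℚ * δ₂) (sym eqn)
          (∣∣-−-≤ (- E τ (λ t → u t * M₁ t)) (E τ (λ t → u t * M₂′ t))
            (subst (_≤ (6ℚ + 2ℚ) * δ₂) (sym (∣-p∣≡∣p∣ _)) (cauchy-schwarz τ u M₁ (0≤* (0≤+ 0≤6 0≤2) 0≤δ₂) u≤1 EM₁²))
            (cauchy-schwarz τ u M₂′ 0≤6δ u≤1
              (≤-trans (E-mono τ (λ t _ → jensen 𝒲 (λ w′ → M₂ w′ t))) (≤-trans (≤-reflexive (E-swap τ 𝒲 _)) (E-≤ 𝒲 EM₂²)))))
          where
          lem : ∀ u a m n → u * (a - m - n) ≡ u * a - u * m - u * n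
          lem = solve-∀ ℚ-ring
          lem₂ : ∀ m n → 0ℚ - m - n ≡ - m - n
          lem₂ = solve-∀ ℚ-ring
          eqn : E τ (λ t → u t * A₂ t) ≡ - E τ (λ t → u t * M₁ t) - E τ (λ t → u t * M₂′ t)
          eqn = trans (E-ext τ (λ t → trans (cong (u t *_) (A₂≡ t)) (lem (u t) (A₀ t) (M₁ t) (M₂′ t))))
            (trans (E-− τ _ _) (trans (cong (λ x → x - E τ (λ t → u t * M₂′ t))
                (trans (E-− τ _ _) (cong (λ x → x - E τ (λ t → u t * M₁ t)) uA₀≡0)))
              (lem₂ (E τ (λ t → u t * M₁ t)) (E τ (λ t → u t * M₂′ t)))))

        A₂≤1 : ∀ t → ∣ A₂ t ∣ ≤ 1ℚ
        A₂≤1 (z , r , c) = E-∣∣ μ (λ k _ → E-∣∣ 𝒲 (λ w′ _ → E-∣∣ 𝒲 (λ w _ → V≤1 _ c)))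

        -- `A₀` is orthogonal to `u` because there are no monochromatic edges, so `A₂` is almost
        -- orthogonal to it. Dilating `r` by 1/N z then turns `u` into `V r` and `A₂` into the
        -- smoothing evaluated at β(k) r.
        edge-free-correlation : ∣ E μ (λ k → EΩ ℛ (λ r c → V r c * smoothing ζ V (β k * r) c)) ∣ ≤ 15δ
        edge-free-correlation = begin
          ∣ target ∣                                ≡⟨ cong ∣_∣ (lem target X) ⟩
          ∣ X + (target - X) ∣                      ≤⟨ ∣∣-+-≤ X (target - X) uA₂≤ (≤-trans near h≤δ₂) ⟩
          15δ                                       ∎
          where
          open ≤-Reasoning
          target = E μ (λ k → EΩ ℛ (λ r c → V r c * smoothing ζ V (β k * r) c))
          X = E τ (λ t → u t * A₂ t)
          h≤δ₂ : h ≤ δ₂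
          h≤δ₂ = ≤-trans h≤δ₃ δ₃≤δ₂
          lem : ∀ x y → x ≡ y + (x - y)
          lem = solve-∀ ℚ-ring
          g : ℚ → ℚ → C → ℚ
          g z r c = u (z , r , c) * A₂ (z , r , c)
          g≤1 : ∀ z → Bd 1ℚ (g z)
          g≤1 z r c = ∣∣-*-≤ (u (z , r , c)) (A₂ (z , r , c)) (u≤1 (z , r , c)) (A₂≤1 (z , r , c))
          u-dilated : ∀ z → Supp ζ z → ∀ r → N z * (inv (N z) * r) ≡ r
          u-dilated z sz r = trans (sym (*-assoc (N z) _ r)) (trans (cong (_* r) (*-invʳ (good-N≢0 gζ sz))) (*-identityˡ r))
          dilated : ∀ z → Supp ζ z → EΩ ℛ (λ r → g z (inv (N z) * r)) ≡ E μ
              (λ k → EΩ ℛ (λ r c → V r c * E 𝒲 (λ w′ → E 𝒲 (λ w → form V (inv (N z)) w w′ z (β k * r) c))))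
          dilated z sz = trans (E-ext ℛ (λ r → E-ext 𝒞 (λ c → trans
              (cong₂ (λ a b → V a c * b) (u-dilated z sz r) (E-ext μ (λ k → E-ext 𝒲
                  (λ w′ → E-ext 𝒲 (λ w → cong (λ t → V t c) (conv-factors (β k) ((z + w) * (z + w′)) (inv (N z)) r))))))
              (sym (E-* μ (V r c) _)))))
            (trans (E-ext ℛ (λ r → E-swap 𝒞 μ _)) (E-swap ℛ μ _))
          target≡ : target ≡ E ζ (λ z → EΩ ℛ (λ r → g z (inv (N z) * r)))
          target≡ = sym (trans (E-cong ζ dilated) (trans (E-swap ζ μ _) (E-ext μ (λ k →
            trans (E-swap ζ ℛ _) (E-ext ℛ (λ r → trans (E-swap ζ 𝒞 _) (E-ext 𝒞 (λ c → E-* ζ (V r c) _))))))))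
          near : ∣ target - X ∣ ≤ h
          near = subst₂ (λ a b → ∣ a - b ∣ ≤ h) (sym target≡) (sym (E-sample ζ ℛ (λ t → u t * A₂ t)))
            (E-close ζ (λ z sz → subst (∣ EΩ ℛ (λ r → g z (inv (N z) * r)) - EΩ ℛ (g z) ∣ ≤_) (*-identityˡ h)
              (dilate gℛ (raise (dinv (varᵈ (inj₂ sz) ⊗ varᵈ (inj₂ sz) ⊖ Dᵈ))) (inv≢0 (good-N≢0 gζ sz)) 1ℚ (g z) (g≤1 z))))

    -- The composition law and its affine covariance.

    -- compose k y = (k y + D)/(k + y).
    compose : ℚ → ℚ → ℚ
    compose k y = k - N k * inv (k + y)

    composite : Law ℚ → Law ℚ → Law ℚ
    composite μ ζ = bind μ (λ k → bind ζ (λ y → ret (compose k y)))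

    E-composite : ∀ μ ζ g → E (composite μ ζ) g ≡ E μ (λ k → E ζ (λ y → g (compose k y)))
    E-composite μ ζ g = trans (E-bind μ _ g) (E-ext μ (λ k → E-bind ζ _ g))

    inv-involutive : ∀ {p} → p ≢ 0ℚ → inv (inv p) ≡ p
    inv-involutive n = inv-unique (inv-sym n)

    N-affine≢0 : ∀ {S ε L} → GoodAt ε S L → ∀ {k} → Supp L k → ∀ {α β} → Def S 2 α → Def S 2 β → α ≢ 0ℚ → N (α * k + β) ≢ 0ℚ
    N-affine≢0 g {k} s {α} {β} dα dβ α≢0 e = no-big-root g s {b = B} {c = Γ} (raise (ng (dβ ⊗ dinv dα ⊕ dβ ⊗ dinv dα)))
        (raise ((Dᵈ ⊖ dβ ⊗ dβ) ⊗ (dinv dα ⊗ dinv dα))) (begin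
      k * k                                             ≡⟨ lem₁ (k * k) ⟩
      1ℚ * 1ℚ * (k * k)                                 ≡⟨ cong (λ t → t * t * (k * k)) (sym (*-invʳ α≢0)) ⟩
      α * i * (α * i) * (k * k)                         ≡⟨ lem₂ α i k β D ⟩
      N (α * k + β) * (i * i) + (- (β * i + β * i) * (α * i) * k + (D - β * β) * (i * i)) ≡⟨ cong₂
          (λ s t → s * (i * i) + (- (β * i + β * i) * t * k + (D - β * β) * (i * i))) e (*-invʳ α≢0) ⟩
      0ℚ * (i * i) + (- (β * i + β * i) * 1ℚ * k + (D - β * β) * (i * i)) ≡⟨ lem₃ i (- (β * i + β * i)) k Γ ⟩
      B * k + Γ                                         ∎)
      where
      open ≡-Reasoning
      i = inv α
      B = - (β * i + β * i)
      Γ = (D - β * β) * (i * i)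
      lem₁ : ∀ x → x ≡ 1ℚ * 1ℚ * x
      lem₁ = solve-∀ ℚ-ring
      lem₂ : ∀ α i k β D → α * i * (α * i) * (k * k) ≡ ((α * k + β) * (α * k + β) - D) * (i * i) +
          (- (β * i + β * i) * (α * i) * k + (D - β * β) * (i * i))
      lem₂ = solve-∀ ℚ-ring
      lem₃ : ∀ i b k c → 0ℚ * (i * i) + (b * 1ℚ * k + c) ≡ b * k + c
      lem₃ = solve-∀ ℚ-ring

    -- An affine map φ satisfies φ (compose k y) = compose (φ k) (ψ y) with ψ affine.
    affine-compose : ∀ {α β k y} → α ≢ 0ℚ → N k ≢ 0ℚ → N (α * k + β) ≢ 0ℚ → k + y ≢ 0ℚ →
      α * compose k y + β ≡ compose (α * k + β) (N (α * k + β) * inv (α * N k) * y + (N (α * k + β) * inv (α * N k) * k - (α * k + β)))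
    affine-compose {α} {β} {k} {y} α≢0 n≢0 ñ≢0 s≢0 = sym (begin
      k̃ - N k̃ * inv (k̃ + (A * y + (A * k - k̃)))  ≡⟨ cong (λ t → k̃ - N k̃ * inv t) (lem₁ k̃ A y k) ⟩
      k̃ - N k̃ * inv (A * (k + y))               ≡⟨ cong (λ t → k̃ - N k̃ * t) (inv-* A≢0 s≢0) ⟩
      k̃ - N k̃ * (inv A * inv (k + y))           ≡⟨ cong (λ t → k̃ - N k̃ * (t * inv (k + y))) invA ⟩
      k̃ - N k̃ * (inv (N k̃) * (α * N k) * inv (k + y)) ≡⟨ lem₂ k̃ (N k̃) (inv (N k̃)) (α * N k) (inv (k + y)) ⟩
      k̃ - N k̃ * inv (N k̃) * (α * N k * inv (k + y))   ≡⟨ cong (λ t → k̃ - t * (α * N k * inv (k + y))) (*-invʳ ñ≢0) ⟩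
      k̃ - 1ℚ * (α * N k * inv (k + y))          ≡⟨ lem₃ α k β (N k) (inv (k + y)) ⟩
      α * compose k y + β                       ∎)
      where
      open ≡-Reasoning
      k̃ = α * k + β
      A = N k̃ * inv (α * N k)
      αN≢0 : α * N k ≢ 0ℚ
      αN≢0 = *≢0 α≢0 n≢0
      A≢0 : A ≢ 0ℚ
      A≢0 = *≢0 ñ≢0 (inv≢0 αN≢0)
      invA : inv A ≡ inv (N k̃) * (α * N k)
      invA = trans (inv-* ñ≢0 (inv≢0 αN≢0)) (cong (inv (N k̃) *_) (inv-involutive αN≢0))
      lem₁ : ∀ k̃ A y k → k̃ + (A * y + (A * k - k̃)) ≡ A * (k + y)
      lem₁ = solve-∀ ℚ-ring
      lem₂ : ∀ k̃ n i a j → k̃ - n * (i * a * j) ≡ k̃ - n * i * (a * j)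
      lem₂ = solve-∀ ℚ-ring
      lem₃ : ∀ α k β n j → α * k + β - 1ℚ * (α * n * j) ≡ α * (k - n * j) + β
      lem₃ = solve-∀ ℚ-ring

    ∣inv∣≤ : ∀ {x y} → y ≢ 0ℚ → ∣ x ∣ ≤ ∣ y ∣ → ∣ x * inv y ∣ ≤ 1ℚ
    ∣inv∣≤ {x} {y} y≢0 le = subst (∣ x * inv y ∣ ≤_) one (subst (_≤ ∣ y ∣ * ∣ inv y ∣) (sym (∣p*q∣≡∣p∣*∣q∣ x (inv y)))
        (*-monoʳ (0≤∣p∣ (inv y)) le))
      where
      one : ∣ y ∣ * ∣ inv y ∣ ≡ 1ℚ
      one = trans (sym (∣p*q∣≡∣p∣*∣q∣ y (inv y))) (cong ∣_∣ (*-invʳ y≢0))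

    -- An affine map acts on the composite through the same map on k and, for fixed k, through
    -- another affine map on y, so the two errors add. The base set `Def S 20` lets given
    -- coefficients count as variables of depth 0. For size, ∣N k/(k + y)∣ ≤ 1, so the composite
    -- stays within 1 of k.
    composite-good : ∀ {S ε₁ ε₂ μ ζ} → GoodAt ε₁ (Def S 20) μ → GoodAt ε₂ (Def S 20 ∪ Supp μ) ζ → GoodAt (ε₁ + ε₂) S (composite μ ζ)
    composite-good {S} {ε₁} {ε₂} {μ} {ζ} gμ gζ .invariant {α} {β} dα dβ α≢0 b G bd =
      subst (∣ E (composite μ ζ) (λ z → G (α * z + β)) - E (composite μ ζ) G ∣ ≤_) (lem b ε₁ ε₂)
        (∣-∣-trans (E (composite μ ζ) (λ z → G (α * z + β))) (E μ (λ k → H (α * k + β))) (E (composite μ ζ) G) step₁ step₂)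
      where
      lem : ∀ b x y → b * y + b * x ≡ b * (x + y)
      lem = solve-∀ ℚ-ring
      H : ℚ → ℚ
      H k = E ζ (λ y → G (compose k y))
      step₂ : ∣ E μ (λ k → H (α * k + β)) - E (composite μ ζ) G ∣ ≤ b * ε₁
      step₂ = subst (λ t → ∣ E μ (λ k → H (α * k + β)) - t ∣ ≤ b * ε₁) (sym (E-composite μ ζ G))
        (invariant gμ (var dα) (var dβ) α≢0 b H (λ k → E-∣∣ ζ (λ y _ → bd (compose k y))))
      step₁ : ∣ E (composite μ ζ) (λ z → G (α * z + β)) - E μ (λ k → H (α * k + β)) ∣ ≤ b * ε₂
      step₁ = subst (λ t → ∣ t - E μ (λ k → H (α * k + β)) ∣ ≤ b * ε₂) (sym (E-composite μ ζ (λ z → G (α * z + β))))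
        (E-close μ inner)
        where
        inner : ∀ k → Supp μ k → ∣ E ζ (λ y → G (α * compose k y + β)) - H (α * k + β) ∣ ≤ b * ε₂
        inner k sk = subst (λ t → ∣ t - H (α * k + β) ∣ ≤ b * ε₂)
          (E-cong ζ (λ y sy → cong G (sym (affine-compose α≢0 n≢0 ñ≢0 (k+y≢0 y sy)))))
          (invariant gζ (raise dA) (raise (dA ⊗ kᵈ ⊖ k̃ᵈ)) (*≢0 ñ≢0 (inv≢0 (*≢0 α≢0 n≢0))) b (λ y → G (compose (α * k + β) y)) (λ y → bd _))
          where
          n≢0 = good-N≢0 gμ sk
          ñ≢0 = N-affine≢0 gμ sk {α} {β} (var dα) (var dβ) α≢0
          S′ = Def S 20 ∪ Supp μ
          kᵈ = varᵈ {S′} (inj₂ sk)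
          αᵈ = varᵈ {S′} (inj₁ dα)
          k̃ᵈ = αᵈ ⊗ kᵈ ⊕ varᵈ {S′} (inj₁ dβ)
          dA = (k̃ᵈ ⊗ k̃ᵈ ⊖ Dᵈ) ⊗ dinv (αᵈ ⊗ (kᵈ ⊗ kᵈ ⊖ Dᵈ))
          k+y≢0 : ∀ y → Supp ζ y → k + y ≢ 0ℚ
          k+y≢0 y sy e = big+≢0 gζ sy (var (inj₂ sk)) (trans (+-comm y k) e)
    composite-good {S} {μ = μ} {ζ} gμ gζ .big sz {s} ds with Supp-bind μ _ sz
    ... | k , sk , t with Supp-bind ζ _ t
    ...   | y , sy , refl = +-cancelʳ-< (∣ s ∣) (∣ compose k y ∣) 1ℚ (<-≤-trans s+1<k k≤z+1)
      where
      S′ = Def S 20 ∪ Supp μ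
      kᵈ = varᵈ {S′} (inj₂ sk)
      q = k * k + 1ℚ + (N k * N k + 1ℚ)
      +-cancelʳ-< : ∀ a b c → a + c < b + c → a < b
      +-cancelʳ-< a b c lt = subst₂ _<_ (lem a c) (lem b c) (+-monoˡ-< (- c) lt)
        where
        lem : ∀ a c → a + c - c ≡ a
        lem = solve-∀ ℚ-ring
      s+1<k : ∣ s ∣ + 1ℚ < ∣ k ∣
      s+1<k = ≤-<-trans (≤-trans (+-monoˡ-≤ 1ℚ (∣∣≤sq+1 s)) (x≤∣x∣ (s * s + 1ℚ + 1ℚ))) (big gμ sk (raise (varᵈ ds ⊗ varᵈ ds ⊕ 1ᵈ ⊕ 1ᵈ)))
      q<y : q < ∣ y ∣
      q<y = ≤-<-trans (x≤∣x∣ q) (big gζ sy (raise (kᵈ ⊗ kᵈ ⊕ 1ᵈ ⊕ ((kᵈ ⊗ kᵈ ⊖ Dᵈ) ⊗ (kᵈ ⊗ kᵈ ⊖ Dᵈ) ⊕ 1ᵈ))))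
      N≤ : ∣ N k ∣ ≤ ∣ k + y ∣
      N≤ = +-cancelʳ-≤ (∣ N k ∣) (∣ k + y ∣) (∣ k ∣) (begin
        ∣ N k ∣ + ∣ k ∣          ≡⟨ +-comm ∣ N k ∣ ∣ k ∣ ⟩
        ∣ k ∣ + ∣ N k ∣          ≤⟨ +-mono-≤ (∣∣≤sq+1 k) (∣∣≤sq+1 (N k)) ⟩
        q                        ≤⟨ <⇒≤ q<y ⟩
        ∣ y ∣                    ≡⟨ cong ∣_∣ (lem k y) ⟩
        ∣ k + y - k ∣            ≤⟨ ∣∣-−-≤ (k + y) k ≤-refl ≤-refl ⟩
        ∣ k + y ∣ + ∣ k ∣        ∎)
        where
        open ≤-Reasoning
        lem : ∀ k y → y ≡ k + y - k
        lem = solve-∀ ℚ-ring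
        +-cancelʳ-≤ : ∀ a b c → a + c ≤ b + c → a ≤ b
        +-cancelʳ-≤ a b c le = subst₂ _≤_ (lem₂ a c) (lem₂ b c) (+-monoˡ-≤ (- c) le)
          where
          lem₂ : ∀ a c → a + c - c ≡ a
          lem₂ = solve-∀ ℚ-ring
      k≤z+1 : ∣ k ∣ ≤ ∣ compose k y ∣ + 1ℚ
      k≤z+1 = subst (λ t → ∣ t ∣ ≤ ∣ compose k y ∣ + 1ℚ) (lem k (N k * inv (k + y)))
        (∣∣-+-≤ (compose k y) (N k * inv (k + y)) ≤-refl (∣inv∣≤ {N k} {k + y}
            (λ e → big+≢0 gζ sy (var (inj₂ sk)) (trans (+-comm y k) e)) N≤))
        where
        lem : ∀ k t → k - t + t ≡ k
        lem = solve-∀ ℚ-ring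

    -- Energy, and smoothing by a composite law.

    opaque
      unfolding 𝒲
      E𝒲≡ : ∀ g → E 𝒲 g ≡ E (avg m (λ i → ret (wpt i))) g
      E𝒲≡ g = refl

      Supp-𝒲 : ∀ i → Supp 𝒲 (wpt i)
      Supp-𝒲 i = i , refl

    Sep-points : ∀ n (p : Fin n → ℚ) (X : ℚ → ℚ) → (∀ {i j} → X (p i) ≡ X (p j) → i ≡ j) → Sep X n (λ i → ret (p i))
    Sep-points zero p X inj = tt
    Sep-points (suc n) p X inj = Sep-points n (p ∘ inject₁) X (λ e → FinP.inject₁-injective (inj e)) ,
      λ { _ (i , refl) _ refl e → fromℕ≢inject₁ i (sym (inj e)) }

    sq-+-≤ : ∀ a b → (a + b) * (a + b) ≤ 2ℚ * (a * a) + 2ℚ * (b * b)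
    sq-+-≤ a b = ≤-by (sq≥0 (a - b)) (lem a b)
      where
      lem : ∀ a b → (1ℚ + 1ℚ) * (a * a) + (1ℚ + 1ℚ) * (b * b) ≡ (a + b) * (a + b) + (a - b) * (a - b)
      lem = solve-∀ ℚ-ring

    Ω : Law ℚ → Law (ℚ × C)
    Ω ℛ = bind ℛ (λ r → bind 𝒞 (λ c → ret (r , c)))

    E-Ω : ∀ ℛ (g : ℚ × C → ℚ) → E (Ω ℛ) g ≡ EΩ ℛ (λ r c → g (r , c))
    E-Ω ℛ g = trans (E-bind ℛ _ g) (E-ext ℛ (λ r → E-bind 𝒞 _ g))

    EΩ-mono : ∀ ℛ {g g′ : ℚ → C → ℚ} → (∀ r c → g r c ≤ g′ r c) → EΩ ℛ g ≤ EΩ ℛ g′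
    EΩ-mono ℛ le = E-mono ℛ (λ r _ → E-mono 𝒞 (λ c _ → le r c))

    EΩ-ext : ∀ ℛ {g g′ : ℚ → C → ℚ} → (∀ r c → g r c ≡ g′ r c) → EΩ ℛ g ≡ EΩ ℛ g′
    EΩ-ext ℛ e = E-ext ℛ (λ r → E-ext 𝒞 (e r))

    EΩ-+ : ∀ ℛ (g g′ : ℚ → C → ℚ) → EΩ ℛ (λ r c → g r c + g′ r c) ≡ EΩ ℛ g + EΩ ℛ g′
    EΩ-+ ℛ g g′ = trans (E-ext ℛ (λ r → E-+ 𝒞 (g r) (g′ r))) (E-+ ℛ _ _)

    EΩ-− : ∀ ℛ (g g′ : ℚ → C → ℚ) → EΩ ℛ (λ r c → g r c - g′ r c) ≡ EΩ ℛ g - EΩ ℛ g′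
    EΩ-− ℛ g g′ = trans (E-ext ℛ (λ r → E-− 𝒞 (g r) (g′ r))) (E-− ℛ _ _)

    EΩ-* : ∀ ℛ a (g : ℚ → C → ℚ) → EΩ ℛ (λ r c → a * g r c) ≡ a * EΩ ℛ g
    EΩ-* ℛ a g = trans (E-ext ℛ (λ r → E-* 𝒞 a (g r))) (E-* ℛ a _)

    EΩ-∣∣ : ∀ ℛ {g b} → Bd b g → ∣ EΩ ℛ g ∣ ≤ b
    EΩ-∣∣ ℛ bd = E-∣∣ ℛ (λ r _ → E-∣∣ 𝒞 (λ c _ → bd r c))

    EΩ-swap : ∀ {T : Set} ℛ (L : Law T) (g : T → ℚ → C → ℚ) → EΩ ℛ (λ r c → E L (λ t → g t r c)) ≡ E L (λ t → EΩ ℛ (g t))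
    EΩ-swap ℛ L g = trans (E-ext ℛ (λ r → E-swap 𝒞 L _)) (E-swap ℛ L _)

    EΩ-jensen : ∀ {T : Set} ℛ (L : Law T) (g : T → ℚ → C → ℚ) {b} → (∀ t → Supp L t → EΩ ℛ (λ r c → g t r c * g t r c) ≤ b) →
      EΩ ℛ (λ r c → E L (λ t → g t r c) * E L (λ t → g t r c)) ≤ b
    EΩ-jensen ℛ L g hyp = ≤-trans (EΩ-mono ℛ (λ r c → jensen L (λ t → g t r c)))
      (≤-trans (≤-reflexive (EΩ-swap ℛ L (λ t r c → g t r c * g t r c))) (E-≤ L hyp))

    EΩ-cauchy-schwarz : ∀ ℛ (u y : ℚ → C → ℚ) {b} → 0ℚ ≤ b → Bd 1ℚ u → EΩ ℛ (λ r c → y r c * y r c) ≤ b * b → ∣ EΩ ℛ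
        (λ r c → u r c * y r c) ∣ ≤ b
    EΩ-cauchy-schwarz ℛ u y 0≤b hu hy = subst (λ t → ∣ t ∣ ≤ _) (E-Ω ℛ (λ { (r , c) → u r c * y r c }))
      (cauchy-schwarz (Ω ℛ) (λ { (r , c) → u r c }) (λ { (r , c) → y r c }) 0≤b (λ { (r , c) → hu r c })
        (subst (_≤ _) (sym (E-Ω ℛ (λ { (r , c) → y r c * y r c }))) hy))

    energy : Law ℚ → (ℚ → C → ℚ) → ℚ
    energy ℛ g = EΩ ℛ (λ r c → g r c * g r c)

    scale : ℚ → ℚ → ℚ → ℚ
    scale k w w′ = inv (N k) * ((k + w) * (k + w′))

    -- (z+w)(z+w′)/N z factors as scale k w w′ · (y+s)(y+s′)/N y for z = compose k y, with s the Möbius image of w.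
    möbius : ℚ → ℚ → ℚ
    möbius k w = (w * k + D) * inv (w + k)

    compose-+ : ∀ {k y w} → k + y ≢ 0ℚ → w + k ≢ 0ℚ → compose k y + w ≡ (k + w) * (y + möbius k w) * inv (k + y)
    compose-+ {k} {y} {w} s≢0 t≢0 = *-cancelʳ s≢0 (begin
      (k - N k * i + w) * (k + y)                 ≡⟨ lem₁ k (N k) i w y ⟩
      (k + w) * (k + y) - N k * ((k + y) * i)     ≡⟨ cong (λ t → (k + w) * (k + y) - N k * t) (*-invʳ s≢0) ⟩
      (k + w) * (k + y) - N k * 1ℚ                ≡⟨ lem₂ k y w D ⟩
      (k + w) * y + (w * k + D) * 1ℚ              ≡⟨ cong (λ t → (k + w) * y + (w * k + D) * t) (sym (*-invʳ t≢0)) ⟩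
      (k + w) * y + (w * k + D) * ((w + k) * j)   ≡⟨ lem₃ k w y (w * k + D) j ⟩
      (k + w) * (y + (w * k + D) * j) * 1ℚ        ≡⟨ cong ((k + w) * (y + möbius k w) *_) (sym (*-invʳ s≢0)) ⟩
      (k + w) * (y + möbius k w) * ((k + y) * i)  ≡⟨ lem₄ ((k + w) * (y + möbius k w)) (k + y) i ⟩
      (k + w) * (y + möbius k w) * i * (k + y)    ∎)
      where
      open ≡-Reasoning
      i = inv (k + y)
      j = inv (w + k)
      lem₁ : ∀ k n i w y → (k - n * i + w) * (k + y) ≡ (k + w) * (k + y) - n * ((k + y) * i)
      lem₁ = solve-∀ ℚ-ring
      lem₂ : ∀ k y w D → (k + w) * (k + y) - (k * k - D) * 1ℚ ≡ (k + w) * y + (w * k + D) * 1ℚ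
      lem₂ = solve-∀ ℚ-ring
      lem₃ : ∀ k w y x j → (k + w) * y + x * ((w + k) * j) ≡ (k + w) * (y + x * j) * 1ℚ
      lem₃ = solve-∀ ℚ-ring
      lem₄ : ∀ a b i → a * (b * i) ≡ a * i * b
      lem₄ = solve-∀ ℚ-ring

    -- Multiplicativity of the norm: (k + √D)(y + √D) = (ky + D) + (k + y)√D, and division by k + y
    -- gives `compose k y` + √D.
    N-compose : ∀ {k y} → k + y ≢ 0ℚ → N (compose k y) ≡ N k * N y * (inv (k + y) * inv (k + y))
    N-compose {k} {y} s≢0 = begin
      (k - N k * i) * (k - N k * i) - D                       ≡⟨ lem₁ k (N k) i D ⟩
      N k * 1ℚ * 1ℚ - (k + k) * N k * i * 1ℚ + N k * N k * (i * i) ≡⟨ cong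
          (λ t → N k * t * t - (k + k) * N k * i * t + N k * N k * (i * i)) (sym (*-invʳ s≢0)) ⟩
      N k * ((k + y) * i) * ((k + y) * i) - (k + k) * N k * i * ((k + y) * i) + N k * N k * (i * i) ≡⟨ lem₂ k y i D ⟩
      N k * N y * (i * i)                                     ∎
      where
      open ≡-Reasoning
      i = inv (k + y)
      lem₁ : ∀ k n i D → (k - n * i) * (k - n * i) - D ≡ (k * k - D) * 1ℚ * 1ℚ - (k + k) * n * i * 1ℚ + n * n * (i * i)
      lem₁ = solve-∀ ℚ-ring
      lem₂ : ∀ k y i D → (k * k - D) * ((k + y) * i) * ((k + y) * i) - (k + k) * (k * k - D) * i * ((k + y) * i) + (k * k - D) *
          (k * k - D) * (i * i)
                         ≡ (k * k - D) * (y * y - D) * (i * i)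
      lem₂ = solve-∀ ℚ-ring

    compose-form : ∀ {k y w w′} → k + y ≢ 0ℚ → w + k ≢ 0ℚ → w′ + k ≢ 0ℚ → N k ≢ 0ℚ → N y ≢ 0ℚ → ∀ r →
      inv (N (compose k y)) * ((compose k y + w) * (compose k y + w′)) * r ≡ inv (N y) * ((y + möbius k w) * (y + möbius k w′)) *
          (scale k w w′ * r)
    compose-form {k} {y} {w} {w′} s≢0 t≢0 t′≢0 nk≢0 ny≢0 r = begin
      inv (N z) * ((z + w) * (z + w′)) * r
        ≡⟨ cong₂ (λ a b → a * b * r) invN (cong₂ _*_ (compose-+ {k} {y} {w} s≢0 t≢0) (compose-+ {k} {y} {w′} s≢0 t′≢0)) ⟩
      inv (N k) * inv (N y) * ((k + y) * (k + y)) * ((k + w) * (y + s) * i * ((k + w′) * (y + s′) * i)) * r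
        ≡⟨ lem (inv (N k)) (inv (N y)) (k + y) (k + w) (y + s) i (k + w′) (y + s′) r ⟩
      (k + y) * i * ((k + y) * i) * (inv (N y) * ((y + s) * (y + s′)) * (inv (N k) * ((k + w) * (k + w′)) * r))
        ≡⟨ cong (λ t → t * t * (inv (N y) * ((y + s) * (y + s′)) * (scale k w w′ * r))) (*-invʳ s≢0) ⟩
      1ℚ * 1ℚ * (inv (N y) * ((y + s) * (y + s′)) * (scale k w w′ * r))
        ≡⟨ lem₂ (inv (N y) * ((y + s) * (y + s′)) * (scale k w w′ * r)) ⟩
      inv (N y) * ((y + s) * (y + s′)) * (scale k w w′ * r) ∎
      where
      open ≡-Reasoning
      z = compose k y
      i = inv (k + y)
      s = möbius k w
      s′ = möbius k w′
      i≢0 = inv≢0 s≢0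
      lem : ∀ a b t p q i p′ q′ r → a * b * (t * t) * (p * q * i * (p′ * q′ * i)) * r ≡ t * i * (t * i) *
          (b * (q * q′) * (a * (p * p′) * r))
      lem = solve-∀ ℚ-ring
      lem₂ : ∀ x → 1ℚ * 1ℚ * x ≡ x
      lem₂ = solve-∀ ℚ-ring
      invN : inv (N z) ≡ inv (N k) * inv (N y) * ((k + y) * (k + y))
      invN = begin
        inv (N z)                                             ≡⟨ cong inv (N-compose {k} {y} s≢0) ⟩
        inv (N k * N y * (i * i))                             ≡⟨ inv-* (*≢0 nk≢0 ny≢0) (*≢0 i≢0 i≢0) ⟩
        inv (N k * N y) * inv (i * i)                         ≡⟨ cong₂ _*_ (inv-* nk≢0 ny≢0)
            (trans (inv-* i≢0 i≢0) (cong (λ t → t * t) (inv-involutive s≢0))) ⟩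
        inv (N k) * inv (N y) * ((k + y) * (k + y))           ∎

    -- The Möbius map w ↦ (wk + D)/(w + k) has determinant k² - D = N k.
    möbius-injective : ∀ {k} → N k ≢ 0ℚ → ∀ {v w} → v + k ≢ 0ℚ → w + k ≢ 0ℚ → möbius k v ≡ möbius k w → v ≡ w
    möbius-injective {k} n≢0 {v} {w} v≢ w≢ e = *-cancelʳ n≢0 (x-y≡0⇒x≡y
        (trans (lem v w k D) (trans (cong (_- (w * k + D) * (v + k)) crossed) (+-inverseʳ ((w * k + D) * (v + k))))))
      where
      lem : ∀ v w k D → v * (k * k - D) - w * (k * k - D) ≡ (v * k + D) * (w + k) - (w * k + D) * (v + k)
      lem = solve-∀ ℚ-ring
      cleared : ∀ v → v + k ≢ 0ℚ → möbius k v * (v + k) ≡ v * k + D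
      cleared v v≢ = trans (*-assoc (v * k + D) (inv (v + k)) (v + k))
          (trans (cong ((v * k + D) *_) (inv-sym v≢)) (*-identityʳ (v * k + D)))
      swap : ∀ a b c → a * b * c ≡ a * c * b
      swap = solve-∀ ℚ-ring
      crossed : (v * k + D) * (w + k) ≡ (w * k + D) * (v + k)
      crossed = begin
        (v * k + D) * (w + k)             ≡⟨ cong (_* (w + k)) (sym (cleared v v≢)) ⟩
        möbius k v * (v + k) * (w + k)    ≡⟨ cong (λ t → t * (v + k) * (w + k)) e ⟩
        möbius k w * (v + k) * (w + k)    ≡⟨ swap (möbius k w) (v + k) (w + k) ⟩
        möbius k w * (w + k) * (v + k)    ≡⟨ cong (_* (v + k)) (cleared w w≢) ⟩
        (w * k + D) * (v + k)             ∎
        where open ≡-Reasoning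

    -- Under the composite law, the roots in y are the Möbius images of w and w′. They differ for
    -- different shifts, so they can be exchanged, one after the other, for independent shifts. The
    -- factor `scale k w w′` keeps the original shifts, and the result is the product of the two
    -- smoothing operators.
    module CompositeLaw {S ε μ ζ ℛ} (gμ : GoodAt ε S μ) (gζ : Good (S ∪ Supp μ) ζ) (gℛ : Good (S ∪ Supp μ ∪ Supp ζ) ℛ)
      (V : ℚ → C → ℚ) (V≤1 : Bd 1ℚ V) where

      replaced : ℚ → (ℚ → ℚ) → ℚ → ℚ → ℚ → C → ℚ
      replaced k cf t y r c = E 𝒲 (λ w → V (inv (N y) * ((y + möbius k w) * (y + t)) * (cf w * r)) c
                                       - E 𝒲 (λ ω → V (inv (N y) * ((y + ω) * (y + t)) * (cf w * r)) c))

      replaced≤2 : ∀ k cf t y → Bd 2ℚ (replaced k cf t y)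
      replaced≤2 k cf t y r c = E-∣∣ 𝒲 (λ w _ → ∣∣-−-≤ (V (inv (N y) * ((y + möbius k w) * (y + t)) * (cf w * r)) c)
          (E 𝒲 (λ ω → V (inv (N y) * ((y + ω) * (y + t)) * (cf w * r)) c)) (V≤1 _ c) (E-∣∣ 𝒲 (λ _ _ → V≤1 _ c)))

      w+k≢0 : ∀ {k w} → Supp μ k → Supp 𝒲 w → w + k ≢ 0ℚ
      w+k≢0 {k} {w} sk sw e = big+≢0 gμ sk (def-w sw) (trans (+-comm k w) e)

      k+y≢0 : ∀ {k y} → Supp μ k → Supp ζ y → k + y ≢ 0ℚ
      k+y≢0 {k} {y} sk sy e = big+≢0 gζ sy (var (inj₂ sk)) (trans (+-comm y k) e)

      def-möbius : ∀ {k w} → Supp μ k → Supp 𝒲 w → Def (S ∪ Supp μ) 3 (möbius k w)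
      def-möbius sk sw = (wᵈ ⊗ kᵈ ⊕ Dᵈ) ⊗ dinv (wᵈ ⊕ kᵈ)
        where
        wᵈ = def-w {S ∪ Supp μ} {n = 0} sw
        kᵈ = varᵈ {S ∪ Supp μ} (inj₂ sk)

      replace-möbius : ∀ {k} → Supp μ k → ∀ cf {t} → Def (S ∪ Supp μ) 3 t →
        E ζ (λ y → energy ℛ (replaced k cf t y)) ≤ 6ℚ * δ₂ * (6ℚ * δ₂)
      replace-möbius {k} sk cf {t} dt = begin
        E ζ (λ y → EΩ ℛ (MM y))              ≤⟨ close-≤ (E ζ (λ y → EΩ ℛ (MM y))) (E ζ (λ y → EΩ ℛ (λ r → MM y (a y * r))))
                                                  (E-close ζ (λ y sy → subst (_≤ err) (∣-∣-comm (EΩ ℛ (λ r → MM y (a y * r))) (EΩ ℛ (MM y)))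
                                                    (dilate gℛ (raise (da sy)) (*≢0 (good-N≢0 gζ sy) (inv≢0 (y+t≢0 sy))) (2ℚ * 2ℚ)
                                                        (MM y) (λ r c → ∣∣-*-≤ (replaced k cf t y r c) (replaced k cf t y r c)
                                                            (replaced≤2 k cf t y r c) (replaced≤2 k cf t y r c))))) ⟩
        E ζ (λ y → EΩ ℛ (λ r → MM y (a y * r))) + err ≡⟨ cong (_+ err)
            (trans (E-cong ζ (λ y sy → EΩ-ext ℛ (λ r c → cong₂ _*_ (same sy r c) (same sy r c))))
                (sym (E-sample ζ ℛ (λ p → E pts (λ w → term w p) * E pts (λ w → term w p))))) ⟩
        E (sample ζ ℛ) (λ p → E pts (λ w → term w p) * E pts (λ w → term w p)) + err
          -- The block consists of the point masses at the shifts; distinctness of the roots is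
          -- injectivity of the Möbius map.
          ≤⟨ +-monoˡ-≤ err (bound-avg (λ i → ret (wpt i)) (λ { _ (i , refl) → raise (def-möbius sk (Supp-𝒲 i)) , def-w , id })
               (Sep-points (suc m) wpt (möbius k) (λ {i} {j} e → wpt-injective
                   (möbius-injective (good-N≢0 gμ sk) (w+k≢0 sk (Supp-𝒲 i)) (w+k≢0 sk (Supp-𝒲 j)) e)))) ⟩
        4ℚ * h + (14h + 14h) + err           ≤⟨ replacement-error ⟩
        6ℚ * δ₂ * (6ℚ * δ₂)                  ∎
        where
        open ≤-Reasoning
        open Core gζ (Good-mono inj₁ gℛ) V V≤1 cf (möbius k) (λ _ ω → ω)
        err = 2ℚ * 2ℚ * h
        pts = avg m (λ i → ret (wpt i))
        a : ℚ → ℚ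
        a y = N y * inv (y + t)
        MM : ℚ → ℚ → C → ℚ
        MM y r c = replaced k cf t y r c * replaced k cf t y r c
        y+t≢0 : ∀ {y} → Supp ζ y → y + t ≢ 0ℚ
        y+t≢0 sy = big+≢0 gζ sy (raise dt)
        da : ∀ {y} → Supp ζ y → Def (S ∪ Supp μ ∪ Supp ζ) 6 (a y)
        da sy = raise ((yᵈ ⊗ yᵈ ⊖ Dᵈ) ⊗ dinv (yᵈ ⊕ Def-mono inj₁ dt))
          where
          yᵈ = varᵈ {S ∪ Supp μ ∪ Supp ζ} (inj₂ sy)
        arg : ∀ {y} → Supp ζ y → ∀ x q r → inv (N y) * ((y + x) * (y + t)) * (q * (a y * r)) ≡ q * (y + x) * r
        arg {y} sy x q r = trans (lem (inv (N y)) (y + x) (y + t) q (N y) (inv (y + t)) r)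
          (trans (cong₂ (λ s u → s * u * (q * (y + x) * r)) (*-invʳ (good-N≢0 gζ sy)) (*-invʳ (y+t≢0 sy))) (lem₂ (q * (y + x) * r)))
          where
          lem : ∀ i x t q n j r → i * (x * t) * (q * (n * j * r)) ≡ n * i * (t * j) * (q * x * r)
          lem = solve-∀ ℚ-ring
          lem₂ : ∀ x → 1ℚ * 1ℚ * x ≡ x
          lem₂ = solve-∀ ℚ-ring
        same : ∀ {y} → Supp ζ y → ∀ r c → replaced k cf t y (a y * r) c ≡ E pts (λ w → term w (y , r , c))
        same {y} sy r c = trans (E𝒲≡ _) (E-ext pts (λ w → cong₂ _-_ (cong (λ u → V u c) (arg sy (möbius k w) (cf w) r))
            (E-ext 𝒲 (λ ω → cong (λ u → V u c) (arg sy ω (cf w) r)))))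

      iterated : ℚ → C → ℚ
      iterated = smoothing μ (smoothing ζ V)

      error : ℚ → C → ℚ
      error r c = smoothing (composite μ ζ) V r c - iterated r c

      error₁ error₂ : ℚ → C → ℚ
      error₁ r c = E μ (λ k → E ζ (λ y → E 𝒲 (λ w′ → replaced k (λ w → scale k w w′) (möbius k w′) y r c)))
      error₂ r c = E μ (λ k → E ζ (λ y → E 𝒲 (λ w → E 𝒲 (λ ω → replaced k (λ w′ → scale k w w′) ω y r c))))

      error≡ : ∀ r c → error r c ≡ error₁ r c + error₂ r c
      error≡ r c = begin
        smoothing (composite μ ζ) V r c - iterated r c
          ≡⟨ cong₂ _-_ start finish ⟩
        EE A₀ - EE A₂
          ≡⟨ lem (EE A₀) (EE A₁) (EE A₂) ⟩
        (EE A₀ - EE A₁) + (EE A₁ - EE A₂)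
          ≡⟨ sym (cong₂ _+_ e₁ e₂) ⟩
        error₁ r c + error₂ r c ∎
        where
        open ≡-Reasoning
        lem : ∀ a b c → a - c ≡ (a - b) + (b - c)
        lem = solve-∀ ℚ-ring
        EE : (ℚ → ℚ → ℚ → ℚ → ℚ) → ℚ
        EE g = E μ (λ k → E ζ (λ y → E 𝒲 (λ w′ → E 𝒲 (λ w → g k y w′ w))))
        F : ℚ → ℚ → ℚ → ℚ → ℚ → ℚ → ℚ
        F k y w′ w s s′ = V (inv (N y) * ((y + s) * (y + s′)) * (scale k w w′ * r)) c
        A₀ A₁ A₂ : ℚ → ℚ → ℚ → ℚ → ℚ
        A₀ k y w′ w = F k y w′ w (möbius k w) (möbius k w′)
        A₁ k y w′ w = E 𝒲 (λ ω → F k y w′ w ω (möbius k w′))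
        A₂ k y w′ w = E 𝒲 (λ ω → E 𝒲 (λ ω′ → F k y w′ w ω ω′))
        EE-− : ∀ g g′ → EE (λ k y w′ w → g k y w′ w - g′ k y w′ w) ≡ EE g - EE g′
        EE-− g g′ = trans (E-ext μ (λ k → trans (E-ext ζ (λ y → trans (E-ext 𝒲 (λ w′ → E-− 𝒲 _ _)) (E-− 𝒲 _ _))) (E-− ζ _ _))) (E-− μ _ _)
        start : smoothing (composite μ ζ) V r c ≡ EE A₀
        start = trans (E-composite μ ζ _) (E-cong μ (λ k sk → E-cong ζ (λ y sy → E-cong 𝒲 (λ w′ sw′ → E-cong 𝒲 (λ w sw →
          cong (λ t → V t c) (compose-form {k} {y} {w} {w′} (k+y≢0 sk sy) (w+k≢0 sk sw) (w+k≢0 sk sw′) (good-N≢0 gμ sk)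
              (good-N≢0 gζ sy) r))))))
        finish : iterated r c ≡ EE A₂
        finish = E-ext μ (λ k → trans (E-ext 𝒲 (λ w′ → E-swap 𝒲 ζ _)) (trans (E-swap 𝒲 ζ _)
          (E-ext ζ (λ y → E-ext 𝒲 (λ w′ → E-ext 𝒲 (λ w → E-swap 𝒲 𝒲 _))))))
        e₁ : error₁ r c ≡ EE A₀ - EE A₁
        e₁ = EE-− A₀ A₁
        e₂ : error₂ r c ≡ EE A₁ - EE A₂
        e₂ = trans (E-ext μ (λ k → E-ext ζ (λ y → trans (E-ext 𝒲 (λ w → trans (E-swap 𝒲 𝒲 _) (E-ext 𝒲 (λ w′ →
            trans (E-− 𝒲 _ _) (cong₂ _-_ (E-ext 𝒲 (λ ω → flip y (möbius k w′) ω (scale k w w′)))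
              (E-ext 𝒲 (λ ω → E-ext 𝒲 (λ ω′ → flip y ω′ ω (scale k w w′)))))))))
            (E-swap 𝒲 𝒲 _)))) (EE-− A₁ A₂)
          where
          flip : ∀ y s s′ q → V (inv (N y) * ((y + s) * (y + s′)) * (q * r)) c ≡ V (inv (N y) * ((y + s′) * (y + s)) * (q * r)) c
          flip y s s′ q = cong (λ t → V (inv (N y) * t * (q * r)) c) (*-comm (y + s) (y + s′))

      12δ : ℚ
      12δ = 6ℚ * δ₂ + 6ℚ * δ₂

      energy-error : energy ℛ error ≤ 12δ * 12δ
      energy-error = begin
        energy ℛ error                                  ≡⟨ EΩ-ext ℛ (λ r c → cong₂ _*_ (error≡ r c) (error≡ r c)) ⟩
        EΩ ℛ (λ r c → (error₁ r c + error₂ r c) * (error₁ r c + error₂ r c)) ≤⟨ EΩ-mono ℛ (λ r c → sq-+-≤ (error₁ r c) (error₂ r c)) ⟩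
        EΩ ℛ (λ r c → 2ℚ * (error₁ r c * error₁ r c) + 2ℚ * (error₂ r c * error₂ r c)) ≡⟨ trans (EΩ-+ ℛ _ _)
            (cong₂ _+_ (EΩ-* ℛ 2ℚ _) (EΩ-* ℛ 2ℚ _)) ⟩
        2ℚ * energy ℛ error₁ + 2ℚ * energy ℛ error₂     ≤⟨ +-mono-≤ (*-monoˡ 0≤2 b₁) (*-monoˡ 0≤2 b₂) ⟩
        2ℚ * (6ℚ * δ₂ * (6ℚ * δ₂)) + 2ℚ * (6ℚ * δ₂ * (6ℚ * δ₂)) ≡⟨ lem (6ℚ * δ₂) ⟩
        12δ * 12δ                                       ∎
        where
        open ≤-Reasoning
        lem : ∀ x → (1ℚ + 1ℚ) * (x * x) + (1ℚ + 1ℚ) * (x * x) ≡ (x + x) * (x + x)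
        lem = solve-∀ ℚ-ring
        B = 6ℚ * δ₂ * (6ℚ * δ₂)
        swap-ζ : ∀ (g : ℚ → ℚ → C → ℚ) → E ζ (λ y → energy ℛ (g y)) ≤ B → EΩ ℛ (λ r c → E ζ (λ y → g y r c) * E ζ (λ y → g y r c)) ≤ B
        swap-ζ g le = ≤-trans (EΩ-mono ℛ (λ r c → jensen ζ (λ y → g y r c)))
            (≤-trans (≤-reflexive (EΩ-swap ℛ ζ (λ y r c → g y r c * g y r c))) le)
        b₁ : energy ℛ error₁ ≤ B
        b₁ = EΩ-jensen ℛ μ (λ k r c → E ζ (λ y → E 𝒲 (λ w′ → replaced k (λ w → scale k w w′) (möbius k w′) y r c))) (λ k sk →
          swap-ζ (λ y r c → E 𝒲 (λ w′ → replaced k (λ w → scale k w w′) (möbius k w′) y r c))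
            (≤-trans (E-mono ζ (λ y _ → ≤-trans (EΩ-mono ℛ (λ r c → jensen 𝒲 _)) (≤-reflexive (EΩ-swap ℛ 𝒲 _))))
              (≤-trans (≤-reflexive (E-swap ζ 𝒲 _)) (E-≤ 𝒲 (λ w′ sw′ → replace-möbius sk (λ w → scale k w w′) (def-möbius sk sw′))))))
        b₂ : energy ℛ error₂ ≤ B
        b₂ = EΩ-jensen ℛ μ (λ k r c → E ζ (λ y → E 𝒲 (λ w → E 𝒲 (λ ω → replaced k (λ w′ → scale k w w′) ω y r c)))) (λ k sk →
          swap-ζ (λ y r c → E 𝒲 (λ w → E 𝒲 (λ ω → replaced k (λ w′ → scale k w w′) ω y r c)))
            (≤-trans (E-mono ζ (λ y _ → ≤-trans (EΩ-mono ℛ (λ r c → ≤-trans (jensen 𝒲 _) (E-mono 𝒲 (λ w _ → jensen 𝒲 _))))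
                 (≤-reflexive (trans (EΩ-swap ℛ 𝒲 _) (E-ext 𝒲 (λ w → EΩ-swap ℛ 𝒲 _))))))
              (≤-trans (≤-reflexive (trans (E-swap ζ 𝒲 _) (E-ext 𝒲 (λ w → E-swap ζ 𝒲 _))))
                (E-≤ 𝒲 (λ w _ → E-≤ 𝒲 (λ ω sω → replace-möbius sk (λ w′ → scale k w w′) (def-w sω)))))))

      -- The smoothed functions are bounded by 1, so a² - b² = a(a - b) + b(a - b) needs only two
      -- applications of Cauchy-Schwarz against `error`.
      energy-composite : energy ℛ (smoothing (composite μ ζ) V) ≤ energy ℛ iterated + (12δ + 12δ)
      energy-composite = ≤-trans (≤-reflexive split) (+-monoʳ-≤ (energy ℛ iterated)
          (+-mono-≤ (side full (smoothing-bd (composite μ ζ) V V≤1)) (side iterated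
              (smoothing-bd μ (smoothing ζ V) (smoothing-bd ζ V V≤1)))))
        where
        full = smoothing (composite μ ζ) V
        0≤12δ : 0ℚ ≤ 12δ
        0≤12δ = 0≤+ (0≤* 0≤6 0≤δ₂) (0≤* 0≤6 0≤δ₂)
        side : ∀ u → Bd 1ℚ u → EΩ ℛ (λ r c → u r c * error r c) ≤ 12δ
        side u u≤1 = ∣∣≤⇒≤ (EΩ-cauchy-schwarz ℛ u error 0≤12δ u≤1 energy-error)
        lem : ∀ a b → a * a ≡ b * b + (a * (a - b) + b * (a - b))
        lem = solve-∀ ℚ-ring
        split : energy ℛ full ≡ energy ℛ iterated + (EΩ ℛ (λ r c → full r c * error r c) + EΩ ℛ (λ r c → iterated r c * error r c))
        split = trans (EΩ-ext ℛ (λ r c → lem (full r c) (iterated r c))) (trans (EΩ-+ ℛ _ _) (cong (energy ℛ iterated +_) (EΩ-+ ℛ _ _)))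

    -- Consequences of a small energy drop.

    cauchy-schwarz₂ : ∀ {T : Set} (L : Law T) ℛ (u y : T → ℚ → C → ℚ) {b} → 0ℚ ≤ b → (∀ t → Bd 1ℚ (u t)) →
      E L (λ t → EΩ ℛ (λ r c → y t r c * y t r c)) ≤ b * b → ∣ E L (λ t → EΩ ℛ (λ r c → u t r c * y t r c)) ∣ ≤ b
    cauchy-schwarz₂ {T} L ℛ u y 0≤b hu hy = subst (λ s → ∣ s ∣ ≤ _) (E-J (λ t r c → u t r c * y t r c))
      (cauchy-schwarz J (λ { (t , r , c) → u t r c }) (λ { (t , r , c) → y t r c }) 0≤b (λ { (t , r , c) → hu t r c })
        (subst (_≤ _) (sym (E-J (λ t r c → y t r c * y t r c))) hy))
      where
      J : Law (T × ℚ × C)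
      J = bind L (λ t → bind ℛ (λ r → bind 𝒞 (λ c → ret (t , r , c))))
      E-J : ∀ (g : T → ℚ → C → ℚ) → E J (λ { (t , r , c) → g t r c }) ≡ E L (λ t → EΩ ℛ (g t))
      E-J g = trans (E-bind L _ _) (E-ext L (λ t → trans (E-bind ℛ _ _) (E-ext ℛ (λ r → E-bind 𝒞 _ _))))

    sq : ℚ → ℚ
    sq x = x * x

    sq≤4 : ∀ x y → ∣ x ∣ ≤ 1ℚ → ∣ y ∣ ≤ 1ℚ → ∣ sq (x - y) ∣ ≤ 2ℚ * 2ℚ
    sq≤4 x y hx hy = ∣∣-*-≤ (x - y) (x - y) b b
      where b = ∣∣-−-≤ x y hx hy

    sq-triangle : ∀ a b c → sq (a - b) ≤ 2ℚ * sq (a - c) + 2ℚ * sq (b - c)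
    sq-triangle a b c = subst₂ _≤_ (cong sq (lem a b c)) (cong (λ t → 2ℚ * sq (a - c) + 2ℚ * t) (lem₂ b c)) (sq-+-≤ (a - c) (c - b))
      where
      lem : ∀ a b c → a - c + (c - b) ≡ a - b
      lem = solve-∀ ℚ-ring
      lem₂ : ∀ b c → (c - b) * (c - b) ≡ (b - c) * (b - c)
      lem₂ = solve-∀ ℚ-ring

    shifts : Law ℚ → Law (ℚ × ℚ × ℚ)
    shifts μ = bind μ (λ k → bind 𝒲 (λ w′ → bind 𝒲 (λ w → ret (k , w′ , w))))

    E-shifts : ∀ μ (g : ℚ → ℚ → ℚ → ℚ) → E (shifts μ) (λ { (k , w′ , w) → g k w′ w }) ≡ E μ (λ k → E 𝒲 (λ w′ → E 𝒲 (λ w → g k w′ w)))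
    E-shifts μ g = trans (E-bind μ _ _) (E-ext μ (λ k → trans (E-bind 𝒲 _ _) (E-ext 𝒲 (λ w′ → E-bind 𝒲 _ _))))

    Supp-shifts : ∀ μ {k w′ w} → Supp (shifts μ) (k , w′ , w) → Supp μ k × Supp 𝒲 w′ × Supp 𝒲 w
    Supp-shifts μ s with Supp-bind μ _ s
    ... | k , sk , t with Supp-bind 𝒲 _ t
    ...   | w′ , sw′ , t′ with Supp-bind 𝒲 _ t′
    ...     | w , sw , refl = sk , sw′ , sw

    -- `48δ` is twice the error made by passing from the iterated smoothing to the composite one, so
    -- a larger drop leaves a net gain of half of it. `53δ` adds the dilation errors h and 4h.
    48δ 53δ : ℚ
    48δ = (6ℚ + 6ℚ) * 4ℚ * δ₂
    53δ = 48δ + (4ℚ + 1ℚ) * h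

    0≤6+2 : 0ℚ ≤ 6ℚ + 2ℚ
    0≤6+2 = 0≤+ 0≤6 0≤2

    h≤δ₂ : h ≤ δ₂
    h≤δ₂ = ≤-trans h≤δ₃ δ₃≤δ₂

    53δ≤ : 53δ ≤ (6ℚ + 2ℚ) * δ₁ * ((6ℚ + 2ℚ) * δ₁)
    53δ≤ = begin
      48δ + (4ℚ + 1ℚ) * h                    ≤⟨ +-monoʳ-≤ 48δ (*-monoˡ (0≤+ 0≤4 0≤1) h≤δ₂) ⟩
      48δ + (4ℚ + 1ℚ) * δ₂                   ≤⟨ ≤-by (0≤* (0≤+ 0≤6 (0≤+ 0≤4 0≤1)) 0≤δ₂) (lem δ₂) ⟩
      (6ℚ + 2ℚ) * (6ℚ + 2ℚ) * δ₂             ≡⟨ cong ((6ℚ + 2ℚ) * (6ℚ + 2ℚ) *_) δ₂-def ⟩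
      (6ℚ + 2ℚ) * (6ℚ + 2ℚ) * (δ₁ * δ₁)      ≡⟨ lem₂ (6ℚ + 2ℚ) δ₁ ⟩
      (6ℚ + 2ℚ) * δ₁ * ((6ℚ + 2ℚ) * δ₁)      ∎
      where
      open ≤-Reasoning
      lem : ∀ s → let two = 1ℚ + 1ℚ; four = two + two; six = four + two; eight = four + four; twelve = six + six in eight * eight * s
        ≡ twelve * four * s + (four + 1ℚ) * s
          + (six + (four + 1ℚ)) * s
      lem = solve-∀ ℚ-ring
      lem₂ : ∀ a s → a * a * (s * s) ≡ a * s * (a * s)
      lem₂ = solve-∀ ℚ-ring

    16ℚ : ℚ
    16ℚ = 4ℚ * 4ℚ

    0≤16 : 0ℚ ≤ 16ℚ
    0≤16 = 0≤* 0≤4 0≤4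

    -- The left side amounts to 192 δ₂ + 44 h; with h ≤ δ₂ this is at most 236 δ₂, below 16² δ₂.
    236δ≤ : (4ℚ * 53δ + (6ℚ + 4ℚ) * h + 6ℚ * h) + 4ℚ * h + 4ℚ * h ≤ 16ℚ * δ₁ * (16ℚ * δ₁)
    236δ≤ = begin
      (4ℚ * 53δ + (6ℚ + 4ℚ) * h + 6ℚ * h) + 4ℚ * h + 4ℚ * h  ≡⟨ lem δ₂ h ⟩
      (6ℚ + 6ℚ) * 16ℚ * δ₂ + (16ℚ + 16ℚ + 6ℚ + 6ℚ) * h       ≤⟨ +-monoʳ-≤ ((6ℚ + 6ℚ) * 16ℚ * δ₂)
          (*-monoˡ (0≤+ (0≤+ (0≤+ 0≤16 0≤16) 0≤6) 0≤6) h≤δ₂) ⟩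
      (6ℚ + 6ℚ) * 16ℚ * δ₂ + (16ℚ + 16ℚ + 6ℚ + 6ℚ) * δ₂      ≤⟨ ≤-by (0≤* (0≤+ 0≤16 0≤4) 0≤δ₂) (lem₁ δ₂) ⟩
      16ℚ * 16ℚ * δ₂                                          ≡⟨ cong (16ℚ * 16ℚ *_) δ₂-def ⟩
      16ℚ * 16ℚ * (δ₁ * δ₁)                                   ≡⟨ lem₂ 16ℚ δ₁ ⟩
      16ℚ * δ₁ * (16ℚ * δ₁)                                   ∎
      where
      open ≤-Reasoning
      lem : ∀ s h → let two = 1ℚ + 1ℚ; four = two + two; six = four + two; twelve = six + six in
          (four * (twelve * four * s + (four + 1ℚ) * h)
           + (six + four) * h + six * h) + four * h + four * h
         ≡ twelve * (four * four) * s
           + (four * four + four * four + six + six) * h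
      lem = solve-∀ ℚ-ring
      lem₁ : ∀ s → let two = 1ℚ + 1ℚ; four = two + two; six = four + two; twelve = six + six in four * four * (four * four) * s
         ≡ twelve * (four * four) * s
           + (four * four + four * four + six + six) * s
           + (four * four + four) * s
      lem₁ = solve-∀ ℚ-ring
      lem₂ : ∀ a s → a * a * (s * s) ≡ a * s * (a * s)
      lem₂ = solve-∀ ℚ-ring

    -- The summands belong to the edge-free correlation, the replacement of `v` by `V`, the two
    -- changes of k + w into k, and the dilations of k and r by ρ.
    57δ : ℚ
    57δ = 15δ + (6ℚ + 2ℚ) * δ₁ + 16ℚ * δ₁ + 16ℚ * δ₁ + (h + h)

    module NoEnergyDrop {S ε μ ζ ℛ} (ε≤h : ε ≤ h) (gμ : GoodAt ε S μ) (gζ : Good (S ∪ Supp μ) ζ) (gℛ : Good (S ∪ Supp μ ∪ Supp ζ) ℛ)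
      (f : ℚ → C → ℚ) (f≤1 : Bd 1ℚ f) where

      gμ′ : Good S μ
      gμ′ = Good-≤ ε≤h gμ

      v V : ℚ → C → ℚ
      v = smoothing ζ f
      V = smoothing μ v

      v≤1 : Bd 1ℚ v
      v≤1 = smoothing-bd ζ f f≤1

      V≤1 : Bd 1ℚ V
      V≤1 = smoothing-bd μ v v≤1

      S″ : ℚ → Set
      S″ = S ∪ Supp μ ∪ Supp ζ

      kᵈ : ∀ {k} → Supp μ k → Def S″ 0 k
      kᵈ sk = varᵈ (inj₁ (inj₂ sk))

      wᵈ : ∀ {w} → Supp 𝒲 w → Def S″ 0 w
      wᵈ = def-w

      k≢0 : ∀ {k} → Supp μ k → k ≢ 0ℚ
      k≢0 sk = big≢0 gμ sk

      k+w≢0 : ∀ {k w} → Supp μ k → Supp 𝒲 w → k + w ≢ 0ℚ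
      k+w≢0 sk sw = big+≢0 gμ sk (def-w sw)

      N≢0 : ∀ {k} → Supp μ k → N k ≢ 0ℚ
      N≢0 = good-N≢0 gμ

      u : ℚ × ℚ × ℚ → ℚ
      u (k , w′ , w) = scale k w w′

      u-def : ∀ {t} → Supp (shifts μ) t → Def S″ 5 (u t)
      u-def s with Supp-shifts μ s
      ... | sk , sw′ , sw = raise (dinv (kᵈ sk ⊗ kᵈ sk ⊖ Dᵈ) ⊗ ((kᵈ sk ⊕ wᵈ sw) ⊗ (kᵈ sk ⊕ wᵈ sw′)))

      u≢0 : ∀ {t} → Supp (shifts μ) t → u t ≢ 0ℚ
      u≢0 s with Supp-shifts μ s
      ... | sk , sw′ , sw = *≢0 (inv≢0 (N≢0 sk)) (*≢0 (k+w≢0 sk sw) (k+w≢0 sk sw′))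

      V≡ : ∀ r c → V r c ≡ E (shifts μ) (λ t → v (u t * r) c)
      V≡ r c = sym (E-shifts μ (λ k w′ w → v (scale k w w′ * r) c))

      dilate≤ : ∀ {a} → Def S″ 20 a → a ≢ 0ℚ → ∀ g → Bd (2ℚ * 2ℚ) g → EΩ ℛ g ≤ EΩ ℛ (λ r → g (a * r)) + 4ℚ * h
      dilate≤ {a} da a≢0 g g≤4 = close-≤ (EΩ ℛ g) (EΩ ℛ (λ r → g (a * r)))
        (subst (_≤ 4ℚ * h) (∣-∣-comm (EΩ ℛ (λ r → g (a * r))) (EΩ ℛ g)) (dilate gℛ da a≢0 (2ℚ * 2ℚ) g g≤4))

      dilate≥ : ∀ {a} → Def S″ 20 a → a ≢ 0ℚ → ∀ g → Bd (2ℚ * 2ℚ) g → EΩ ℛ (λ r → g (a * r)) ≤ EΩ ℛ g + 4ℚ * h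
      dilate≥ {a} da a≢0 g g≤4 = close-≤ (EΩ ℛ (λ r → g (a * r))) (EΩ ℛ g) (dilate gℛ da a≢0 (2ℚ * 2ℚ) g g≤4)

      module _ (no-drop : energy ℛ v ≤ energy ℛ V + 48δ) where

        -- `V` is the mean of the dilates of `v`, and dilation almost preserves energy. The loss of
        -- energy is therefore a variance, and if it is small, most dilates of `v` are close to `V`.
        variance : E (shifts μ) (λ t → EΩ ℛ (λ r c → sq (v (u t * r) c - V r c))) ≤ 48δ + h
        variance = begin
          E (shifts μ) (λ t → EΩ ℛ (λ r c → sq (v (u t * r) c - V r c)))
            ≡⟨ sym (EΩ-swap ℛ (shifts μ) (λ t r c → sq (v (u t * r) c - V r c))) ⟩
          EΩ ℛ (λ r c → E (shifts μ) (λ t → sq (v (u t * r) c - V r c)))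
            ≡⟨ EΩ-ext ℛ (λ r c → pointwise r c) ⟩
          EΩ ℛ (λ r c → E (shifts μ) (λ t → sq (v (u t * r) c)) - sq (V r c))
            ≡⟨ EΩ-− ℛ _ _ ⟩
          EΩ ℛ (λ r c → E (shifts μ) (λ t → sq (v (u t * r) c))) - energy ℛ V
            ≡⟨ cong (_- energy ℛ V) (EΩ-swap ℛ (shifts μ) (λ t r c → sq (v (u t * r) c))) ⟩
          E (shifts μ) (λ t → EΩ ℛ (λ r c → sq (v (u t * r) c))) - energy ℛ V
            ≤⟨ +-monoˡ-≤ (- energy ℛ V) (E-≤ (shifts μ) dilated) ⟩
          energy ℛ v + h - energy ℛ V
            ≤⟨ +-monoˡ-≤ (- energy ℛ V) (+-monoˡ-≤ h no-drop) ⟩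
          energy ℛ V + 48δ + h - energy ℛ V
            ≡⟨ lem (energy ℛ V) 48δ h ⟩
          48δ + h ∎
          where
          open ≤-Reasoning
          lem : ∀ a b c → a + b + c - a ≡ b + c
          lem = solve-∀ ℚ-ring
          dilated : ∀ t → Supp (shifts μ) t → EΩ ℛ (λ r c → sq (v (u t * r) c)) ≤ energy ℛ v + h
          dilated t s = close-≤ (EΩ ℛ (λ r c → sq (v (u t * r) c))) (energy ℛ v)
            (subst (∣ EΩ ℛ (λ r c → sq (v (u t * r) c)) - energy ℛ v ∣ ≤_) (*-identityˡ h)
              (dilate gℛ (raise (u-def s)) (u≢0 s) 1ℚ (λ r c → sq (v r c)) (λ r c → ∣∣-*-≤ (v r c) (v r c) (v≤1 r c) (v≤1 r c))))
          pointwise : ∀ r c → E (shifts μ) (λ t → sq (v (u t * r) c - V r c)) ≡ E (shifts μ) (λ t → sq (v (u t * r) c)) - sq (V r c)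
          pointwise r c = begin-equality
            E L (λ t → sq (g t - x̄))                       ≡⟨ E-ext L (λ t → expand (g t) x̄) ⟩
            E L (λ t → sq (g t) + (g t * (- (x̄ + x̄)) + x̄ * x̄)) ≡⟨ trans (E-+ L _ _)
                (cong (E L (λ t → sq (g t)) +_) (trans (E-+ L _ _) (cong₂ _+_ (E-*ʳ L (- (x̄ + x̄)) g) (E-const L (x̄ * x̄))))) ⟩
            E L (λ t → sq (g t)) + (E L g * (- (x̄ + x̄)) + x̄ * x̄) ≡⟨ cong
                (λ s → E L (λ t → sq (g t)) + (s * (- (x̄ + x̄)) + x̄ * x̄)) (sym (V≡ r c)) ⟩
            E L (λ t → sq (g t)) + (x̄ * (- (x̄ + x̄)) + x̄ * x̄) ≡⟨ fin (E L (λ t → sq (g t))) x̄ ⟩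
            E L (λ t → sq (g t)) - sq x̄                    ∎
            where
            L = shifts μ
            x̄ = V r c
            g : ℚ × ℚ × ℚ → ℚ
            g t = v (u t * r) c
            expand : ∀ x m → (x - m) * (x - m) ≡ x * x + (x * (- (m + m)) + m * m)
            expand = solve-∀ ℚ-ring
            fin : ∀ q m → q + (m * (- (m + m)) + m * m) ≡ q - m * m
            fin = solve-∀ ℚ-ring

        scaled-variance : ∀ (ρ : ℚ × ℚ × ℚ → ℚ) → (∀ {t} → Supp (shifts μ) t → Def S″ 20 (ρ t) × ρ t ≢ 0ℚ) →
          E (shifts μ) (λ t → EΩ ℛ (λ r c → sq (v (u t * (ρ t * r)) c - V (ρ t * r) c))) ≤ 53δ
        scaled-variance ρ good = begin
          E (shifts μ) (λ t → EΩ ℛ (λ r c → sq (v (u t * (ρ t * r)) c - V (ρ t * r) c)))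
            ≤⟨ E-mono (shifts μ) (λ t s → dilate≥ (proj₁ (good s)) (proj₂ (good s)) (λ r c → sq (v (u t * r) c - V r c))
                (λ r c → sq≤4 (v (u t * r) c) (V r c) (v≤1 _ c) (V≤1 _ c))) ⟩
          E (shifts μ) (λ t → EΩ ℛ (λ r c → sq (v (u t * r) c - V r c)) + 4ℚ * h)
            ≡⟨ trans (E-+ (shifts μ) _ _) (cong (E (shifts μ) (λ t → EΩ ℛ (λ r c → sq (v (u t * r) c - V r c))) +_)
                (E-const (shifts μ) (4ℚ * h))) ⟩
          E (shifts μ) (λ t → EΩ ℛ (λ r c → sq (v (u t * r) c - V r c))) + 4ℚ * h
            ≤⟨ +-monoˡ-≤ (4ℚ * h) variance ⟩
          48δ + h + 4ℚ * h
            ≡⟨ lem 48δ h ⟩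
          53δ ∎
          where
          open ≤-Reasoning
          lem : ∀ a h → a + h + (1ℚ + 1ℚ + (1ℚ + 1ℚ)) * h ≡ a + (1ℚ + 1ℚ + (1ℚ + 1ℚ) + 1ℚ) * h
          lem = solve-∀ ℚ-ring

        dist : (ℚ → C → ℚ) → ℚ → ℚ → ℚ
        dist g a b = E μ (λ k → EΩ ℛ (λ r c → sq (g (1ℚ * (k + a) * r) c - g (1ℚ * (k + b) * r) c)))

        0≤dist : ∀ g a b → 0ℚ ≤ dist g a b
        0≤dist g a b = E-0≤ μ (λ k → E-0≤ ℛ (λ r → E-0≤ 𝒞 (λ c → sq≥0 (g (1ℚ * (k + a) * r) c - g (1ℚ * (k + b) * r) c))))

        -- Dilating r by N k/(k + w′) turns v(u r) into v((k + w) r), whereas the point at which `V`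
        -- is taken does not involve w. Two shifts are compared through this common value.
        mean-dist : E 𝒲 (λ w₁ → E 𝒲 (λ w₂ → dist v w₁ w₂)) ≤ 4ℚ * 53δ
        mean-dist = begin
          E 𝒲 (λ w₁ → E 𝒲 (λ w₂ → dist v w₁ w₂))
            ≡⟨ E-ext 𝒲 (λ w₁ → E-ext 𝒲 (λ w₂ → sym (E-const 𝒲 _))) ⟩
          E 𝒲 (λ w₁ → E 𝒲 (λ w₂ → E 𝒲 (λ w′ → dist v w₁ w₂)))
            ≤⟨ E-mono 𝒲 (λ w₁ _ → E-mono 𝒲 (λ w₂ _ → E-mono 𝒲 (λ w′ _ → through w₁ w₂ w′))) ⟩
          E 𝒲 (λ w₁ → E 𝒲 (λ w₂ → E 𝒲 (λ w′ → 2ℚ * q w′ w₁ + 2ℚ * q w′ w₂)))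
            ≡⟨ E-ext 𝒲 (λ w₁ → trans (E-ext 𝒲 (λ w₂ → trans (E-+ 𝒲 (λ w′ → 2ℚ * q w′ w₁) (λ w′ → 2ℚ * q w′ w₂))
                (cong₂ _+_ (E-* 𝒲 2ℚ (λ w′ → q w′ w₁)) (E-* 𝒲 2ℚ (λ w′ → q w′ w₂)))))
                    (trans (E-+ 𝒲 (λ _ → 2ℚ * E 𝒲 (λ w′ → q w′ w₁)) (λ w₂ → 2ℚ * E 𝒲 (λ w′ → q w′ w₂)))
                        (cong₂ _+_ (E-const 𝒲 _) (E-* 𝒲 2ℚ (λ w₂ → E 𝒲 (λ w′ → q w′ w₂)))))) ⟩
          E 𝒲 (λ w₁ → 2ℚ * E 𝒲 (λ w′ → q w′ w₁) + 2ℚ * E 𝒲 (λ w₂ → E 𝒲 (λ w′ → q w′ w₂)))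
            ≡⟨ trans (E-+ 𝒲 (λ w₁ → 2ℚ * E 𝒲 (λ w′ → q w′ w₁)) (λ _ → 2ℚ * qq))
                (cong₂ _+_ (E-* 𝒲 2ℚ (λ w₁ → E 𝒲 (λ w′ → q w′ w₁))) (E-const 𝒲 _)) ⟩
          2ℚ * qq + 2ℚ * qq
            ≤⟨ +-mono-≤ (*-monoˡ 0≤2 qq≤) (*-monoˡ 0≤2 qq≤) ⟩
          2ℚ * 53δ + 2ℚ * 53δ
            ≡⟨ lem 53δ ⟩
          4ℚ * 53δ ∎
          where
          open ≤-Reasoning
          lem : ∀ x → (1ℚ + 1ℚ) * x + (1ℚ + 1ℚ) * x ≡ (1ℚ + 1ℚ + (1ℚ + 1ℚ)) * x
          lem = solve-∀ ℚ-ring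
          ρ : ℚ × ℚ × ℚ → ℚ
          ρ (k , w′ , w) = N k * inv (k + w′)
          q₀ : ℚ → ℚ → ℚ → ℚ
          q₀ k w′ w = EΩ ℛ (λ r c → sq (v (1ℚ * (k + w) * r) c - V (N k * inv (k + w′) * r) c))
          q : ℚ → ℚ → ℚ
          q w′ w = E μ (λ k → q₀ k w′ w)
          qq = E 𝒲 (λ w → E 𝒲 (λ w′ → q w′ w))
          through : ∀ w₁ w₂ w′ → dist v w₁ w₂ ≤ 2ℚ * q w′ w₁ + 2ℚ * q w′ w₂
          through w₁ w₂ w′ = ≤-trans (E-mono μ (λ k _ → ≤-trans (EΩ-mono ℛ
              (λ r c → sq-triangle (v (1ℚ * (k + w₁) * r) c) (v (1ℚ * (k + w₂) * r) c) (V (N k * inv (k + w′) * r) c)))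
              (≤-reflexive (trans (EΩ-+ ℛ _ _) (cong₂ _+_ (EΩ-* ℛ 2ℚ (λ r c → sq
                  (v (1ℚ * (k + w₁) * r) c - V (N k * inv (k + w′) * r) c)))
                      (EΩ-* ℛ 2ℚ (λ r c → sq (v (1ℚ * (k + w₂) * r) c - V (N k * inv (k + w′) * r) c))))))))
            (≤-reflexive (trans (E-+ μ (λ k → 2ℚ * q₀ k w′ w₁) (λ k → 2ℚ * q₀ k w′ w₂))
                (cong₂ _+_ (E-* μ 2ℚ (λ k → q₀ k w′ w₁)) (E-* μ 2ℚ (λ k → q₀ k w′ w₂)))))
          arg : ∀ {k w w′} → Supp μ k → Supp 𝒲 w′ → ∀ r → scale k w w′ * (N k * inv (k + w′) * r) ≡ 1ℚ * (k + w) * r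
          arg {k} {w} {w′} sk sw′ r = trans (lem₁ (inv (N k)) (k + w) (k + w′) (N k) (inv (k + w′)) r)
            (trans (cong₂ (λ a b → a * b * ((k + w) * r)) (*-invʳ (N≢0 sk)) (*-invʳ (k+w≢0 sk sw′))) (lem₂ (k + w) r))
            where
            lem₁ : ∀ i a b n j r → i * (a * b) * (n * j * r) ≡ n * i * (b * j) * (a * r)
            lem₁ = solve-∀ ℚ-ring
            lem₂ : ∀ a r → 1ℚ * 1ℚ * (a * r) ≡ 1ℚ * a * r
            lem₂ = solve-∀ ℚ-ring
          qq≤ : qq ≤ 53δ
          qq≤ = subst (_≤ 53δ) (trans (E-cong (shifts μ) (λ { (k , w′ , w) s → EΩ-ext ℛ (λ r c →
                cong (λ x → sq (v x c - V (N k * inv (k + w′) * r) c))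
                    (arg (proj₁ (Supp-shifts μ s)) (proj₁ (proj₂ (Supp-shifts μ s))) r)) }))
              (trans (E-shifts μ q₀) (trans (E-swap μ 𝒲 _) (trans (E-ext 𝒲 (λ w′ → E-swap μ 𝒲 _)) (E-swap 𝒲 𝒲 _)))))
            (scaled-variance ρ (λ { {k , w′ , w} s → let sk , sw′ , _ = Supp-shifts μ s in
              raise ((kᵈ sk ⊗ kᵈ sk ⊖ Dᵈ) ⊗ dinv (kᵈ sk ⊕ wᵈ sw′)) , *≢0 (N≢0 sk) (inv≢0 (k+w≢0 sk sw′)) }))

        open Pair gμ′ (Good-mono (λ s → inj₁ (inj₁ s)) gℛ) v v≤1 using (Q; B₀; correlation; VV≤1)

        -- The approximate value of `dist v a b` for every pair of distinct definable shifts: the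
        -- squares give the energy, the mixed term the normalised correlation `B₀`.
        d₀ : ℚ
        d₀ = energy ℛ v + energy ℛ v - (B₀ 1ℚ 1ℚ + B₀ 1ℚ 1ℚ)

        dist-v : ∀ {a b} → Def S 10 a → Def S 10 b → a ≢ b → ∣ dist v a b - d₀ ∣ ≤ 6ℚ * h
        dist-v {a} {b} da db a≢b = subst₂ (λ s t → ∣ s ∣ ≤ t) (sym diff) (lem₂ h)
          (∣∣-−-≤ ((M a - en) + (M b - en)) ((Q₁ - B) + (Q₁ - B)) (∣∣-+-≤ (M a - en) (M b - en) (norm da) (norm db))
              (∣∣-+-≤ (Q₁ - B) (Q₁ - B) corr corr))
          where
          en = energy ℛ v
          B = B₀ 1ℚ 1ℚ
          Q₁ = Q 1ℚ a 1ℚ b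
          corr : ∣ Q₁ - B ∣ ≤ h + h
          corr = correlation (raise da) (raise db) a≢b 1ℚ 1ℚ
          M : ℚ → ℚ
          M a = E μ (λ k → EΩ ℛ (λ r c → sq (v (1ℚ * (k + a) * r) c)))
          norm : ∀ {a} → Def S 10 a → ∣ M a - en ∣ ≤ h
          norm {a} da = subst (λ t → ∣ M a - t ∣ ≤ h) (E-const μ en) (E-close μ (λ k sk →
            subst (∣ EΩ ℛ (λ r c → sq (v (1ℚ * (k + a) * r) c)) - en ∣ ≤_) (*-identityˡ h)
              (dilate gℛ (raise (1ᵈ ⊗ (kᵈ sk ⊕ Def-mono (λ s → inj₁ (inj₁ s)) da)))
                (λ e → big+≢0 gμ sk (raise da) (trans (sym (*-identityˡ (k + a))) e)) 1ℚ (λ r c → sq (v r c)) (λ r c → VV≤1 r r c))))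
          lem₂ : ∀ h → h + h + (h + h + (h + h)) ≡ (1ℚ + 1ℚ + (1ℚ + 1ℚ) + (1ℚ + 1ℚ)) * h
          lem₂ = solve-∀ ℚ-ring
          expand : ∀ x y → (x - y) * (x - y) ≡ x * x + y * y - (x * y + x * y)
          expand = solve-∀ ℚ-ring
          dist≡ : dist v a b ≡ M a + M b - (Q₁ + Q₁)
          dist≡ = trans (E-ext μ (λ k → trans (EΩ-ext ℛ (λ r c → expand (v (1ℚ * (k + a) * r) c) (v (1ℚ * (k + b) * r) c)))
              (trans (EΩ-− ℛ _ _) (cong₂ _-_ (EΩ-+ ℛ _ _) (EΩ-+ ℛ _ _)))))
            (trans (E-− μ _ _) (cong₂ _-_ (E-+ μ _ _) (E-+ μ _ _)))
          lem : ∀ x y q e b → x + y - (q + q) - (e + e - (b + b)) ≡ (x - e) + (y - e) - ((q - b) + (q - b))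
          lem = solve-∀ ℚ-ring
          diff : dist v a b - d₀ ≡ (M a - en) + (M b - en) - ((Q₁ - B) + (Q₁ - B))
          diff = trans (cong (_- d₀) dist≡) (lem (M a) (M b) Q₁ en B)

        -- As `dist v` is almost the same for all pairs of distinct shifts, its average over random
        -- pairs controls this common value; coinciding pairs cost 4 and have weight at most `h`.
        d₀≤ : d₀ ≤ 4ℚ * 53δ + (6ℚ + 4ℚ) * h
        d₀≤ = begin
          d₀                                                                     ≡⟨ sym
              (trans (E-ext 𝒲 (λ _ → E-const 𝒲 d₀)) (E-const 𝒲 d₀)) ⟩
          E 𝒲 (λ w₁ → E 𝒲 (λ w₂ → d₀))                                           ≤⟨ E-mono 𝒲
              (λ w₁ s₁ → E-mono 𝒲 (λ w₂ s₂ → pointwise w₁ s₁ w₂ s₂)) ⟩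
          E 𝒲 (λ w₁ → E 𝒲 (λ w₂ → dist v w₁ w₂ + (6ℚ * h + 4ℚ * eq w₁ w₂)))       ≡⟨ trans (E-ext 𝒲 (λ w₁ → E-+ 𝒲 _ _)) (E-+ 𝒲 _ _) ⟩
          E 𝒲 (λ w₁ → E 𝒲 (λ w₂ → dist v w₁ w₂)) + E 𝒲 (λ w₁ → E 𝒲 (λ w₂ → 6ℚ * h + 4ℚ * eq w₁ w₂)) ≤⟨ +-mono-≤ mean-dist
              (E-≤ 𝒲 (λ w₁ _ → collide w₁)) ⟩
          4ℚ * 53δ + (6ℚ * h + 4ℚ * h)                                           ≡⟨ cong (4ℚ * 53δ +_) (sym (*-distribʳ-+ h 6ℚ 4ℚ)) ⟩
          4ℚ * 53δ + (6ℚ + 4ℚ) * h                                               ∎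
          where
          open ≤-Reasoning
          collide : ∀ w₁ → E 𝒲 (λ w₂ → 6ℚ * h + 4ℚ * eq w₁ w₂) ≤ 6ℚ * h + 4ℚ * h
          collide w₁ = subst (_≤ 6ℚ * h + 4ℚ * h) (sym (trans (E-+ 𝒲 _ _) (cong₂ _+_ (E-const 𝒲 (6ℚ * h)) (E-* 𝒲 4ℚ _))))
            (+-monoʳ-≤ (6ℚ * h) (*-monoˡ 0≤4 (E𝒲-collision w₁ (λ w → w) id)))
          d₀≤4 : d₀ ≤ 4ℚ
          d₀≤4 = ∣∣≤⇒≤ (∣∣-−-≤ (energy ℛ v + energy ℛ v) (B₀ 1ℚ 1ℚ + B₀ 1ℚ 1ℚ) (∣∣-+-≤ (energy ℛ v) (energy ℛ v) en≤1 en≤1)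
              (∣∣-+-≤ (B₀ 1ℚ 1ℚ) (B₀ 1ℚ 1ℚ) B≤1 B≤1))
            where
            en≤1 : ∣ energy ℛ v ∣ ≤ 1ℚ
            en≤1 = EΩ-∣∣ ℛ (λ r c → VV≤1 r r c)
            B≤1 : ∣ B₀ 1ℚ 1ℚ ∣ ≤ 1ℚ
            B≤1 = E-∣∣ μ (λ z _ → EΩ-∣∣ ℛ (λ r c → VV≤1 _ _ c))
          pointwise : ∀ w₁ → Supp 𝒲 w₁ → ∀ w₂ → Supp 𝒲 w₂ → d₀ ≤ dist v w₁ w₂ + (6ℚ * h + 4ℚ * eq w₁ w₂)
          pointwise w₁ s₁ w₂ s₂ with w₁ ℚ.≟ w₂
          ... | no n = ≤-trans (close-≤ d₀ (dist v w₁ w₂) (subst (_≤ 6ℚ * h) (∣-∣-comm (dist v w₁ w₂) d₀) (dist-v (def-w s₁) (def-w s₂) n)))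
                  (≤-reflexive (lem (dist v w₁ w₂) (6ℚ * h)))
            where
            lem : ∀ a b → a + b ≡ a + (b + (1ℚ + 1ℚ + (1ℚ + 1ℚ)) * 0ℚ)
            lem = solve-∀ ℚ-ring
          ... | yes _ = ≤-trans d₀≤4 (≤-by (0≤+ (0≤dist v w₁ w₂) (0≤* 0≤6 0≤h)) (lem (dist v w₁ w₂) (6ℚ * h)))
            where
            lem : ∀ a b → a + (b + (1ℚ + 1ℚ + (1ℚ + 1ℚ)) * 1ℚ) ≡ (1ℚ + 1ℚ + (1ℚ + 1ℚ)) + (a + b)
            lem = solve-∀ ℚ-ring

        -- The shift 0 does not occur in `𝒲`, so `mean-dist` says nothing about it directly; the
        -- pair 0, w is reached through `d₀`. Jensen then passes from `v` to its average `V`.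
        dist-V : ∀ {w} → Supp 𝒲 w → dist V 0ℚ w ≤ (4ℚ * 53δ + (6ℚ + 4ℚ) * h + 6ℚ * h) + 4ℚ * h
        dist-V {w} sw = begin
          dist V 0ℚ w                                     ≤⟨ E-mono μ (λ k _ → contract k) ⟩
          E μ (λ k → EΩ ℛ (λ r c → sq (v (1ℚ * (k + 0ℚ) * r) c - v (1ℚ * (k + w) * r) c)) + 4ℚ * h) ≡⟨ trans (E-+ μ _ _)
              (cong (dist v 0ℚ w +_) (E-const μ (4ℚ * h))) ⟩
          dist v 0ℚ w + 4ℚ * h                            ≤⟨ +-monoˡ-≤ (4ℚ * h)
              (≤-trans (close-≤ (dist v 0ℚ w) d₀ (dist-v c0 (def-w sw) (λ e → 𝒲-≢0 sw (sym e)))) (+-monoˡ-≤ (6ℚ * h) d₀≤)) ⟩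
          (4ℚ * 53δ + (6ℚ + 4ℚ) * h + 6ℚ * h) + 4ℚ * h    ∎
          where
          open ≤-Reasoning
          contract : ∀ k → EΩ ℛ (λ r c → sq (V (1ℚ * (k + 0ℚ) * r) c - V (1ℚ * (k + w) * r) c))
            ≤ EΩ ℛ (λ r c → sq (v (1ℚ * (k + 0ℚ) * r) c - v (1ℚ * (k + w) * r) c)) + 4ℚ * h
          contract k = begin
            EΩ ℛ (λ r c → sq (V (x r) c - V (y r) c))
              ≡⟨ EΩ-ext ℛ (λ r c → cong sq (trans (cong₂ _-_ (V≡ (x r) c) (V≡ (y r) c)) (sym (E-− (shifts μ) _ _)))) ⟩
            EΩ ℛ (λ r c → sq (E (shifts μ) (λ t → v (u t * x r) c - v (u t * y r) c)))
              ≤⟨ EΩ-jensen ℛ (shifts μ) (λ t r c → v (u t * x r) c - v (u t * y r) c) (λ t s → dilated t s) ⟩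
            EΩ ℛ (λ r c → sq (v (x r) c - v (y r) c)) + 4ℚ * h ∎
            where
            x y : ℚ → ℚ
            x r = 1ℚ * (k + 0ℚ) * r
            y r = 1ℚ * (k + w) * r
            dilated : ∀ t → Supp (shifts μ) t → EΩ ℛ (λ r c → sq (v (u t * x r) c - v (u t * y r) c)) ≤ EΩ ℛ
                (λ r c → sq (v (x r) c - v (y r) c)) + 4ℚ * h
            dilated t s = subst (_≤ EΩ ℛ (λ r c → sq (v (x r) c - v (y r) c)) + 4ℚ * h)
              (EΩ-ext ℛ (λ r c → cong₂ (λ p q → sq (v p c - v q c)) (swap-factors (1ℚ * (k + 0ℚ)) (u t) r)
                  (swap-factors (1ℚ * (k + w)) (u t) r)))
              (dilate≥ (raise (u-def s)) (u≢0 s) (λ r c → sq (v (x r) c - v (y r) c))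
                  (λ r c → sq≤4 (v (x r) c) (v (y r) c) (v≤1 _ c) (v≤1 _ c)))

        -- Two multipliers whose ratio is k : k + b with b ∈ {w, w′} are interchangeable under V.
        interchange : ∀ (x y a b : ℚ × ℚ × ℚ → ℚ) → (∀ {t} → Supp (shifts μ) t → Def S″ 20 (a t) × a t ≢ 0ℚ) →
          (∀ {t} → Supp (shifts μ) t → x t * a t ≡ proj₁ t) → (∀ {t} → Supp (shifts μ) t → y t * a t ≡ proj₁ t + b t) →
          E (shifts μ) (λ t → EΩ ℛ (λ r c → sq (V (1ℚ * (proj₁ t + 0ℚ) * r) c - V (1ℚ * (proj₁ t + b t) * r) c))) ≤
              (4ℚ * 53δ + (6ℚ + 4ℚ) * h + 6ℚ * h) + 4ℚ * h →
          E (shifts μ) (λ t → EΩ ℛ (λ r c → sq (V (x t * r) c - V (y t * r) c))) ≤ 16ℚ * δ₁ * (16ℚ * δ₁)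
        interchange x y a b good ex ey hyp = begin
          E (shifts μ) (λ t → EΩ ℛ (λ r c → sq (V (x t * r) c - V (y t * r) c)))
            ≤⟨ E-mono (shifts μ) (λ t s → ≤-trans (dilate≤ (proj₁ (good s)) (proj₂ (good s))
                (λ r c → sq (V (x t * r) c - V (y t * r) c)) (λ r c → sq≤4 (V (x t * r) c) (V (y t * r) c) (V≤1 _ c) (V≤1 _ c)))
                 (≤-reflexive (cong (_+ 4ℚ * h) (EΩ-ext ℛ (λ r c → cong₂ (λ p q → sq (V p c - V q c))
                   (trans (sym (*-assoc (x t) (a t) r)) (cong (_* r) (trans (ex s) (lem (proj₁ t)))))
                   (trans (sym (*-assoc (y t) (a t) r)) (cong (_* r) (trans (ey s) (sym (*-identityˡ (proj₁ t + b t))))))))))) ⟩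
          E (shifts μ) (λ t → EΩ ℛ (λ r c → sq (V (1ℚ * (proj₁ t + 0ℚ) * r) c - V (1ℚ * (proj₁ t + b t) * r) c)) + 4ℚ * h)
            ≡⟨ trans (E-+ (shifts μ) _ _) (cong (E (shifts μ) (λ t → EΩ ℛ
                (λ r c → sq (V (1ℚ * (proj₁ t + 0ℚ) * r) c - V (1ℚ * (proj₁ t + b t) * r) c))) +_) (E-const (shifts μ) (4ℚ * h))) ⟩
          E (shifts μ) (λ t → EΩ ℛ (λ r c → sq (V (1ℚ * (proj₁ t + 0ℚ) * r) c - V (1ℚ * (proj₁ t + b t) * r) c))) + 4ℚ * h
            ≤⟨ +-monoˡ-≤ (4ℚ * h) hyp ⟩
          (4ℚ * 53δ + (6ℚ + 4ℚ) * h + 6ℚ * h) + 4ℚ * h + 4ℚ * h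
            ≤⟨ 236δ≤ ⟩
          16ℚ * δ₁ * (16ℚ * δ₁) ∎
          where
          open ≤-Reasoning
          lem : ∀ k → k ≡ 1ℚ * (k + 0ℚ)
          lem = solve-∀ ℚ-ring

        -- `γ₀` is chosen so that u γ₀ = β(k). Changing k + w into k turns numerator and denominator
        -- into those of `γ₁` up to the ratio k : k + w, and the same change with w′ leads on to
        -- `γ₂`.
        γ₀ γ₁ γ₂ : ℚ × ℚ × ℚ → ℚ
        γ₀ (k , w′ , w) = 2e * k * inv ((k + w) * (k + w′))
        γ₁ (k , w′ , w) = 2e * inv (k + w′)
        γ₂ (k , w′ , w) = 2e * inv k

        pairing : (ℚ × ℚ × ℚ → ℚ) → ℚ
        pairing γ = E (shifts μ) (λ t → EΩ ℛ (λ r c → f r c * V (γ t * r) c))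

        pairing-close : ∀ γ γ′ {b} → 0ℚ ≤ b → E (shifts μ) (λ t → EΩ ℛ (λ r c → sq (V (γ t * r) c - V (γ′ t * r) c))) ≤ b * b →
            ∣ pairing γ - pairing γ′ ∣ ≤ b
        pairing-close γ γ′ {b} 0≤b hyp = subst (λ x → ∣ x ∣ ≤ b)
          (trans (E-ext (shifts μ) (λ t → trans (EΩ-ext ℛ (λ r c → distrib (f r c) (V (γ t * r) c) (V (γ′ t * r) c)))
              (EΩ-− ℛ _ _))) (E-− (shifts μ) _ _))
          (cauchy-schwarz₂ (shifts μ) ℛ (λ _ → f) (λ t r c → V (γ t * r) c - V (γ′ t * r) c) 0≤b (λ _ → f≤1) hyp)
          where
          distrib : ∀ a b c → a * (b - c) ≡ a * b - a * c
          distrib = solve-∀ ℚ-ring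

        γ₀γ₁ : ∣ pairing γ₀ - pairing γ₁ ∣ ≤ 16ℚ * δ₁
        γ₀γ₁ = pairing-close γ₀ γ₁ (0≤* 0≤16 0≤δ₁) (interchange γ₀ γ₁ (λ { (k , w′ , w) → (k + w) * (k + w′) * inv 2e })
            (λ { (k , w′ , w) → w })
          (λ { {k , w′ , w} s → let sk , sw′ , sw = Supp-shifts μ s in
            raise ((kᵈ sk ⊕ wᵈ sw) ⊗ (kᵈ sk ⊕ wᵈ sw′) ⊗ dinv (eᵈ ⊕ eᵈ)) , *≢0 (*≢0 (k+w≢0 sk sw) (k+w≢0 sk sw′)) (inv≢0 e+e≢0) })
          (λ { {k , w′ , w} s → let sk , sw′ , sw = Supp-shifts μ s in
            trans (lem₁ 2e k (inv ((k + w) * (k + w′))) ((k + w) * (k + w′)) (inv 2e))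
                (cancel₂ (*-invʳ (*≢0 (k+w≢0 sk sw) (k+w≢0 sk sw′))) k) })
          (λ { {k , w′ , w} s → let sk , sw′ , sw = Supp-shifts μ s in
            trans (lem₂ 2e (inv (k + w′)) (k + w) (k + w′) (inv 2e)) (cancel₂ (*-invʳ (k+w≢0 sk sw′)) (k + w)) })
          (≤-trans (≤-reflexive (trans (E-shifts μ _) (trans (E-ext μ (λ k → E-const 𝒲 _)) (E-swap μ 𝒲 _)))) (E-≤ 𝒲 (λ w sw → dist-V sw))))
          where
          lem₁ : ∀ e k i p j → e * k * i * (p * j) ≡ p * i * (e * j) * k
          lem₁ = solve-∀ ℚ-ring
          lem₂ : ∀ e i a b j → e * i * (a * b * j) ≡ b * i * (e * j) * a
          lem₂ = solve-∀ ℚ-ring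
          cancel₂ : ∀ {x} → x ≡ 1ℚ → ∀ k → x * (2e * inv 2e) * k ≡ k
          cancel₂ {x} e k = trans (cong₂ (λ s t → s * t * k) e (*-invʳ e+e≢0)) (*-identityˡ k)

        γ₁γ₂ : ∣ pairing γ₂ - pairing γ₁ ∣ ≤ 16ℚ * δ₁
        γ₁γ₂ = subst (_≤ 16ℚ * δ₁) (∣-∣-comm (pairing γ₁) (pairing γ₂))
            (pairing-close γ₁ γ₂ (0≤* 0≤16 0≤δ₁) (interchange γ₁ γ₂ (λ { (k , w′ , w) → k * (k + w′) * inv 2e }) (λ { (k , w′ , w) → w′ })
          (λ { {k , w′ , w} s → let sk , sw′ , sw = Supp-shifts μ s in
            raise (kᵈ sk ⊗ (kᵈ sk ⊕ wᵈ sw′) ⊗ dinv (eᵈ ⊕ eᵈ)) , *≢0 (*≢0 (k≢0 sk) (k+w≢0 sk sw′)) (inv≢0 e+e≢0) })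
          (λ { {k , w′ , w} s → let sk , sw′ , sw = Supp-shifts μ s in
            trans (lem₁ 2e (inv (k + w′)) k (k + w′) (inv 2e)) (cancel₂ (*-invʳ (k+w≢0 sk sw′)) k) })
          (λ { {k , w′ , w} s → let sk , sw′ , sw = Supp-shifts μ s in
            trans (lem₂ 2e (inv k) k (k + w′) (inv 2e)) (cancel₂ (*-invʳ (k≢0 sk)) (k + w′)) })
          (≤-trans (≤-reflexive (trans (E-shifts μ _) (trans (E-ext μ (λ k → E-ext 𝒲 (λ w′ → E-const 𝒲 _))) (E-swap μ 𝒲 _))))
              (E-≤ 𝒲 (λ w sw → dist-V sw)))))
          where
          lem₁ : ∀ e i a b j → e * i * (a * b * j) ≡ b * i * (e * j) * a
          lem₁ = solve-∀ ℚ-ring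
          lem₂ : ∀ e i a b j → e * i * (a * b * j) ≡ a * i * (e * j) * b
          lem₂ = solve-∀ ℚ-ring
          cancel₂ : ∀ {x} → x ≡ 1ℚ → ∀ k → x * (2e * inv 2e) * k ≡ k
          cancel₂ {x} e k = trans (cong₂ (λ s t → s * t * k) e (*-invʳ e+e≢0)) (*-identityˡ k)

        module _ (corr : ∣ E μ (λ k → EΩ ℛ (λ r c → f r c * v (β k * r) c)) ∣ ≤ 15δ) where

          pairing₀ : ∣ pairing γ₀ ∣ ≤ 15δ + (6ℚ + 2ℚ) * δ₁
          pairing₀ = subst (λ x → ∣ x ∣ ≤ 15δ + (6ℚ + 2ℚ) * δ₁) (lem X (pairing γ₀)) (∣∣-−-≤ X (X - pairing γ₀)
              (subst (λ x → ∣ x ∣ ≤ 15δ) (sym X≡) corr) diff)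
            where
            X = E (shifts μ) (λ t → EΩ ℛ (λ r c → f r c * v (u t * (γ₀ t * r)) c))
            lem : ∀ x y → x - (x - y) ≡ y
            lem = solve-∀ ℚ-ring
            arg : ∀ {k w w′} → Supp μ k → Supp 𝒲 w → Supp 𝒲 w′ → ∀ r → scale k w w′ * (2e * k * inv ((k + w) * (k + w′)) * r) ≡ β k * r
            arg {k} {w} {w′} sk sw sw′ r = trans (lem₁ (inv (N k)) ((k + w) * (k + w′)) 2e k (inv ((k + w) * (k + w′))) r)
              (trans (cong (_* (2e * k * inv (N k) * r)) (*-invʳ (*≢0 (k+w≢0 sk sw) (k+w≢0 sk sw′))))
                  (*-identityˡ (2e * k * inv (N k) * r)))
              where
              lem₁ : ∀ i p e k j r → i * p * (e * k * j * r) ≡ p * j * (e * k * i * r)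
              lem₁ = solve-∀ ℚ-ring
            X≡ : X ≡ E μ (λ k → EΩ ℛ (λ r c → f r c * v (β k * r) c))
            X≡ = trans (E-cong (shifts μ) (λ { (k , w′ , w) s → let sk , sw′ , sw = Supp-shifts μ s in
                  EΩ-ext ℛ (λ r c → cong (λ x → f r c * v x c) (arg sk sw sw′ r)) }))
                (trans (E-shifts μ (λ k w′ w → EΩ ℛ (λ r c → f r c * v (β k * r) c))) (E-ext μ (λ k → trans (E-const 𝒲 _) (E-const 𝒲 _))))
            diff : ∣ X - pairing γ₀ ∣ ≤ (6ℚ + 2ℚ) * δ₁
            diff = subst (λ x → ∣ x ∣ ≤ (6ℚ + 2ℚ) * δ₁)
              (trans (E-ext (shifts μ) (λ t → trans (EΩ-ext ℛ (λ r c → distrib (f r c) _ _)) (EΩ-− ℛ _ _))) (E-− (shifts μ) _ _))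
              (cauchy-schwarz₂ (shifts μ) ℛ (λ _ → f) (λ t r c → v (u t * (γ₀ t * r)) c - V (γ₀ t * r) c) (0≤* 0≤6+2 0≤δ₁) (λ _ → f≤1)
                (≤-trans (scaled-variance γ₀ (λ { {k , w′ , w} s → let sk , sw′ , sw = Supp-shifts μ s in
                  raise ((eᵈ ⊕ eᵈ) ⊗ kᵈ sk ⊗ dinv ((kᵈ sk ⊕ wᵈ sw) ⊗ (kᵈ sk ⊕ wᵈ sw′))) , *≢0 (*≢0 e+e≢0 (k≢0 sk))
                      (inv≢0 (*≢0 (k+w≢0 sk sw) (k+w≢0 sk sw′))) })) 53δ≤))
              where
              distrib : ∀ a b c → a * (b - c) ≡ a * b - a * c
              distrib = solve-∀ ℚ-ring

          pairing₂ : ∣ pairing γ₂ ∣ ≤ 15δ + (6ℚ + 2ℚ) * δ₁ + 16ℚ * δ₁ + 16ℚ * δ₁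
          pairing₂ = subst (λ x → ∣ x ∣ ≤ 15δ + (6ℚ + 2ℚ) * δ₁ + 16ℚ * δ₁ + 16ℚ * δ₁) (lem (pairing γ₀) (pairing γ₁) (pairing γ₂))
            (∣∣-+-≤ (pairing γ₀ - (pairing γ₀ - pairing γ₁)) (pairing γ₂ - pairing γ₁)
                (∣∣-−-≤ (pairing γ₀) (pairing γ₀ - pairing γ₁) pairing₀ γ₀γ₁) γ₁γ₂)
            where
            lem : ∀ a b c → a - (a - b) + (c - b) ≡ c
            lem = solve-∀ ℚ-ring

          -- The purpose of reaching 2e/k is its homogeneity: k ↦ ρk divides it by ρ, and r ↦ ρr
          -- restores it while moving ρ into the argument of `f`. The multiplier β(k) has no such
          -- property.
          decorrelation : ∀ {ρ} → Def S 15 ρ → ρ ≢ 0ℚ → E μ (λ k → EΩ ℛ (λ r c → f (ρ * r) c * V (2e * inv k * r) c)) ≤ 57δ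
          decorrelation {ρ} dρ ρ≢0 = ∣∣≤⇒≤ (subst (λ x → ∣ x ∣ ≤ 57δ) (lem X Y Z)
              (∣∣-+-≤ X ((Z - Y) + (Y - X)) X≤ (∣∣-+-≤ (Z - Y) (Y - X) ZY YX)))
            where
            lem : ∀ x y z → x + ((z - y) + (y - x)) ≡ z
            lem = solve-∀ ℚ-ring
            H : ℚ → ℚ
            H k = EΩ ℛ (λ r c → f r c * V (2e * inv k * r) c)
            X = E μ H
            Y = E μ (λ k → H (ρ * k + 0ℚ))
            Z = E μ (λ k → EΩ ℛ (λ r c → f (ρ * r) c * V (2e * inv k * r) c))
            fV≤1 : ∀ x y c → ∣ f x c * V y c ∣ ≤ 1ℚ
            fV≤1 x y c = ∣∣-*-≤ (f x c) (V y c) (f≤1 x c) (V≤1 y c)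
            X≤ : ∣ X ∣ ≤ 15δ + (6ℚ + 2ℚ) * δ₁ + 16ℚ * δ₁ + 16ℚ * δ₁
            X≤ = subst (λ x → ∣ x ∣ ≤ 15δ + (6ℚ + 2ℚ) * δ₁ + 16ℚ * δ₁ + 16ℚ * δ₁)
              (trans (E-shifts μ (λ k _ _ → H k)) (E-ext μ (λ k → trans (E-const 𝒲 _) (E-const 𝒲 _)))) pairing₂
            YX : ∣ Y - X ∣ ≤ h
            YX = subst (∣ Y - X ∣ ≤_) (*-identityˡ h) (invariant gμ′ (raise dρ) c0 ρ≢0 1ℚ H (λ k → EΩ-∣∣ ℛ (λ r c → fV≤1 _ _ c)))
            ZY : ∣ Z - Y ∣ ≤ h
            ZY = E-close μ (λ k sk → subst₂ (λ a b → ∣ a - H (ρ * k + 0ℚ) ∣ ≤ b)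
              (EΩ-ext ℛ (λ r c → cong (λ x → f (ρ * r) c * V x c) (arg k sk r))) (*-identityˡ h)
              (dilate gℛ (raise (Def-mono (λ s → inj₁ (inj₁ s)) dρ)) ρ≢0 1ℚ (λ r c → f r c * V (2e * inv (ρ * k + 0ℚ) * r) c)
                  (λ r c → fV≤1 _ _ c)))
              where
              arg : ∀ k → Supp μ k → ∀ r → 2e * inv (ρ * k + 0ℚ) * (ρ * r) ≡ 2e * inv k * r
              arg k sk r = trans (cong (λ t → 2e * t * (ρ * r)) (trans (cong inv (+-identityʳ (ρ * k))) (inv-* ρ≢0 (k≢0 sk))))
                (trans (lem₁ 2e (inv ρ) (inv k) ρ r) (trans (cong (_* (2e * inv k * r)) (*-invʳ ρ≢0)) (*-identityˡ (2e * inv k * r))))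
                where
                lem₁ : ∀ e i j p r → e * (i * j) * (p * r) ≡ p * i * (e * j * r)
                lem₁ = solve-∀ ℚ-ring

    -- Existence of good laws.

    opaque
      Finite-Def : ∀ {S} → Finite S → ∀ n → Finite (Def S n)
      Finite-Def {S} (xs , S∈) n = closure n , complete
        where
        base : List ℚ
        base = xs ++ 0ℚ ∷ 1ℚ ∷ D ∷ e ∷ map wpt (allFin (suc m))
        closure : ℕ → List ℚ
        closure zero = base
        closure (suc n) = base ++ cartesianProductWith _+_ (closure n) (closure n) ++ cartesianProductWith _*_ (closure n) (closure n)
          ++ map -_ (closure n) ++ map inv (closure n)
        from-base : ∀ n {x} → x ∈ base → x ∈ closure n
        from-base zero i = i
        from-base (suc n) i = ∈-++⁺ˡ i
        complete : ∀ {n x} → Def S n x → x ∈ closure n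
        complete {n} (var s) = from-base n (∈-++⁺ˡ (S∈ s))
        complete {n} c0 = from-base n (∈-++⁺ʳ xs (here refl))
        complete {n} c1 = from-base n (∈-++⁺ʳ xs (there (here refl)))
        complete {n} cD = from-base n (∈-++⁺ʳ xs (there (there (here refl))))
        complete {n} ce = from-base n (∈-++⁺ʳ xs (there (there (there (here refl)))))
        complete {n} (cw i) = from-base n (∈-++⁺ʳ xs (there (there (there (there (∈-map⁺ wpt (∈-allFin i)))))))
        complete (add p q) = ∈-++⁺ʳ base (∈-++⁺ˡ (∈-cartesianProductWith⁺ _+_ (complete p) (complete q)))
        complete {suc n} (mul p q) = ∈-++⁺ʳ base (∈-++⁺ʳ (cartesianProductWith _+_ (closure n) (closure n))
            (∈-++⁺ˡ (∈-cartesianProductWith⁺ _*_ (complete p) (complete q))))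
        complete {suc n} (ng p) = ∈-++⁺ʳ base (∈-++⁺ʳ (cartesianProductWith _+_ (closure n) (closure n))
            (∈-++⁺ʳ (cartesianProductWith _*_ (closure n) (closure n)) (∈-++⁺ˡ (∈-map⁺ -_ (complete p)))))
        complete {suc n} (dinv p) = ∈-++⁺ʳ base (∈-++⁺ʳ (cartesianProductWith _+_ (closure n) (closure n))
            (∈-++⁺ʳ (cartesianProductWith _*_ (closure n) (closure n)) (∈-++⁺ʳ (map -_ (closure n)) (∈-map⁺ inv (complete p)))))

    -- Averages over boxes of iterates of commuting maps are almost invariant under each of the maps.
    module Orbit {I X : Set} (φ : I → X → X) (φ-comm : ∀ i j x → φ i (φ j x) ≡ φ j (φ i x)) (M : ℕ) where

      iterate : I → ℕ → X → X
      iterate i zero x = x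
      iterate i (suc n) x = φ i (iterate i n x)

      iterate-comm : ∀ i j n x → iterate i n (φ j x) ≡ φ j (iterate i n x)
      iterate-comm i j zero x = refl
      iterate-comm i j (suc n) x = trans (cong (φ i) (iterate-comm i j n x)) (φ-comm i j (iterate i n x))

      orbit : List I → X → Law X
      orbit [] x = ret x
      orbit (i ∷ is) x = avg M (λ n → orbit is (iterate i (Fin.toℕ n) x))

      orbit-map : ∀ is j x (G : X → ℚ) → E (orbit is (φ j x)) G ≡ E (orbit is x) (λ y → G (φ j y))
      orbit-map [] j x G = refl
      orbit-map (i ∷ is) j x G = cong (inv (nat (suc M)) *_) (sumF-cong (suc M) (λ n →
        trans (cong (λ y → E (orbit is y) G) (iterate-comm i j (Fin.toℕ n) x)) (orbit-map is j (iterate i (Fin.toℕ n) x) G)))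

      telescope : ∀ n (H : ℕ → ℚ) → sumF n (λ i → H (suc (Fin.toℕ i))) - sumF n (λ i → H (Fin.toℕ i)) ≡ H n - H 0
      telescope zero H = sym (+-inverseʳ (H 0))
      telescope (suc n) H = begin
        sumF n (λ i → H (suc (Fin.toℕ (inject₁ i)))) + H (suc (Fin.toℕ (fromℕ n)))
            - (sumF n (λ i → H (Fin.toℕ (inject₁ i))) + H (Fin.toℕ (fromℕ n)))
          ≡⟨ cong₂ (λ s t → s - t) (cong₂ _+_ (sumF-cong n (λ i → cong (H ∘ suc) (FinP.toℕ-inject₁ i))) (cong (H ∘ suc) (FinP.toℕ-fromℕ n)))
                                   (cong₂ _+_ (sumF-cong n (λ i → cong H (FinP.toℕ-inject₁ i))) (cong H (FinP.toℕ-fromℕ n))) ⟩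
        a + H (suc n) - (b + H n)
          ≡⟨ lem a b (H n) (H (suc n)) ⟩
        (a - b) + (H (suc n) - H n)
          ≡⟨ cong (_+ (H (suc n) - H n)) (telescope n H) ⟩
        (H n - H 0) + (H (suc n) - H n)
          ≡⟨ lem₂ (H n) (H 0) (H (suc n)) ⟩
        H (suc n) - H 0 ∎
        where
        open ≡-Reasoning
        a = sumF n (λ i → H (suc (Fin.toℕ i)))
        b = sumF n (λ i → H (Fin.toℕ i))
        lem : ∀ a b x y → a + y - (b + x) ≡ (a - b) + (y - x)
        lem = solve-∀ ℚ-ring
        lem₂ : ∀ x z y → (x - z) + (y - x) ≡ y - z
        lem₂ = solve-∀ ℚ-ring

      orbit-shift : ∀ {is j} → j ∈ is → ∀ x b (G : X → ℚ) → (∀ y → ∣ G y ∣ ≤ b) →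
        ∣ E (orbit is (φ j x)) G - E (orbit is x) G ∣ ≤ inv (nat (suc M)) * (b + b)
      orbit-shift {is = i ∷ is} (here refl) x b G bd = subst (λ t → ∣ t ∣ ≤ w * (b + b)) (sym eqn)
        (∣∣-*-≤ w (H (suc M) - H 0) (≤-reflexive (0≤p⇒∣p∣≡p (0≤wt M))) (∣∣-−-≤ (H (suc M)) (H 0) (H≤ (suc M)) (H≤ 0)))
        where
        w = inv (nat (suc M))
        H : ℕ → ℚ
        H n = E (orbit is (iterate i n x)) G
        H≤ : ∀ n → ∣ H n ∣ ≤ b
        H≤ n = E-∣∣ (orbit is (iterate i n x)) (λ y _ → bd y)
        factor : ∀ w a b → w * a - w * b ≡ w * (a - b)
        factor = solve-∀ ℚ-ring
        eqn : E (orbit (i ∷ is) (φ i x)) G - E (orbit (i ∷ is) x) G ≡ w * (H (suc M) - H 0)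
        eqn = trans (cong (λ s → w * s - E (orbit (i ∷ is) x) G) (sumF-cong (suc M)
            (λ n → cong (λ y → E (orbit is y) G) (iterate-comm i i (Fin.toℕ n) x))))
          (trans (factor w (sumF (suc M) (λ n → H (suc (Fin.toℕ n)))) (sumF (suc M) (λ n → H (Fin.toℕ n))))
              (cong (w *_) (telescope (suc M) H)))
      orbit-shift {is = i ∷ is} {j} (there j∈) x b G bd = subst (λ t → ∣ t ∣ ≤ W) eqn
        (E-∣∣ (avg M ret) (λ n _ → subst (λ y → ∣ E (orbit is y) G - E (orbit is (iterate i (Fin.toℕ n) x)) G ∣ ≤ W)
          (sym (iterate-comm i j (Fin.toℕ n) x)) (orbit-shift j∈ (iterate i (Fin.toℕ n) x) b G bd)))
        where
        W = inv (nat (suc M)) * (b + b)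
        eqn = E-− (avg M ret) (λ n → E (orbit is (iterate i (Fin.toℕ n) (φ j x))) G) (λ n → E (orbit is (iterate i (Fin.toℕ n) x)) G)

      orbit-invariant : ∀ {is j} → j ∈ is → ∀ x b (G : X → ℚ) → (∀ y → ∣ G y ∣ ≤ b) →
        ∣ E (orbit is x) (λ y → G (φ j y)) - E (orbit is x) G ∣ ≤ inv (nat (suc M)) * (b + b)
      orbit-invariant {is} {j} j∈ x b G bd = subst (λ t → ∣ t - E (orbit is x) G ∣ ≤ inv (nat (suc M)) * (b + b))
          (orbit-map is j x G) (orbit-shift j∈ x b G bd)

      orbit-preserves : (P : X → Set) → (∀ i x → P x → P (φ i x)) → ∀ is x → P x → ∀ {y} → Supp (orbit is x) y → P y
      orbit-preserves P pres [] x px refl = px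
      orbit-preserves P pres (i ∷ is) x px (n , s) = orbit-preserves P pres is (iterate i (Fin.toℕ n) x) (iterated (Fin.toℕ n)) s
        where
        iterated : ∀ n → P (iterate i n x)
        iterated zero = px
        iterated (suc n) = pres i (iterate i n x) (iterated n)

    opaque
      list-bound : (xs : List ℚ) → Σ[ B ∈ ℚ ] (0ℚ ≤ B × (∀ {x} → x ∈ xs → ∣ x ∣ ≤ B))
      list-bound [] = 0ℚ , ≤-refl , λ ()
      list-bound (x ∷ xs) with list-bound xs
      ... | B , 0≤B , bd = ∣ x ∣ + B , 0≤+ (0≤∣p∣ x) 0≤B , λ
        { (here refl) → ≤-by 0≤B refl
        ; (there i) → ≤-trans (bd i) (≤-by (0≤∣p∣ x) (+-comm (∣ x ∣) B)) }

    -- Lets every element of a list act by multiplication without leaving the nonzero rationals; 0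
    -- acts trivially.
    nonzero : ℚ → ℚ
    nonzero α with α ℚ.≟ 0ℚ
    ... | yes _ = 1ℚ
    ... | no _ = α

    nonzero≢0 : ∀ α → nonzero α ≢ 0ℚ
    nonzero≢0 α with α ℚ.≟ 0ℚ
    ... | yes _ = 1≢0
    ... | no n = n

    nonzero-≡ : ∀ {α} → α ≢ 0ℚ → nonzero α ≡ α
    nonzero-≡ {α} n with α ℚ.≟ 0ℚ
    ... | yes e = ⊥-elim (n e)
    ... | no _ = refl

    separate : ∀ {b₁ b₂ x t} → ∣ x ∣ ≤ b₁ → ∣ t ∣ ≤ b₂ → ∣ x ∣ < ∣ b₁ + b₂ + 1ℚ + t ∣
    separate {b₁} {b₂} {x} {t} hx ht = ≤-<-trans hx (<-≤-trans b₁<b₁+1 (≤-trans (≤-by 0≤b₂+t (lem b₁ b₂ t)) (x≤∣x∣ (b₁ + b₂ + 1ℚ + t))))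
      where
      b₁<b₁+1 : b₁ < b₁ + 1ℚ
      b₁<b₁+1 = ≤-<-trans (≤-reflexive (sym (+-identityʳ b₁))) (+-monoʳ-< b₁ 0<1)
      0≤b₂+t : 0ℚ ≤ b₂ - (- t)
      0≤b₂+t = 0≤diff { - t} {b₂} (≤-trans (x≤∣x∣ (- t)) (≤-trans (≤-reflexive (∣-p∣≡∣p∣ t)) ht))
      lem : ∀ a b t → a + b + 1ℚ + t ≡ a + 1ℚ + (b - (- t))
      lem = solve-∀ ℚ-ring

    ∣∣<-* : ∀ {a y s} → a ≢ 0ℚ → ∣ s * inv a ∣ < ∣ y ∣ → ∣ s ∣ < ∣ a * y ∣
    ∣∣<-* {a} {y} {s} a≢0 lt = subst₂ _<_ (trans (sym (∣p*q∣≡∣p∣*∣q∣ (s * inv a) a)) (cong ∣_∣ s≡))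
        (trans (sym (∣p*q∣≡∣p∣*∣q∣ y a)) (cong ∣_∣ (*-comm y a)))
        (*-monoˡ-<-pos ∣ a ∣ {{positive 0<a}} lt)
      where
      s≡ : s * inv a * a ≡ s
      s≡ = trans (*-assoc s (inv a) a) (trans (cong (s *_) (inv-sym a≢0)) (*-identityʳ s))
      0<a : 0ℚ < ∣ a ∣
      0<a = ≰⇒> (λ le → a≢0 (∣p∣≡0⇒p≡0 a (≤-antisym le (0≤∣p∣ a))))

    -- z = a(T + t), with a averaged over a multiplicative box and t over an additive box that absorbs all translations
    -- β/(αa); the constant T makes z large.
    module Box {S : ℚ → Set} {ε : ℚ} (xs : List ℚ) (∈xs : ∀ {x} → Def S 20 x → x ∈ xs) (M : ℕ) (4w≤ε : inv (nat (suc M)) * 4ℚ ≤ ε) where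
      w : ℚ
      w = inv (nat (suc M))

      module Mul = Orbit (λ α a → nonzero α * a) (λ α β a → swap-factors (nonzero α) (nonzero β) a) M

      +-swap : ∀ a b c → a + (b + c) ≡ b + (a + c)
      +-swap = solve-∀ ℚ-ring

      module Add = Orbit _+_ +-swap M

      𝒜 : Law ℚ
      𝒜 = Mul.orbit xs 1ℚ

      gs : List ℚ
      gs = cartesianProductWith (λ β x → β * inv x) xs (cartesianProductWith _*_ xs (proj₁ (Finite-Supp 𝒜)))

      𝒯 : Law ℚ
      𝒯 = Add.orbit gs 0ℚ

      𝒜≢0 : ∀ {a} → Supp 𝒜 a → a ≢ 0ℚ
      𝒜≢0 = Mul.orbit-preserves (_≢ 0ℚ) (λ α a a≢0 → *≢0 (nonzero≢0 α) a≢0) xs 1ℚ 1≢0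

      module _ (T : ℚ) where
        L : Law ℚ
        L = bind 𝒜 (λ a → bind 𝒯 (λ t → ret (a * (T + t))))

        E-L : ∀ g → E L g ≡ E 𝒜 (λ a → E 𝒯 (λ t → g (a * (T + t))))
        E-L g = trans (E-bind 𝒜 _ g) (E-ext 𝒜 (λ a → E-bind 𝒯 _ g))

        inv-L : ∀ {α β} → Def S 20 α → Def S 20 β → α ≢ 0ℚ → ∀ b (G : ℚ → ℚ) → (∀ x → ∣ G x ∣ ≤ b) →
          ∣ E L (λ z → G (α * z + β)) - E L G ∣ ≤ b * ε
        inv-L {α} {β} dα dβ α≢0 b G bd = ≤-trans
          (∣-∣-trans (E L (λ z → G (α * z + β))) (E 𝒜 (λ a → K (nonzero α * a))) (E L G)
            (subst (λ x → ∣ x - E 𝒜 (λ a → K (nonzero α * a)) ∣ ≤ w * (b + b)) (sym (E-L _)) (E-close 𝒜 additive))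
            (subst (λ x → ∣ E 𝒜 (λ a → K (nonzero α * a)) - x ∣ ≤ w * (b + b)) (sym (E-L G))
              (Mul.orbit-invariant (∈xs dα) 1ℚ b K (λ a → E-∣∣ 𝒯 (λ t _ → bd (a * (T + t)))))))
          (subst₂ _≤_ (lem₄ b w) refl (*-monoˡ (≤-trans (0≤∣p∣ (G 0ℚ)) (bd 0ℚ)) 4w≤ε))
          where
          K : ℚ → ℚ
          K a = E 𝒯 (λ t → G (a * (T + t)))
          lem₄ : ∀ b w → b * (w * (1ℚ + 1ℚ + (1ℚ + 1ℚ))) ≡ w * (b + b) + w * (b + b)
          lem₄ = solve-∀ ℚ-ring
          additive : ∀ a → Supp 𝒜 a → ∣ E 𝒯 (λ t → G (α * (a * (T + t)) + β)) - K (nonzero α * a) ∣ ≤ w * (b + b)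
          additive a sa = subst₂ (λ x y → ∣ x - y ∣ ≤ w * (b + b)) (E-ext 𝒯 (λ t → cong G (arg t)))
              (cong K (cong (_* a) (sym (nonzero-≡ α≢0))))
            (Add.orbit-invariant (∈-cartesianProductWith⁺ (λ β x → β * inv x) (∈xs dβ)
                (∈-cartesianProductWith⁺ _*_ (∈xs dα) (proj₂ (Finite-Supp 𝒜) sa)))
              0ℚ b (λ t → G (α * a * (T + t))) (λ t → bd _))
            where
            g = β * inv (α * a)
            arg : ∀ t → α * a * (T + (g + t)) ≡ α * (a * (T + t)) + β
            arg t = trans (lem₁ α a T β (inv (α * a)) t) (trans (cong (λ x → α * (a * (T + t)) + β * x)
                (*-invʳ (*≢0 α≢0 (𝒜≢0 sa)))) (cong (α * (a * (T + t)) +_) (*-identityʳ β)))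
              where
              lem₁ : ∀ α a T β i t → α * a * (T + (β * i + t)) ≡ α * (a * (T + t)) + β * (α * a * i)
              lem₁ = solve-∀ ℚ-ring

        box-good : (∀ {a t s} → Supp 𝒜 a → Supp 𝒯 t → Def S 20 s → ∣ s * inv a ∣ < ∣ T + t ∣) → GoodAt ε S L
        box-good large .invariant = inv-L
        box-good large .big sz {s} ds = subst (λ z → ∣ s ∣ < ∣ z ∣) (sym (proj₂ (proj₂ u))) (∣∣<-* (𝒜≢0 sa) (large sa (proj₁ (proj₂ u)) ds))
          where
          sa = proj₁ (proj₂ (Supp-bind 𝒜 _ sz))
          u = Supp-bind 𝒯 _ (proj₂ (proj₂ (Supp-bind 𝒜 _ sz)))

      bounded-box-good : ∀ b₁ b₂ → (∀ {a s} → Supp 𝒜 a → Def S 20 s → ∣ s * inv a ∣ ≤ b₁) → (∀ {t} → Supp 𝒯 t → ∣ t ∣ ≤ b₂) →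
        GoodAt ε S (L (b₁ + b₂ + 1ℚ))
      bounded-box-good b₁ b₂ h₁ h₂ = box-good (b₁ + b₂ + 1ℚ) (λ {a} {t} {s} sa st ds → separate {b₁} {b₂} {s * inv a} {t}
          (h₁ sa ds) (h₂ st))

      quotients : List ℚ
      quotients = cartesianProductWith (λ s a → s * inv a) xs (proj₁ (Finite-Supp 𝒜))

      quotients-complete : ∀ {a s} → Supp 𝒜 a → Def S 20 s → s * inv a ∈ quotients
      quotients-complete sa ds = ∈-cartesianProductWith⁺ (λ s a → s * inv a) (∈xs ds) (proj₂ (Finite-Supp 𝒜) sa)

      good-from-list : Σ[ L ∈ Law ℚ ] GoodAt ε S L
      good-from-list = L (proj₁ (list-bound quotients) + proj₁ (list-bound (proj₁ (Finite-Supp 𝒯))) + 1ℚ) , bounded-box-good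
          (proj₁ (list-bound quotients)) (proj₁ (list-bound (proj₁ (Finite-Supp 𝒯))))
        (λ sa ds → proj₂ (proj₂ (list-bound quotients)) (quotients-complete sa ds))
        (λ st → proj₂ (proj₂ (list-bound (proj₁ (Finite-Supp 𝒯)))) (proj₂ (Finite-Supp 𝒯) st))

    opaque
      good-exists : ∀ {S ε} → Finite S → 0ℚ < ε → Σ[ L ∈ Law ℚ ] GoodAt ε S L
      good-exists {S} {ε} fin 0<ε = Box.good-from-list {S} {ε} (proj₁ (Finite-Def fin 20)) (proj₂ (Finite-Def fin 20))
        (proj₁ (small-weight 0<ε)) (proj₂ (small-weight 0<ε))

    Good-avg : ∀ {S ε n} {η : Fin (suc n) → Law ℚ} → (∀ i → GoodAt ε S (η i)) → GoodAt ε S (avg n η)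
    Good-avg {n = n} {η} g .invariant {α} {β} dα dβ α≢0 b G bd =
      subst (λ t → ∣ t ∣ ≤ _) (E-− (avg n ret) (λ i → E (η i) (λ z → G (α * z + β))) (λ i → E (η i) G))
        (E-∣∣ (avg n ret) (λ i _ → invariant (g i) dα dβ α≢0 b G bd))
    Good-avg g .big (i , s) = big (g i) s

    -- Existence of hierarchical blocks.

    snoc : {A : Set} {n : ℕ} → (Fin n → A) → A → Fin (suc n) → A
    snoc {n = zero} f a _ = a
    snoc {n = suc n} f a zero = f zero
    snoc {n = suc n} f a (suc i) = snoc (f ∘ suc) a i

    snoc-inject₁ : {A : Set} {n : ℕ} (f : Fin n → A) (a : A) → ∀ i → snoc f a (inject₁ i) ≡ f i
    snoc-inject₁ {n = suc n} f a zero = refl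
    snoc-inject₁ {n = suc n} f a (suc i) = snoc-inject₁ (f ∘ suc) a i

    snoc-last : {A : Set} (n : ℕ) (f : Fin n → A) (a : A) → snoc f a (fromℕ n) ≡ a
    snoc-last zero f a = refl
    snoc-last (suc n) f a = snoc-last n (f ∘ suc) a

    pre-cong : ∀ {n} {η η′ : Fin n → Law ℚ} → (∀ i → η i ≡ η′ i) → pre n η ⊆ pre n η′
    pre-cong e {x} (i , s) = i , subst (λ L → Supp L x) (e i) s

    Hier-cong : ∀ {S} n {η η′ : Fin n → Law ℚ} → (∀ i → η i ≡ η′ i) → Hier S n η → Hier S n η′
    Hier-cong zero e hi = tt
    Hier-cong {S} (suc n) {η} {η′} e (hi , g) = Hier-cong n (e ∘ inject₁) hi ,
      subst (Good _) (e (fromℕ n)) (Good-mono (λ { (inj₁ s) → inj₁ s ; (inj₂ p) → inj₂ (pre-cong (λ i → sym (e (inject₁ i))) p) }) g)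

    opaque
      -- Two qualities are recorded: `h` relative to the predecessors serves the second-moment
      -- estimates, while ε relative to `S` alone is inherited by the average of the block and keeps
      -- composites good.
      block-exists : ∀ {S ε} → Finite S → 0ℚ < ε → ε ≤ h → ∀ n → Σ[ η ∈ (Fin n → Law ℚ) ] (Hier S n η × (∀ i → GoodAt ε S (η i)))
      block-exists fin 0<ε ε≤h zero = (λ ()) , tt , λ ()
      block-exists {S} {ε} fin 0<ε ε≤h (suc n) with block-exists fin 0<ε ε≤h n
      ... | η , hi , g = snoc η L , (Hier-cong n (λ i → sym (snoc-inject₁ η L i)) hi ,
              subst (Good _) (sym (snoc-last n η L)) (Good-mono (λ { (inj₁ s) → inj₁ s ; (inj₂ p) → inj₂
                  (pre-cong (snoc-inject₁ η L) p) }) (Good-≤ ε≤h gL))) , all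
        where
        Finite-pre : Finite (pre n η)
        Finite-pre = concat (map (λ i → proj₁ (Finite-Supp (η i))) (allFin n)) ,
            λ { (i , s) → ∈-concat⁺′ (proj₂ (Finite-Supp (η i)) s) (∈-map⁺ (λ i → proj₁ (Finite-Supp (η i))) (∈-allFin i)) }
        ex : Σ[ L ∈ Law ℚ ] GoodAt ε (S ∪ pre n η) L
        ex = good-exists (Finite-∪ fin Finite-pre) 0<ε
        L : Law ℚ
        L = proj₁ ex
        gL : GoodAt ε (S ∪ pre n η) L
        gL = proj₂ ex
        all : ∀ i → GoodAt ε S (snoc η L i)
        all i with last-or-inject₁ i
        ... | inj₁ refl = subst (GoodAt ε S) (sym (snoc-last n η L)) (Good-mono inj₁ gL)
        ... | inj₂ (j , refl) = subst (GoodAt ε S) (sym (snoc-inject₁ η L j)) (g j)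

    -- Nondegenerate edges.

    quadratic≢0 : ∀ {S ε L} → GoodAt ε S L → ∀ {z} → Supp L z → ∀ {a b c} → Def S 7 a → Def S 7 b → Def S 7 c → a ≢ 0ℚ →
      a * (z * z) + b * z + c ≢ 0ℚ
    quadratic≢0 g {z} s {a} {b} {c} da db dc a≢0 e≡ = no-big-root g s {b = - (b * i)} {c = - (c * i)} (raise (ng (db ⊗ dinv da)))
        (raise (ng (dc ⊗ dinv da))) (begin
      z * z                                       ≡⟨ lem₁ (z * z) ⟩
      1ℚ * (z * z)                                ≡⟨ cong (_* (z * z)) (sym (*-invʳ a≢0)) ⟩
      a * i * (z * z)                             ≡⟨ lem₂ a b c i z ⟩
      (a * (z * z) + b * z + c) * i + (- (b * i) * z + - (c * i)) ≡⟨ cong (λ t → t * i + (- (b * i) * z + - (c * i))) e≡ ⟩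
      0ℚ * i + (- (b * i) * z + - (c * i))        ≡⟨ lem₃ i (- (b * i) * z + - (c * i)) ⟩
      - (b * i) * z + - (c * i)                   ∎)
      where
      open ≡-Reasoning
      i = inv a
      lem₁ : ∀ x → x ≡ 1ℚ * x
      lem₁ = solve-∀ ℚ-ring
      lem₂ : ∀ a b c i z → a * i * (z * z) ≡ (a * (z * z) + b * z + c) * i + (- (b * i) * z + - (c * i))
      lem₂ = solve-∀ ℚ-ring
      lem₃ : ∀ i x → 0ℚ * i + x ≡ x
      lem₃ = solve-∀ ℚ-ring

    -- What is needed for x = r N z and y = r β(k)(z+k)(z+D/k) to be distinct solutions in absolute value.
    record Valid (k z : ℚ) : Set where
      field
        k≢0 : k ≢ 0ℚ
        Nk≢0 : N k ≢ 0ℚ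
        Nz≢0 : N z ≢ 0ℚ
        q≢0 : k + z ≢ 0ℚ
        p≢0 : k * z + D ≢ 0ℚ
        p²+Dq²≢0 : (k * z + D) * (k * z + D) + D * ((k + z) * (k + z)) ≢ 0ℚ
        NN≢2epq : N z * N k ≢ 2e * ((k * z + D) * (k + z))
        NN≢-2epq : N z * N k ≢ - (2e * ((k * z + D) * (k + z)))

    -- The conditions linking k and z exclude roots of linear or quadratic polynomials in z with
    -- coefficients definable from k. The leading coefficients do not vanish because k is itself
    -- large.
    valid-pair : ∀ {S ε ε′ μ ζ} → GoodAt ε S μ → GoodAt ε′ (S ∪ Supp μ) ζ → ∀ {k z} → Supp μ k → Supp ζ z → Valid k z
    valid-pair {S} {μ = μ} gμ gζ {k} {z} sk sz = record
      { k≢0 = k≢0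
      ; Nk≢0 = good-N≢0 gμ sk
      ; Nz≢0 = good-N≢0 gζ sz
      ; q≢0 = λ e → big+≢0 gζ sz (raise kᵈ) (trans (+-comm z k) e)
      ; p≢0 = λ e → big≢ gζ sz (raise (ng (Dᵈ ⊗ dinv kᵈ))) (p-root e)
      ; p²+Dq²≢0 = λ e → quadratic≢0 gζ sz (raise (kᵈ ⊗ kᵈ ⊕ Dᵈ)) (raise (kᵈ ⊗ Dᵈ ⊕ kᵈ ⊗ Dᵈ ⊕ (kᵈ ⊗ Dᵈ ⊕ kᵈ ⊗ Dᵈ)))
          (raise (Dᵈ ⊗ Dᵈ ⊕ Dᵈ ⊗ (kᵈ ⊗ kᵈ)))
          k²+D≢0 (trans (lem₁ k z D) e)
      ; NN≢2epq = λ e → no-coincidence 2e (raise (eᵈ ⊕ eᵈ)) (raise (eᵈ ⊕ eᵈ)) e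
      ; NN≢-2epq = λ e → no-coincidence (- 2e) (ng (eᵈ ⊕ eᵈ)) (ng (eᵈ ⊕ eᵈ)) (trans e (neg-* 2e ((k * z + D) * (k + z))))
      }
      where
      k≢0 = big≢0 gμ sk
      kᵈ = varᵈ {S ∪ Supp μ} (inj₂ sk)
      neg-* : ∀ a b → - (a * b) ≡ - a * b
      neg-* = solve-∀ ℚ-ring
      p-root : k * z + D ≡ 0ℚ → z ≡ - (D * inv k)
      p-root e = *-cancelʳ k≢0 (begin
        z * k                    ≡⟨ lem z k D ⟩
        k * z + D - D            ≡⟨ cong (_- D) e ⟩
        0ℚ - D                   ≡⟨ lem₂ D ⟩
        - (D * 1ℚ)               ≡⟨ cong (λ t → - (D * t)) (sym (inv-sym k≢0)) ⟩
        - (D * (inv k * k))      ≡⟨ lem₃ D (inv k) k ⟩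
        - (D * inv k) * k        ∎)
        where
        open ≡-Reasoning
        lem : ∀ z k D → z * k ≡ k * z + D - D
        lem = solve-∀ ℚ-ring
        lem₂ : ∀ D → 0ℚ - D ≡ - (D * 1ℚ)
        lem₂ = solve-∀ ℚ-ring
        lem₃ : ∀ D i k → - (D * (i * k)) ≡ - (D * i) * k
        lem₃ = solve-∀ ℚ-ring
      k²+D≢0 : k * k + D ≢ 0ℚ
      k²+D≢0 e = sq≢ (big gμ sk c1) (big gμ sk (ng cD)) (trans (lem (k * k) D) (trans (cong (_- D) e) (+-identityˡ (- D))))
        where
        lem : ∀ x D → x ≡ x + D - D
        lem = solve-∀ ℚ-ring
      lem₁ : ∀ k z D → (k * k + D) * (z * z) + (k * D + k * D + (k * D + k * D)) * z + (D * D + D * (k * k)) ≡ (k * z + D) *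
          (k * z + D) + D * ((k + z) * (k + z))
      lem₁ = solve-∀ ℚ-ring
      no-coincidence : ∀ s → Def S 2 s → Def (S ∪ Supp μ) 2 s → N z * N k ≢ s * ((k * z + D) * (k + z))
      no-coincidence s ds ds′ e = quadratic≢0 gζ sz (raise (nᵈ ⊖ ds′ ⊗ kᵈ)) (raise (ng (ds′ ⊗ (kᵈ ⊗ kᵈ ⊕ Dᵈ))))
          (raise (ng (Dᵈ ⊗ nᵈ) ⊖ ds′ ⊗ (Dᵈ ⊗ kᵈ))) lead
        (trans (lem k z D s) (trans (cong (_- s * ((k * z + D) * (k + z))) e) (+-inverseʳ (s * ((k * z + D) * (k + z))))))
        where
        nᵈ = kᵈ ⊗ kᵈ ⊖ Dᵈ
        lem : ∀ k z D s → (k * k - D - s * k) * (z * z) + - (s * (k * k + D)) * z + (- (D * (k * k - D)) - s * (D * k)) ≡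
            (z * z - D) * (k * k - D) - s * ((k * z + D) * (k + z))
        lem = solve-∀ ℚ-ring
        lead : k * k - D - s * k ≢ 0ℚ
        lead e′ = quadratic≢0 gμ sk c1 (raise (ng ds)) (ng cD) (λ ()) (trans (lem₂ k s D) e′)
          where
          lem₂ : ∀ k s D → 1ℚ * (k * k) + - s * k + - D ≡ k * k - D - s * k
          lem₂ = solve-∀ ℚ-ring

    -- The energy iteration.

    Free : (ℚ → C → ℚ) → List (ℚ × ℚ) → Law ℚ → Set
    Free f KZ ℛ = ∀ {k z} → (k , z) ∈ KZ → ∀ {r} → Supp ℛ r → ∀ c → f (N z * r) c * form f (β k) k (D * inv k) z r c ≡ 0ℚ

    Decorrelates : Law ℚ → (ℚ → Set) → Law ℚ → (ℚ → C → ℚ) → Set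
    Decorrelates Ξ S ℛ f = ∀ {ρ} → S ρ → ρ ≢ 0ℚ → E Ξ (λ ξ → EΩ ℛ (λ r c → f (ρ * r) c * f (ξ * r) c)) ≤ 57δ

    -- The multiplier ξ obtained by writing out both smoothings in V(2e r/k) as averages of f(ξ r).
    ratio-law : Law ℚ → Law ℚ → Law ℚ
    ratio-law μ ζ = bind μ (λ k → bind (shifts μ) (λ { (k̃ , w′ , w) → bind ζ (λ z → bind 𝒲 (λ ω′ → bind 𝒲 (λ ω →
      ret (scale z ω ω′ * (scale k̃ w w′ * (2e * inv k)))))) }))

    E-ratio-law : ∀ μ ζ ℛ f ρ → E (ratio-law μ ζ) (λ ξ → EΩ ℛ (λ r c → f (ρ * r) c * f (ξ * r) c))
      ≡ E μ (λ k → EΩ ℛ (λ r c → f (ρ * r) c * smoothing μ (smoothing ζ f) (2e * inv k * r) c))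
    E-ratio-law μ ζ ℛ f ρ = trans (E-bind μ _ _) (E-ext μ (λ k →
      trans (E-bind (shifts μ) _ _) (trans (E-ext (shifts μ) (λ { (k̃ , w′ , w) →
        trans (E-bind ζ _ _) (trans (E-ext ζ (λ z →
          trans (E-bind 𝒲 _ _) (trans (E-ext 𝒲 (λ ω′ →
            trans (E-bind 𝒲 _ _) (trans (E-ext 𝒲 (λ ω → EΩ-ext ℛ (λ r c → cong (λ x → f (ρ * r) c * f x c)
                (assoc (scale z ω ω′) (scale k̃ w w′) (2e * inv k) r))))
              (pull ℛ 𝒲 (λ r c → f (ρ * r) c) (λ ω r c → f (scale z ω ω′ * (scale k̃ w w′ * (2e * inv k * r))) c)))))
            (pull ℛ 𝒲 (λ r c → f (ρ * r) c) (λ ω′ r c → E 𝒲 (λ ω → f (scale z ω ω′ * (scale k̃ w w′ * (2e * inv k * r))) c))))))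
          (pull ℛ ζ (λ r c → f (ρ * r) c) (λ z r c → E 𝒲 (λ ω′ → E 𝒲 (λ ω → f (scale z ω ω′ * (scale k̃ w w′ * (2e * inv k * r))) c))))) }))
        (trans (pull ℛ (shifts μ) (λ r c → f (ρ * r) c) (λ { (k̃ , w′ , w) r c → smoothing ζ f (scale k̃ w w′ * (2e * inv k * r)) c }))
          (EΩ-ext ℛ (λ r c → cong (f (ρ * r) c *_) (E-shifts μ (λ k̃ w′ w → smoothing ζ f (scale k̃ w w′ * (2e * inv k * r)) c))))))))
      where
      assoc : ∀ a b c r → a * (b * c) * r ≡ a * (b * (c * r))
      assoc = solve-∀ ℚ-ring
      pull : ∀ {T : Set} ℛ (L : Law T) (g : ℚ → C → ℚ) (g′ : T → ℚ → C → ℚ) →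
        E L (λ t → EΩ ℛ (λ r c → g r c * g′ t r c)) ≡ EΩ ℛ (λ r c → g r c * E L (λ t → g′ t r c))
      pull ℛ L g g′ = trans (sym (EΩ-swap ℛ L (λ t r c → g r c * g′ t r c))) (EΩ-ext ℛ (λ r c → E-* L (g r c) (λ t → g′ t r c)))

    ratio-law≢0 : ∀ {S ε ε′ μ ζ} → GoodAt ε S μ → GoodAt ε′ (S ∪ Supp μ) ζ → ∀ {ξ} → Supp (ratio-law μ ζ) ξ → ξ ≢ 0ℚ
    ratio-law≢0 {μ = μ} {ζ} gμ gζ s with Supp-bind μ _ s
    ... | k , sk , s₁ with Supp-bind (shifts μ) _ s₁
    ...   | (k̃ , w′ , w) , st , s₂ with Supp-shifts μ st | Supp-bind ζ _ s₂
    ...     | sk̃ , sw′ , sw | z , sz , s₃ with Supp-bind 𝒲 _ s₃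
    ...       | ω′ , sω′ , s₄ with Supp-bind 𝒲 _ s₄
    ...         | ω , sω , refl = *≢0 (scale≢0 gζ sz sω sω′) (*≢0 (scale≢0 gμ sk̃ sw sw′) (*≢0 e+e≢0 (inv≢0 (big≢0 gμ sk))))
      where
      scale≢0 : ∀ {S ε L} → GoodAt ε S L → ∀ {z v w} → Supp L z → Supp 𝒲 v → Supp 𝒲 w → scale z v w ≢ 0ℚ
      scale≢0 g sz sv sw = *≢0 (inv≢0 (good-N≢0 g sz)) (*≢0 (big+≢0 g sz (def-w sv)) (big+≢0 g sz (def-w sw)))

    24δ : ℚ
    24δ = (6ℚ * δ₂ + 6ℚ * δ₂) + (6ℚ * δ₂ + 6ℚ * δ₂)

    -- Either some law in 𝒪 decorrelates the colouring f, or the smoothed colouring has lost n units of energy.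
    record Level (n : ℕ) (ε : ℚ) (S : ℚ → Set) : Set₁ where
      field
        ζ : Law ℚ
        ζ-good : GoodAt ε S ζ
        R : ℚ → Set
        R-finite : Finite R
        𝒪 : List (Law ℚ)
        𝒪≢0 : ∀ {Ξ} → Ξ ∈ 𝒪 → ∀ {ξ} → Supp Ξ ξ → ξ ≢ 0ℚ
        KZ : List (ℚ × ℚ)
        valid : ∀ {k z} → (k , z) ∈ KZ → Valid k z
        outcome : ∀ {ℛ} → Good R ℛ → ∀ f → Bd 1ℚ f → Free f KZ ℛ →
          (Σ[ Ξ ∈ Law ℚ ] (Ξ ∈ 𝒪 × Decorrelates Ξ S ℛ f)) ⊎ (energy ℛ (smoothing ζ f) ≤ 1ℚ - nat n * 24δ)

    level-zero : ∀ {S ε} → Finite S → 0ℚ < ε → Level 0 ε S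
    level-zero {S} fin 0<ε = record
      { ζ = proj₁ ex ; ζ-good = proj₂ ex ; R = S ; R-finite = fin ; 𝒪 = [] ; 𝒪≢0 = λ () ; KZ = [] ; valid = λ ()
      ; outcome = λ {ℛ} _ f f≤1 _ → inj₂ (≤-trans (∣∣≤⇒≤ (EΩ-∣∣ ℛ (λ r c → ∣∣-*-≤ (smoothing (proj₁ ex) f r c)
          (smoothing (proj₁ ex) f r c) {1ℚ} {1ℚ} (smoothing-bd (proj₁ ex) f f≤1 r c) (smoothing-bd (proj₁ ex) f f≤1 r c))))
          (≤-reflexive (lem 24δ))) }
      where
      ex = good-exists fin 0<ε
      lem : ∀ x → 1ℚ ≡ 1ℚ - 0ℚ * x
      lem = solve-∀ ℚ-ring

    -- The new block is chosen before the law of the previous level, which has to be good relative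
    -- to the support of the block. The recursion therefore enlarges the base set and lowers ε, and
    -- μ is the left factor of the composite.
    module LevelStep {S ε ε₀} (fin : Finite S) (ε₀≤h : ε₀ ≤ h) (2ε₀≤ε : ε₀ + ε₀ ≤ ε) (η : Fin (suc m) → Law ℚ)
      (hi : Hier (Def S 20) (suc m) η) (gη : ∀ i → GoodAt ε₀ (Def S 20) (η i)) (n : ℕ) (prev : Level n ε₀ (Def S 20 ∪ Supp (avg m η))) where
      open Level prev renaming (ζ to ζ′; ζ-good to ζ′-good; R to R′; R-finite to R′-finite; 𝒪 to 𝒪′; 𝒪≢0 to 𝒪′≢0; KZ to KZ′; valid
          to valid′; outcome to outcome′)

      μ : Law ℚ
      μ = avg m η

      gμ : GoodAt ε₀ (Def S 20) μ
      gμ = Good-avg gη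

      S₂ : ℚ → Set
      S₂ = Def S 20 ∪ Supp μ

      gζ′ : Good S₂ ζ′
      gζ′ = Good-≤ ε₀≤h ζ′-good

      pairs : List (ℚ × ℚ)
      pairs = cartesianProductWith _,_ (proj₁ (Finite-Supp μ)) (proj₁ (Finite-Supp ζ′))

      pairs-complete : ∀ {k z} → Supp μ k → Supp ζ′ z → (k , z) ∈ pairs
      pairs-complete sk sz = ∈-cartesianProductWith⁺ _,_ (proj₂ (Finite-Supp μ) sk) (proj₂ (Finite-Supp ζ′) sz)

      step-outcome : ∀ {ℛ} → Good (S₂ ∪ Supp ζ′ ∪ R′) ℛ → ∀ f → Bd 1ℚ f → Free f (pairs ++ KZ′) ℛ →
        (Σ[ Ξ ∈ Law ℚ ] (Ξ ∈ (ratio-law μ ζ′ ∷ 𝒪′) × Decorrelates Ξ S ℛ f)) ⊎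
            (energy ℛ (smoothing (composite μ ζ′) f) ≤ 1ℚ - nat (suc n) * 24δ)
      step-outcome {ℛ} gℛ f f≤1 free = next (outcome′ (Good-mono inj₂ gℛ) f f≤1 (λ i → free (∈-++⁺ʳ pairs i)))
        where
        gℛ′ : Good (S₂ ∪ Supp ζ′) ℛ
        gℛ′ = Good-mono inj₁ gℛ
        module ND = NoEnergyDrop {S = Def S 20} {ε = ε₀} {μ = μ} {ζ = ζ′} ε₀≤h gμ gζ′ gℛ′ f f≤1
        corr : ∣ E μ (λ k → EΩ ℛ (λ r c → f r c * smoothing ζ′ f (β k * r) c)) ∣ ≤ 15δ
        corr = EdgeFree.edge-free-correlation gζ′ gℛ′ inj₁ f f≤1 η hi inj₂ (λ sk sz sr c → free (∈-++⁺ˡ (pairs-complete sk sz)) sr c)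
        next : (Σ[ Ξ ∈ Law ℚ ] (Ξ ∈ 𝒪′ × Decorrelates Ξ S₂ ℛ f)) ⊎ (energy ℛ (smoothing ζ′ f) ≤ 1ℚ - nat n * 24δ) →
          (Σ[ Ξ ∈ Law ℚ ] (Ξ ∈ (ratio-law μ ζ′ ∷ 𝒪′) × Decorrelates Ξ S ℛ f)) ⊎
              (energy ℛ (smoothing (composite μ ζ′) f) ≤ 1ℚ - nat (suc n) * 24δ)
        next (inj₁ (Ξ , i , dec)) = inj₁ (Ξ , there i , λ sρ → dec (inj₁ (var sρ)))
        -- Which case occurs depends on `f`, but the law of the first and the composite of the
        -- second are both fixed beforehand.
        next (inj₂ low) with energy ℛ (smoothing ζ′ f) ℚ.≤? energy ℛ (smoothing μ (smoothing ζ′ f)) + 48δ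
        ... | yes no-drop = inj₁ (ratio-law μ ζ′ , here refl , λ {ρ} sρ ρ≢0 →
                ≤-trans (≤-reflexive (E-ratio-law μ ζ′ ℛ f ρ)) (ND.decorrelation no-drop corr (var (var sρ)) ρ≢0))
        ... | no drop = inj₂ (begin
                energy ℛ (smoothing (composite μ ζ′) f)     ≤⟨ CompositeLaw.energy-composite gμ gζ′ gℛ′ f f≤1 ⟩
                E₂ + 24δ                                    ≡⟨ lem₁ E₂ δ₂ ⟩
                E₂ + 48δ - 24δ                              ≤⟨ +-monoˡ-≤ (- 24δ) (<⇒≤ (≰⇒> drop)) ⟩
                energy ℛ (smoothing ζ′ f) - 24δ             ≤⟨ +-monoˡ-≤ (- 24δ) low ⟩
                1ℚ - nat n * 24δ - 24δ                      ≡⟨ lem₂ (nat n) 24δ ⟩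
                1ℚ - nat (suc n) * 24δ                      ∎)
          where
          open ≤-Reasoning
          E₂ = energy ℛ (smoothing μ (smoothing ζ′ f))
          lem₁ : ∀ a d → let two = 1ℚ + 1ℚ; four = two + two; six = four + two; twelve = six + six in a +
              ((six * d + six * d) + (six * d + six * d))
            ≡ a + twelve * four * d - ((six * d + six * d) + (six * d + six * d))
          lem₁ = solve-∀ ℚ-ring
          lem₂ : ∀ n d → 1ℚ - n * d - d ≡ 1ℚ - (n + 1ℚ) * d
          lem₂ = solve-∀ ℚ-ring

      level-suc : Level (suc n) ε S
      level-suc = record
        { ζ = composite μ ζ′
        ; ζ-good = Good-≤ 2ε₀≤ε (composite-good gμ ζ′-good)
        ; R = S₂ ∪ Supp ζ′ ∪ R′
        ; R-finite = Finite-∪ (Finite-∪ (Finite-∪ (Finite-Def fin 20) (Finite-Supp μ)) (Finite-Supp ζ′)) R′-finite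
        ; 𝒪 = ratio-law μ ζ′ ∷ 𝒪′
        ; 𝒪≢0 = λ { (here refl) → ratio-law≢0 gμ gζ′ ; (there i) → 𝒪′≢0 i }
        ; KZ = pairs ++ KZ′
        ; valid = λ i → valid-++ (∈-++⁻ pairs i)
        ; outcome = step-outcome
        }
        where
        valid-++ : ∀ {k z} → (k , z) ∈ pairs ⊎ (k , z) ∈ KZ′ → Valid k z
        valid-++ (inj₂ i) = valid′ i
        valid-++ (inj₁ i) with ∈-cartesianProductWith⁻ _,_ (proj₁ (Finite-Supp μ)) (proj₁ (Finite-Supp ζ′)) i
        ... | _ , _ , ik , iz , refl = valid-pair gμ gζ′ (Supp-support μ ik) (Supp-support ζ′ iz)

    opaque
      level : 0ℚ < h → ∀ n {S ε} → Finite S → 0ℚ < ε → Level n ε S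
      level 0<h zero fin 0<ε = level-zero fin 0<ε
      level 0<h (suc n) {S} {ε} fin 0<ε = LevelStep.level-suc fin (p⊓q≤p h half) 2ε₀≤ε (proj₁ block) (proj₁ (proj₂ block))
          (proj₂ (proj₂ block)) n
          (level 0<h n (Finite-∪ (Finite-Def fin 20) (Finite-Supp (avg m (proj₁ block)))) 0<ε₀)
        where
        half ε₀ : ℚ
        half = ε * inv 2ℚ
        -- One half of ε for each factor of the composite; the bound by `h` makes the block usable
        -- in the second-moment estimates.
        ε₀ = h ⊓ half
        0<half : 0ℚ < half
        0<half = subst (_< half) (*-zeroˡ (inv 2ℚ)) (*-monoˡ-<-pos (inv 2ℚ)
            {{positive (≰⇒> (λ le → inv≢0 {2ℚ} (λ ()) (≤-antisym le (0≤inv {2ℚ} (0<nat 1)))))}} 0<ε)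
        0<ε₀ : 0ℚ < ε₀
        0<ε₀ = ≰⇒> (λ le → [ (λ e → <-irrefl refl (<-≤-trans (subst (0ℚ <_) (sym e) 0<h) le)) ,
            (λ e → <-irrefl refl (<-≤-trans (subst (0ℚ <_) (sym e) 0<half) le)) ]′ (⊓-sel h half))
        2ε₀≤ε : ε₀ + ε₀ ≤ ε
        2ε₀≤ε = ≤-trans (+-mono-≤ (p⊓q≤q h half) (p⊓q≤q h half)) (≤-reflexive
            (trans (lem ε (inv 2ℚ)) (trans (cong (ε *_) (*-invʳ {2ℚ} (λ ()))) (*-identityʳ ε))))
          where
          lem : ∀ ε i → ε * i + ε * i ≡ ε * ((1ℚ + 1ℚ) * i)
          lem = solve-∀ ℚ-ring
        block : Σ[ η ∈ (Fin (suc m) → Law ℚ) ] (Hier (Def S 20) (suc m) η × (∀ i → GoodAt ε₀ (Def S 20) (η i)))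
        block = block-exists (Finite-Def fin 20) 0<ε₀ (p⊓q≤p h half) (suc m)

    -- Multipliers with almost disjoint colour classes.

    minimal-term : ∀ n (x : Fin (suc n) → ℚ) → Σ[ i ∈ Fin (suc n) ] nat (suc n) * x i ≤ sumF (suc n) x
    minimal-term zero x = zero , ≤-reflexive (lem (x zero))
      where
      lem : ∀ x → (0ℚ + 1ℚ) * x ≡ 0ℚ + x
      lem = solve-∀ ℚ-ring
    minimal-term (suc n) x with minimal-term n (x ∘ inject₁)
    ... | j , le with ≤-total (x (inject₁ j)) (x (fromℕ (suc n)))
    ...   | inj₁ h₁ = inject₁ j , ≤-trans (≤-reflexive (lem (nat (suc n)) (x (inject₁ j)))) (+-mono-≤ le h₁)
      where
      lem : ∀ n x → (n + 1ℚ) * x ≡ n * x + x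
      lem = solve-∀ ℚ-ring
    ...   | inj₂ h₂ = fromℕ (suc n) , ≤-trans (≤-reflexive (lem (nat (suc n)) (x (fromℕ (suc n)))))
        (+-monoˡ-≤ (x (fromℕ (suc n))) (≤-trans (*-monoˡ (0≤nat (suc n)) h₂) le))
      where
      lem : ∀ n x → (n + 1ℚ) * x ≡ n * x + x
      lem = solve-∀ ℚ-ring

    below-average : {A : Set} (L : Law A) (g : A → ℚ) → Σ[ a ∈ A ] (Supp L a × g a ≤ E L g)
    below-average (ret a) g = a , refl , ≤-refl
    below-average (avg n ℓ) g with minimal-term n (λ i → E (ℓ i) g)
    ... | i , le with below-average (ℓ i) g
    ...   | a , s , le′ = a , (i , s) , ≤-trans le′ (subst (_≤ E (avg n ℓ) g) eqn (*-monoˡ (0≤wt n) le))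
      where
      x = E (ℓ i) g
      eqn : inv (nat (suc n)) * (nat (suc n) * x) ≡ x
      eqn = trans (rotate-factors (inv (nat (suc n))) (nat (suc n)) x) (trans (cong (_* x) (*-invʳ (nat≢0 n))) (*-identityˡ x))

    record Decorrelator (S : ℚ → Set) : Set₁ where
      field
        R : ℚ → Set
        R-finite : Finite R
        𝒪 : List (Law ℚ)
        𝒪≢0 : ∀ {Ξ} → Ξ ∈ 𝒪 → ∀ {ξ} → Supp Ξ ξ → ξ ≢ 0ℚ
        KZ : List (ℚ × ℚ)
        valid : ∀ {k z} → (k , z) ∈ KZ → Valid k z
        outcome : ∀ {ℛ} → Good R ℛ → ∀ f → Bd 1ℚ f → Free f KZ ℛ → Σ[ Ξ ∈ Law ℚ ] (Ξ ∈ 𝒪 × Decorrelates Ξ S ℛ f)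

    -- After `n` drops the energy would be negative, so the iteration must have produced a
    -- decorrelating law.
    decorrelator : 0ℚ < h → ∀ n → 1ℚ < nat n * 24δ → ∀ {S} → Finite S → Decorrelator S
    decorrelator 0<h n 1<n24δ {S} fin = record
      { R = R ; R-finite = R-finite ; 𝒪 = 𝒪 ; 𝒪≢0 = 𝒪≢0 ; KZ = KZ ; valid = valid
      ; outcome = λ {ℛ} gℛ f f≤1 free → [ id , (λ low → ⊥-elim (absurd ℛ f low)) ]′ (outcome gℛ f f≤1 free) }
      where
      open Level (level 0<h n fin 0<h)
      absurd : ∀ ℛ f → energy ℛ (smoothing ζ f) ≤ 1ℚ - nat n * 24δ → ⊥
      absurd ℛ f low = <-irrefl refl (<-≤-trans 1<n24δ (≤-by (≤-trans (E-0≤ ℛ (λ r → E-0≤ 𝒞 (λ c → sq≥0 (smoothing ζ f r c))))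
          low) (lem (nat n * 24δ))))
        where
        lem : ∀ a → 1ℚ ≡ a + (1ℚ - a)
        lem = solve-∀ ℚ-ring

    count : (ℚ → C → ℚ) → List ℚ → ℚ → C → ℚ
    count f [] r c = 0ℚ
    count f (p ∷ ps) r c = f (p * r) c + count f ps r c

    0≤57δ : 0ℚ ≤ 57δ
    0≤57δ = 0≤+ (0≤+ (0≤+ (0≤+ (0≤+ (0≤+ (0≤* 0≤6+2 0≤δ₂) (0≤* 0≤6 0≤δ₂)) 0≤δ₂) (0≤* 0≤6+2 0≤δ₁)) (0≤* 0≤16 0≤δ₁))
        (0≤* 0≤16 0≤δ₁)) (0≤+ 0≤h 0≤h)

    cross-count : ∀ {Ξ S ℛ f} → Decorrelates Ξ S ℛ f → ∀ ps → (∀ {p} → p ∈ ps → S p × p ≢ 0ℚ) →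
      E Ξ (λ ξ → EΩ ℛ (λ r c → count f ps r c * f (ξ * r) c)) ≤ nat (length ps) * 57δ
    cross-count {Ξ} {ℛ = ℛ} {f} dec [] hps = ≤-reflexive (trans (E-ext Ξ
        (λ ξ → trans (EΩ-ext ℛ (λ r c → *-zeroˡ (f (ξ * r) c))) (trans (E-ext ℛ (λ r → E-const 𝒞 0ℚ)) (E-const ℛ 0ℚ))))
            (trans (E-const Ξ 0ℚ) (sym (*-zeroˡ 57δ))))
    cross-count {Ξ} {S} {ℛ} {f} dec (p ∷ ps) hps = begin
      E Ξ (λ ξ → EΩ ℛ (λ r c → (f (p * r) c + count f ps r c) * f (ξ * r) c))
        ≡⟨ E-ext Ξ (λ ξ → trans (EΩ-ext ℛ (λ r c → *-distribʳ-+ (f (ξ * r) c) (f (p * r) c) (count f ps r c))) (EΩ-+ ℛ _ _)) ⟩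
      E Ξ (λ ξ → EΩ ℛ (λ r c → f (p * r) c * f (ξ * r) c) + EΩ ℛ (λ r c → count f ps r c * f (ξ * r) c))
        ≡⟨ E-+ Ξ _ _ ⟩
      E Ξ (λ ξ → EΩ ℛ (λ r c → f (p * r) c * f (ξ * r) c)) + E Ξ (λ ξ → EΩ ℛ (λ r c → count f ps r c * f (ξ * r) c))
        ≤⟨ +-mono-≤ (dec (proj₁ (hps (here refl))) (proj₂ (hps (here refl)))) (cross-count {Ξ} {S} {ℛ} {f} dec ps (λ i → hps (there i))) ⟩
      57δ + nat (length ps) * 57δ
        ≡⟨ lem 57δ (nat (length ps)) ⟩
      nat (length (p ∷ ps)) * 57δ ∎
      where
      open ≤-Reasoning
      lem : ∀ d n → d + n * d ≡ (n + 1ℚ) * d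
      lem = solve-∀ ℚ-ring

    -- The second moment of the count stays nearly diagonal.
    record Chain (J : ℕ) (S : ℚ → Set) : Set₁ where
      field
        R : ℚ → Set
        R-finite : Finite R
        KZ : List (ℚ × ℚ)
        valid : ∀ {k z} → (k , z) ∈ KZ → Valid k z
        extend : ∀ {ℛ} → Good R ℛ → ∀ f → Bd 1ℚ f → Free f KZ ℛ → ∀ κ → (∀ p → energy ℛ (λ r → f (p * r)) ≤ κ) →
          ∀ ps → (∀ {p} → p ∈ ps → S p × p ≢ 0ℚ) → ∀ M → nat (length ps) + nat J ≤ M →
          Σ[ qs ∈ List ℚ ] (nat (length qs) ≡ nat (length ps) + nat J × energy ℛ (count f qs) ≤ energy ℛ (count f ps) + nat J *
              (κ + 2ℚ * (M * 57δ)))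

    chain-zero : ∀ {S} → Chain 0 S
    chain-zero = record
      { R = λ _ → ⊥ ; R-finite = [] , (λ ()) ; KZ = [] ; valid = λ ()
      ; extend = λ {ℛ} _ f _ _ κ _ ps _ M _ → ps , sym (+-identityʳ (nat (length ps))) , ≤-reflexive
          (lem (energy ℛ (count f ps)) (κ + 2ℚ * (M * 57δ))) }
      where
      lem : ∀ a b → a ≡ a + 0ℚ * b
      lem = solve-∀ ℚ-ring

    -- The law that decorrelates is known only once `f` is given, so the rest of the chain is built
    -- over the supports of all candidates. A multiplier whose correlation with the current count is
    -- at most the mean is then selected.
    module ChainStep {S} (J : ℕ) (fin : Finite S) (dec : Decorrelator S)
      (rest : Chain J (S ∪ (λ x → Σ[ Ξ ∈ Law ℚ ] (Ξ ∈ Decorrelator.𝒪 dec × Supp Ξ x)))) where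
      open Decorrelator dec
      open Chain rest renaming (R to R′; R-finite to R′-finite; KZ to KZ′; valid to valid′; extend to extend′)

      step : ∀ {ℛ} → Good (R ∪ R′) ℛ → ∀ f → Bd 1ℚ f → Free f (KZ ++ KZ′) ℛ → ∀ κ → (∀ p → energy ℛ (λ r → f (p * r)) ≤ κ) →
          ∀ ps → (∀ {p} → p ∈ ps → S p × p ≢ 0ℚ) → ∀ M → nat (length ps) + nat (suc J) ≤ M →
          Σ[ qs ∈ List ℚ ] (nat (length qs) ≡ nat (length ps) + nat (suc J) × energy ℛ (count f qs) ≤ energy ℛ (count f ps) + nat
              (suc J) * (κ + 2ℚ * (M * 57δ)))
      step {ℛ} gℛ f f≤1 free κ hκ ps hps M le with outcome (Good-mono inj₁ gℛ) f f≤1 (λ i → free (∈-++⁺ˡ i))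
      ... | Ξ , Ξ∈ , decΞ with below-average Ξ (λ ξ → EΩ ℛ (λ r c → count f ps r c * f (ξ * r) c))
      ...   | ξ , sξ , ξ≤ with extend′ (Good-mono inj₂ gℛ) f f≤1 (λ i → free (∈-++⁺ʳ KZ i)) κ hκ (ξ ∷ ps)
                (λ { (here refl) → inj₂ (Ξ , Ξ∈ , sξ) , 𝒪≢0 Ξ∈ sξ ; (there i) → inj₁ (proj₁ (hps i)) , proj₂ (hps i) }) M
                    (subst (_≤ M) (lem (nat (length ps)) (nat J)) le)
        where
        lem : ∀ a b → a + (b + 1ℚ) ≡ a + 1ℚ + b
        lem = solve-∀ ℚ-ring
      ...     | qs , len , bound = qs , trans len (lem (nat (length ps)) (nat J)) , (begin
        energy ℛ (count f qs)                                       ≤⟨ bound ⟩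
        energy ℛ (count f (ξ ∷ ps)) + nat J * B                     ≤⟨ +-monoˡ-≤ (nat J * B) one-more ⟩
        energy ℛ (count f ps) + B + nat J * B                       ≡⟨ lem₂ (energy ℛ (count f ps)) B (nat J) ⟩
        energy ℛ (count f ps) + nat (suc J) * B                     ∎)
        where
        open ≤-Reasoning
        B = κ + 2ℚ * (M * 57δ)
        lem : ∀ a b → a + 1ℚ + b ≡ a + (b + 1ℚ)
        lem = solve-∀ ℚ-ring
        lem₂ : ∀ a b j → a + b + j * b ≡ a + (j + 1ℚ) * b
        lem₂ = solve-∀ ℚ-ring
        len≤M : nat (length ps) ≤ M
        len≤M = ≤-trans (≤-by (0≤nat (suc J)) refl) le
        expand : ∀ x s → (x + s) * (x + s) ≡ s * s + (x * x + (1ℚ + 1ℚ) * (s * x))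
        expand = solve-∀ ℚ-ring
        one-more : energy ℛ (count f (ξ ∷ ps)) ≤ energy ℛ (count f ps) + B
        one-more = begin
          energy ℛ (count f (ξ ∷ ps))                               ≡⟨ EΩ-ext ℛ (λ r c → expand (f (ξ * r) c) (count f ps r c)) ⟩
          EΩ ℛ (λ r c → count f ps r c * count f ps r c + (f (ξ * r) c * f (ξ * r) c + 2ℚ * (count f ps r c * f (ξ * r) c)))
            ≡⟨ trans (EΩ-+ ℛ (λ r c → count f ps r c * count f ps r c)
                (λ r c → f (ξ * r) c * f (ξ * r) c + 2ℚ * (count f ps r c * f (ξ * r) c)))
                 (cong (energy ℛ (count f ps) +_) (trans (EΩ-+ ℛ (λ r c → f (ξ * r) c * f (ξ * r) c)
                     (λ r c → 2ℚ * (count f ps r c * f (ξ * r) c)))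
                   (cong (energy ℛ (λ r → f (ξ * r)) +_) (EΩ-* ℛ 2ℚ (λ r c → count f ps r c * f (ξ * r) c))))) ⟩
          energy ℛ (count f ps) + (energy ℛ (λ r → f (ξ * r)) + 2ℚ * EΩ ℛ (λ r c → count f ps r c * f (ξ * r) c))
            ≤⟨ +-monoʳ-≤ (energy ℛ (count f ps)) (+-mono-≤ (hκ ξ) (*-monoˡ 0≤2
                (≤-trans ξ≤ (≤-trans (cross-count {Ξ} {S} {ℛ} {f} decΞ ps hps) (*-monoʳ 0≤57δ len≤M))))) ⟩
          energy ℛ (count f ps) + B                                 ∎

      chain-suc : Chain (suc J) S
      chain-suc = record
        { R = R ∪ R′ ; R-finite = Finite-∪ R-finite R′-finite ; KZ = KZ ++ KZ′
        ; valid = λ i → [ valid , valid′ ]′ (∈-++⁻ KZ i) ; extend = step }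

    Finite-⋃ : (𝒪 : List (Law ℚ)) → Finite (λ x → Σ[ Ξ ∈ Law ℚ ] (Ξ ∈ 𝒪 × Supp Ξ x))
    Finite-⋃ 𝒪 = concat (map (λ Ξ → proj₁ (Finite-Supp Ξ)) 𝒪) , λ { (Ξ , i , s) → ∈-concat⁺′ (proj₂ (Finite-Supp Ξ) s)
        (∈-map⁺ (λ Ξ → proj₁ (Finite-Supp Ξ)) i) }

    opaque
      chain : 0ℚ < h → ∀ n → 1ℚ < nat n * 24δ → ∀ J {S} → Finite S → Chain J S
      chain 0<h n lt zero fin = chain-zero
      chain 0<h n lt (suc J) {S} fin = ChainStep.chain-suc J fin dec (chain 0<h n lt J (Finite-∪ fin (Finite-⋃ (Decorrelator.𝒪 dec))))
        where
        dec : Decorrelator S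
        dec = decorrelator 0<h n lt fin

    EΩ-count : ∀ ℛ f κ → (∀ x → E 𝒞 (f x) ≡ κ) → ∀ ps → EΩ ℛ (count f ps) ≡ nat (length ps) * κ
    EΩ-count ℛ f κ hκ [] = trans (E-ext ℛ (λ r → E-const 𝒞 0ℚ)) (trans (E-const ℛ 0ℚ) (sym (*-zeroˡ κ)))
    EΩ-count ℛ f κ hκ (p ∷ ps) = trans (EΩ-+ ℛ (λ r → f (p * r)) (count f ps))
      (trans (cong₂ _+_ (trans (E-ext ℛ (λ r → hκ (p * r))) (E-const ℛ κ)) (EΩ-count ℛ f κ hκ ps)) (lem κ (nat (length ps))))
      where
      lem : ∀ k n → k + n * k ≡ (n + 1ℚ) * k
      lem = solve-∀ ℚ-ring

    -- `ℛ` and `KZ` precede `f`, so a colouring may be defined from the denominators of the vertices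
    -- they produce. The inequality compares the squared mean of the count of `J` multipliers with
    -- its second moment.
    record Obstruction (J : ℕ) : Set₁ where
      field
        ℛ : Law ℚ
        ℛ≢0 : ∀ {r} → Supp ℛ r → r ≢ 0ℚ
        KZ : List (ℚ × ℚ)
        valid : ∀ {k z} → (k , z) ∈ KZ → Valid k z
        bound : ∀ f → Bd 1ℚ f → (∀ x c → f x c * f x c ≡ f x c) → ∀ κ → (∀ x → E 𝒞 (f x) ≡ κ) → Free f KZ ℛ →
          nat J * κ * (nat J * κ) ≤ nat J * (κ + 2ℚ * (nat J * 57δ))

    opaque
      obstruction : 0ℚ < h → ∀ n → 1ℚ < nat n * 24δ → ∀ J → Obstruction J
      obstruction 0<h n lt J = record { ℛ = ℛ ; ℛ≢0 = λ s → big≢0 gℛ s ; KZ = KZ ; valid = valid ; bound = bound }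
        where
        open Chain (chain 0<h n lt J {λ _ → ⊥} ([] , λ ()))
        ex : Σ[ L ∈ Law ℚ ] Good R L
        ex = good-exists R-finite 0<h
        ℛ : Law ℚ
        ℛ = proj₁ ex
        gℛ : Good R ℛ
        gℛ = proj₂ ex
        bound : ∀ f → Bd 1ℚ f → (∀ x c → f x c * f x c ≡ f x c) → ∀ κ → (∀ x → E 𝒞 (f x) ≡ κ) → Free f KZ ℛ →
          nat J * κ * (nat J * κ) ≤ nat J * (κ + 2ℚ * (nat J * 57δ))
        bound f f≤1 idem κ hκ free = from-extension (extend gℛ f f≤1 free κ diagonal [] (λ ()) (nat J) (≤-reflexive (+-identityˡ (nat J))))
          where
          diagonal : ∀ p → energy ℛ (λ r → f (p * r)) ≤ κ
          diagonal p = ≤-reflexive (trans (EΩ-ext ℛ (λ r c → idem (p * r) c)) (trans (E-ext ℛ (λ r → hκ (p * r))) (E-const ℛ κ)))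
          B : ℚ
          B = κ + 2ℚ * (nat J * 57δ)
          from-extension : Σ[ qs ∈ List ℚ ] (nat (length qs) ≡ nat 0 + nat J × energy ℛ (count f qs) ≤ energy ℛ (count f []) + nat
              J * B) → nat J * κ * (nat J * κ) ≤ nat J * B
          from-extension (qs , len , le) = begin
            nat J * κ * (nat J * κ)                          ≡⟨ cong (λ t → t * κ * (t * κ)) (sym (trans len (+-identityˡ (nat J)))) ⟩
            nat (length qs) * κ * (nat (length qs) * κ)      ≡⟨ cong (λ t → t * t) (sym (EΩ-count ℛ f κ hκ qs)) ⟩
            EΩ ℛ (count f qs) * EΩ ℛ (count f qs)            ≤⟨ EΩ-jensen₁ ⟩
            energy ℛ (count f qs)                            ≤⟨ le ⟩
            energy ℛ (count f []) + nat J * B                ≡⟨ trans (cong (_+ nat J * B) zero-energy) (+-identityˡ (nat J * B)) ⟩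
            nat J * B                                        ∎
            where
            open ≤-Reasoning
            zero-energy : energy ℛ (count f []) ≡ 0ℚ
            zero-energy = trans (E-ext ℛ (λ r → E-const 𝒞 (0ℚ * 0ℚ))) (E-const ℛ (0ℚ * 0ℚ))
            EΩ-jensen₁ : EΩ ℛ (count f qs) * EΩ ℛ (count f qs) ≤ energy ℛ (count f qs)
            EΩ-jensen₁ = ≤-trans (jensen ℛ (λ r → E 𝒞 (count f qs r))) (E-mono ℛ (λ r _ → jensen 𝒞 (count f qs r)))

  -- Integers in ℚ and common denominators.

  ι : ℤ.ℤ → ℚ
  ι i = mkℚ i 0 (Coprime.sym (Coprime.1-coprimeTo ℤ.∣ i ∣))

  ι-* : ∀ i j → ι (i ℤ.* j) ≡ ι i * ι j
  ι-* i j = toℚᵘ-injective (ℚᵘ.≃-sym (toℚᵘ-homo-* (ι i) (ι j)))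

  ι-+ : ∀ i j → ι (i ℤ.+ j) ≡ ι i + ι j
  ι-+ i j = toℚᵘ-injective (ℚᵘ.≃-trans (ℚᵘ.*≡* (cong (ℤ._* (ℤ.+ 1)) (sym (cong₂ ℤ._+_ (ℤ.*-identityʳ i) (ℤ.*-identityʳ j)))))
      (ℚᵘ.≃-sym (toℚᵘ-homo-+ (ι i) (ι j))))

  ι-injective : ∀ {i j} → ι i ≡ ι j → i ≡ j
  ι-injective e = cong ↥_ e

  ι≢0 : ∀ {i} → i ≢ ℤ.0ℤ → ι i ≢ 0ℚ
  ι≢0 i≢0 e = i≢0 (ι-injective e)

  denominator-clears : ∀ x → ι (↧ x) * x ≡ ι (↥ x)
  denominator-clears x@(mkℚ n d-1 _) = toℚᵘ-injective (ℚᵘ.≃-trans (toℚᵘ-homo-* (ι (↧ x)) x) (ℚᵘ.*≡* eqn))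
    where
    eqn : (ℤ.+ suc d-1 ℤ.* n) ℤ.* ℤ.+ 1 ≡ n ℤ.* ℤ.+ suc (d-1 ℕ.+ 0)
    eqn = trans (ℤ.*-identityʳ _) (trans (ℤ.*-comm (ℤ.+ suc d-1) n) (cong (λ t → n ℤ.* ℤ.+ suc t) (sym (ℕ.+-identityʳ d-1))))

  opaque
    common-denominator : (xs : List ℚ) → Σ[ W ∈ ℤ.ℤ ] (W ≢ ℤ.0ℤ × (∀ {x} → x ∈ xs → Σ[ i ∈ ℤ.ℤ ] ι W * x ≡ ι i))
    common-denominator [] = ℤ.1ℤ , (λ ()) , λ ()
    common-denominator (x ∷ xs) with common-denominator xs
    ... | W , W≢0 , clears = W ℤ.* ↧ x , (λ e → [ W≢0 , (λ ()) ]′ (ℤ.i*j≡0⇒i≡0∨j≡0 W e)) , λ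
      { (here refl) → W ℤ.* ↥ x , trans (cong (_* x) (ι-* W (↧ x))) (trans (*-assoc (ι W) (ι (↧ x)) x)
          (trans (cong (ι W *_) (denominator-clears x)) (sym (ι-* W (↥ x)))))
      ; {y} (there i) → ↧ x ℤ.* proj₁ (clears i) , trans (cong (_* y) (ι-* W (↧ x)))
          (trans (swap (ι W) (ι (↧ x)) y) (trans (cong (ι (↧ x) *_) (proj₂ (clears i))) (sym (ι-* (↧ x) (proj₁ (clears i)))))) }
      where
      swap : ∀ a b c → a * b * c ≡ b * (a * c)
      swap = solve-∀ ℚ-ring

  -- Finite search and indicators of colours.

  search : {A : Set} {P : A → Set} → (∀ x → Dec (P x)) → (xs : List A) → (Σ[ x ∈ A ] (x ∈ xs × P x)) ⊎ (∀ x → x ∈ xs → ¬ P x)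
  search P? [] = inj₂ λ _ ()
  search P? (x ∷ xs) with P? x | search P? xs
  ... | yes p | _ = inj₁ (x , here refl , p)
  ... | no _ | inj₁ (y , i , p) = inj₁ (y , there i , p)
  ... | no n | inj₂ none = inj₂ λ { _ (here refl) → n ; y (there i) → none y i }

  indicator : ∀ {n} → Fin n → Fin n → ℚ
  indicator a c with a FinP.≟ c
  ... | yes _ = 1ℚ
  ... | no _ = 0ℚ

  indicator-≡ : ∀ {n} {a c : Fin n} → a ≡ c → indicator a c ≡ 1ℚ
  indicator-≡ {a = a} refl with a FinP.≟ a
  ... | yes _ = refl
  ... | no n = ⊥-elim (n refl)

  indicator-≢ : ∀ {n} {a c : Fin n} → a ≢ c → indicator a c ≡ 0ℚ
  indicator-≢ {a = a} {c} n with a FinP.≟ c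
  ... | yes e = ⊥-elim (n e)
  ... | no _ = refl

  indicator-idem : ∀ {n} (a c : Fin n) → indicator a c * indicator a c ≡ indicator a c
  indicator-idem a c with a FinP.≟ c
  ... | yes _ = refl
  ... | no _ = refl

  ∣indicator∣≤1 : ∀ {n} (a c : Fin n) → ∣ indicator a c ∣ ≤ 1ℚ
  ∣indicator∣≤1 a c with a FinP.≟ c
  ... | yes _ = ≤-refl
  ... | no _ = 0≤1

  indicator-disjoint : ∀ {n} {a b : Fin n} → a ≢ b → ∀ c → indicator a c * indicator b c ≡ 0ℚ
  indicator-disjoint {a = a} {b} a≢b c with a FinP.≟ c | b FinP.≟ c
  ... | yes refl | yes refl = ⊥-elim (a≢b refl)
  ... | yes _ | no _ = refl
  ... | no _ | yes _ = refl
  ... | no _ | no _ = refl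

  sumF-indicator : ∀ n (a : Fin n) → sumF n (indicator a) ≡ 1ℚ
  sumF-indicator (suc n) a with last-or-inject₁ a
  ... | inj₁ refl = cong₂ _+_ (sumF-0 n (λ i → indicator-≢ (fromℕ≢inject₁ i))) (indicator-≡ {a = fromℕ n} refl)
  ... | inj₂ (j , refl) = cong₂ _+_ (trans (sumF-cong n shifted) (sumF-indicator n j)) (indicator-≢ (λ e → fromℕ≢inject₁ j (sym e)))
    where
    shifted : ∀ i → indicator (inject₁ j) (inject₁ i) ≡ indicator j i
    shifted i with j FinP.≟ i
    ... | yes refl = indicator-≡ {a = inject₁ j} refl
    ... | no n = indicator-≢ (λ e → n (FinP.inject₁-injective e))

  nat-+ : ∀ i j → nat (i ℕ.+ j) ≡ nat i + nat j
  nat-+ zero j = sym (+-identityˡ (nat j))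
  nat-+ (suc i) j = trans (cong (_+ 1ℚ) (nat-+ i j)) (lem (nat i) (nat j))
    where
    lem : ∀ a b → a + b + 1ℚ ≡ a + 1ℚ + b
    lem = solve-∀ ℚ-ring

  0<⁺ : ∀ {x} → 0ℚ ≤ x → x ≢ 0ℚ → 0ℚ < x
  0<⁺ 0≤x x≢0 = ≰⇒> (λ le → x≢0 (≤-antisym le 0≤x))

  0<* : ∀ {x y} → 0ℚ < x → 0ℚ < y → 0ℚ < x * y
  0<* {x} {y} 0<x 0<y = subst (_< x * y) (*-zeroʳ x) (*-monoʳ-<-pos x {{positive 0<x}} 0<y)

  0<inv : ∀ {x} → 0ℚ < x → 0ℚ < inv x
  0<inv 0<x = 0<⁺ (0≤inv 0<x) (inv≢0 (λ e → <-irrefl (sym e) 0<x))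

  enough-steps : ∀ {x} → 0ℚ < x → Σ[ n ∈ ℕ ] 1ℚ < nat n * x
  enough-steps {x} 0<x with archimedean (inv x + 1ℚ)
  ... | n , le = n , <-≤-trans 1<1+x (subst (_≤ nat n * x) eqn (*-monoʳ (<⇒≤ 0<x) le))
    where
    1<1+x : 1ℚ < 1ℚ + x
    1<1+x = subst (_< 1ℚ + x) (+-identityʳ 1ℚ) (+-monoʳ-< 1ℚ 0<x)
    eqn : (inv x + 1ℚ) * x ≡ 1ℚ + x
    eqn = trans (*-distribʳ-+ x (inv x) 1ℚ) (cong₂ _+_ (inv-sym (λ e → <-irrefl (sym e) 0<x)) (*-identityˡ x))

  ∣i∣²≡i² : ∀ i → ℤ.+ ℤ.∣ i ∣ ℤ.* ℤ.+ ℤ.∣ i ∣ ≡ i ℤ.* i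
  ∣i∣²≡i² (ℤ.+ n) = refl
  ∣i∣²≡i² ℤ.-[1+ n ] = refl

  ∣∣-≡⇒± : ∀ i j → ℤ.∣ i ∣ ≡ ℤ.∣ j ∣ → i ≡ j ⊎ i ≡ ℤ.- j
  ∣∣-≡⇒± (ℤ.+ m) (ℤ.+ n) e = inj₁ (cong ℤ.+_ e)
  ∣∣-≡⇒± (ℤ.+ m) ℤ.-[1+ n ] e = inj₂ (cong ℤ.+_ e)
  ∣∣-≡⇒± ℤ.-[1+ m ] (ℤ.+ n) refl = inj₂ refl
  ∣∣-≡⇒± ℤ.-[1+ m ] ℤ.-[1+ n ] e = inj₁ (cong ℤ.-[1+_] (ℕ.suc-injective e))

  -- From an obstruction to integer solutions.

  module Solutions (a b c t : ℤ.ℤ) (a≢0 : a ≢ ℤ.0ℤ) (b≢0 : b ≢ ℤ.0ℤ) (c≢0 : c ≢ ℤ.0ℤ) (ac≡t² : a ℤ.* c ≡ t ℤ.* t)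
    (q : ℕ) (χ : ℕ → Fin (suc q)) where

    Solution : Set
    Solution = ∃[ x ] ∃[ y ] ∃[ z ] (x ℕ.≥ 1 × y ℕ.≥ 1 × z ℕ.≥ 1 × x ≢ y × χ x ≡ χ y × Eqn a b c x y z)

    A′ B′ C′ Q X δ : ℚ
    A′ = ι a
    B′ = ι b
    C′ = ι c
    Q = nat (suc q)
    -- 512 Q²: with `J` = 2Q and 57δ ≤ 64 δ₁, the error term 2 J² · 57δ is at most X δ₁ = 1.
    X = (4ℚ + 4ℚ) * ((4ℚ + 4ℚ) * (4ℚ + 4ℚ)) * (Q * Q)
    δ = inv X

    0<8 : 0ℚ < 4ℚ + 4ℚ
    0<8 = positive⁻¹ (4ℚ + 4ℚ)

    0<X : 0ℚ < X
    0<X = 0<* (0<* 0<8 (0<* 0<8 0<8)) (0<* (0<nat q) (0<nat q))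

    0<δ : 0ℚ < δ
    0<δ = 0<inv 0<X

    t≢0 : t ≢ ℤ.0ℤ
    t≢0 refl = [ a≢0 , c≢0 ]′ (ℤ.i*j≡0⇒i≡0∨j≡0 a ac≡t²)

    1≤X : 1ℚ ≤ X
    1≤X = ≤-trans (from-yes (1ℚ ℚ.≤? 512ℚ)) (subst (_≤ X) (*-identityʳ 512ℚ) (*-monoˡ 0≤512 (*-mono-≤ 0≤1 (0≤nat (suc q)) 1≤Q 1≤Q)))
      where
      512ℚ : ℚ
      512ℚ = (4ℚ + 4ℚ) * ((4ℚ + 4ℚ) * (4ℚ + 4ℚ))
      0≤512 : 0ℚ ≤ 512ℚ
      0≤512 = <⇒≤ (0<* 0<8 (0<* 0<8 0<8))
      1≤Q : 1ℚ ≤ Q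
      1≤Q = ≤-by (0≤nat q) (+-comm (nat q) 1ℚ)

    Xδ≡1 : X * δ ≡ 1ℚ
    Xδ≡1 = *-invʳ (λ e → <-irrefl (sym e) 0<X)

    h₀ : ℚ
    h₀ = δ * δ * (δ * δ) * (δ * δ * (δ * δ))

    0<h₀ : 0ℚ < h₀
    0<h₀ = 0<* (0<* (0<* 0<δ 0<δ) (0<* 0<δ 0<δ)) (0<* (0<* 0<δ 0<δ) (0<* 0<δ 0<δ))

    setup : Setup
    setup = record
      { D = B′ * C′ ; e = ι t ; D≢0 = *≢0 (ι≢0 b≢0) (ι≢0 c≢0) ; e≢0 = ι≢0 t≢0
      ; δ₁ = δ ; δ₂ = δ * δ ; δ₃ = δ * δ * (δ * δ) ; h = h₀
      ; 0≤δ₁ = <⇒≤ 0<δ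
      ; δ₁≤1 = subst (δ ≤_) Xδ≡1 (subst (_≤ X * δ) (*-identityˡ δ) (*-monoʳ (<⇒≤ 0<δ) 1≤X))
      ; δ₂-def = refl ; δ₃-def = refl ; h-def = refl
      ; m = proj₁ (small-weight 0<h₀)
      ; 1/m≤h = ≤-trans (subst (_≤ w * 4ℚ) (*-identityʳ w) (*-monoˡ (0≤wt (proj₁ (small-weight 0<h₀))) (from-yes (1ℚ ℚ.≤? 4ℚ))))
          (proj₂ (small-weight 0<h₀))
      ; C = Fin (suc q)
      -- For a uniformly random colour, the indicator of the colour of x has mean 1/Q whatever x is;
      -- no class needs to be singled out as dense.
      ; 𝒞 = avg q ret
      }
      where
      w = inv (nat (suc (proj₁ (small-weight 0<h₀))))

    open Setup setup using (D; e; D≢0; e≢0; δ₁; δ₂; h; h≤δ₃; δ₃≤δ₂; δ₂≤δ₁; 0≤δ₂; 𝒞)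
    open Construction setup using (Obstruction; obstruction; Valid; N; β; 2e; e+e≢0; Free; form; 24δ; 57δ; 15δ; 16ℚ; 6ℚ)

    -- With twice as many multipliers as colours the count has mean 2, so the obstruction would give
    -- 4 ≤ 2 + 1.
    J : ℕ
    J = suc q ℕ.+ suc q

    0<δ₂ : 0ℚ < δ₂
    0<δ₂ = 0<* 0<δ 0<δ

    steps : Σ[ n ∈ ℕ ] 1ℚ < nat n * 24δ
    steps = enough-steps (+-mono-< (+-mono-< d d) (+-mono-< d d))
      where
      d : 0ℚ < 6ℚ * δ₂
      d = 0<* (positive⁻¹ 6ℚ) 0<δ₂

    obs : Obstruction J
    obs = obstruction 0<h₀ (proj₁ steps) (proj₂ steps) J

    open Obstruction obs

    57δ≤ : 57δ ≤ (4ℚ + 4ℚ) * (4ℚ + 4ℚ) * δ₁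
    57δ≤ = ≤-trans
      (+-mono-≤ (+-monoˡ-≤ (16ℚ * δ₁) (+-monoˡ-≤ (16ℚ * δ₁) (+-monoˡ-≤ ((6ℚ + 2ℚ) * δ₁)
          (+-mono-≤ (+-mono-≤ (*-monoˡ (from-yes (0ℚ ℚ.≤? 6ℚ + 2ℚ)) δ₂≤δ₁) (*-monoˡ (from-yes (0ℚ ℚ.≤? 6ℚ)) δ₂≤δ₁)) δ₂≤δ₁))))
              (+-mono-≤ h≤δ₁ h≤δ₁))
      (≤-by (0≤* (from-yes (0ℚ ℚ.≤? 4ℚ + 2ℚ + 1ℚ)) (<⇒≤ 0<δ)) (lem δ₁))
      where
      h≤δ₁ : h ≤ δ₁
      h≤δ₁ = ≤-trans h≤δ₃ (≤-trans δ₃≤δ₂ δ₂≤δ₁)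
      lem : ∀ d → let two = 1ℚ + 1ℚ; four = two + two; six = four + two; eight = four + four in eight * eight * d
        ≡ eight * d + six * d + d + eight * d
          + four * four * d + four * four * d + (d + d) + (six + 1ℚ) * d
      lem = solve-∀ ℚ-ring

    no-free-colouring : ∀ (χ̂ : ℚ → Fin (suc q)) → ¬ Free (λ x → indicator (χ̂ x)) KZ ℛ
    no-free-colouring χ̂ free = from-no (4ℚ ℚ.≤? 2ℚ + 1ℚ) (begin
      4ℚ                                          ≡⟨ sym (lhs Q κ (*-invʳ (nat≢0 q))) ⟩
      (Q + Q) * κ * ((Q + Q) * κ)                 ≡⟨ cong (λ x → x * κ * (x * κ)) (sym (nat-+ (suc q) (suc q))) ⟩
      nat J * κ * (nat J * κ)                     ≤⟨ bound (λ x → indicator (χ̂ x)) (λ x → ∣indicator∣≤1 (χ̂ x))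
          (λ x → indicator-idem (χ̂ x)) κ Ef≡κ free ⟩
      nat J * (κ + 2ℚ * (nat J * 57δ))            ≡⟨ cong (λ x → x * (κ + 2ℚ * (x * 57δ))) (nat-+ (suc q) (suc q)) ⟩
      (Q + Q) * (κ + 2ℚ * ((Q + Q) * 57δ))        ≤⟨ *-monoˡ 0≤2Q (+-monoʳ-≤ κ (*-monoˡ (from-yes (0ℚ ℚ.≤? 2ℚ)) (*-monoˡ 0≤2Q 57δ≤))) ⟩
      (Q + Q) * (κ + 2ℚ * ((Q + Q) * ((4ℚ + 4ℚ) * (4ℚ + 4ℚ) * δ₁))) ≡⟨ rhs Q κ δ₁ ⟩
      2ℚ * (Q * κ) + X * δ₁                       ≡⟨ cong₂ (λ x y → 2ℚ * x + y) (*-invʳ (nat≢0 q)) Xδ≡1 ⟩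
      2ℚ * 1ℚ + 1ℚ                                ≡⟨ cong (_+ 1ℚ) (*-identityʳ 2ℚ) ⟩
      2ℚ + 1ℚ                                     ∎)
      where
      open ≤-Reasoning
      κ = inv (nat (suc q))
      0≤2Q : 0ℚ ≤ Q + Q
      0≤2Q = 0≤+ (0≤nat (suc q)) (0≤nat (suc q))
      Ef≡κ : ∀ x → E 𝒞 (indicator (χ̂ x)) ≡ κ
      Ef≡κ x = trans (cong (κ *_) (sumF-indicator (suc q) (χ̂ x))) (*-identityʳ κ)
      lhs : ∀ Q κ → Q * κ ≡ 1ℚ → (Q + Q) * κ * ((Q + Q) * κ) ≡ 4ℚ
      lhs Q κ e = trans (lem Q κ) (cong (λ x → x * x * 4ℚ) e)
        where
        lem : ∀ Q κ → (Q + Q) * κ * ((Q + Q) * κ) ≡ Q * κ * (Q * κ) * (1ℚ + 1ℚ + (1ℚ + 1ℚ))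
        lem = solve-∀ ℚ-ring
      rhs : ∀ Q κ d → let two = 1ℚ + 1ℚ; four = two + two; eight = four + four in (Q + Q) * (κ + two * ((Q + Q) * (eight * eight * d)))
        ≡ two * (Q * κ) + eight * (eight * eight) * (Q * Q) * d
      rhs = solve-∀ ℚ-ring

    -- Multiplying the equation by c gives (e x)² + D y² = (c z)². Hence the third coordinate is
    -- e(p² + D q²) r/N k divided by c, in the notation p = kz + D, q = k + z.
    xᵖ yᵖ zᵖ : ℚ → ℚ → ℚ → ℚ
    xᵖ k z r = N z * r
    yᵖ k z r = β k * ((z + k) * (z + D * inv k)) * r
    zᵖ k z r = e * ((k * z + D) * (k * z + D) + D * ((k + z) * (k + z))) * inv (N k) * inv C′ * r

    module _ {k z r : ℚ} (v : Valid k z) (r≢0 : r ≢ 0ℚ) where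
      open Valid v
      private
        p q̂ i j x y s : ℚ
        p = k * z + D
        q̂ = k + z
        i = inv (N k)
        j = inv k
        x = xᵖ k z r
        y = yᵖ k z r
        s = zᵖ k z r

      x-form : x ≡ N z * N k * i * r
      x-form = sym (trans (cong (_* r) (trans (*-assoc (N z) (N k) i) (cong (N z *_) (*-invʳ Nk≢0)))) (cong (_* r) (*-identityʳ (N z))))

      y-form : y ≡ 2e * (p * q̂) * i * r
      y-form = trans (lem 2e k i z D j r) (trans (cong (λ u → 2e * ((k * z + D * u) * q̂) * i * r) (*-invʳ k≢0))
          (cong (λ u → 2e * ((k * z + u) * q̂) * i * r) (*-identityʳ D)))
        where
        lem : ∀ E k i z D j r → E * k * i * ((z + k) * (z + D * j)) * r ≡ E * ((k * z + D * (k * j)) * (k + z)) * i * r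
        lem = solve-∀ ℚ-ring

      x≢0 : x ≢ 0ℚ
      x≢0 = *≢0 Nz≢0 r≢0

      y≢0 : y ≢ 0ℚ
      y≢0 e′ = *≢0 (*≢0 (*≢0 e+e≢0 (*≢0 p≢0 q≢0)) (inv≢0 Nk≢0)) r≢0 (trans (sym y-form) e′)

      s≢0 : s ≢ 0ℚ
      s≢0 = *≢0 (*≢0 (*≢0 (*≢0 e≢0 p²+Dq²≢0) (inv≢0 Nk≢0)) (inv≢0 (ι≢0 c≢0))) r≢0

      x≢y : x ≢ y
      x≢y e′ = NN≢2epq (*-cancelʳ (inv≢0 Nk≢0) (*-cancelʳ r≢0 (trans (sym x-form) (trans e′ y-form))))

      x≢-y : x ≢ - y
      x≢-y e′ = NN≢-2epq (*-cancelʳ (inv≢0 Nk≢0) (*-cancelʳ r≢0 (trans (sym x-form)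
          (trans e′ (trans (cong -_ y-form) (lem (2e * (p * q̂)) i r))))))
        where
        lem : ∀ a i r → - (a * i * r) ≡ - a * i * r
        lem = solve-∀ ℚ-ring

      -- (p² - D q²)² + 4 D p² q² = (p² + D q²)².
      conic : A′ * (x * x) + B′ * (y * y) ≡ C′ * (s * s)
      conic = *-cancelʳ (ι≢0 c≢0) (begin
        (A′ * (x * x) + B′ * (y * y)) * C′
          ≡⟨ lem₁ A′ B′ C′ x y ⟩
        A′ * C′ * (x * x) + D * (y * y)
          ≡⟨ cong₂ _+_ (cong₂ _*_ AC (cong₂ _*_ x-form x-form)) (cong (D *_) (cong₂ _*_ y-form y-form)) ⟩
        e * e * (N z * N k * i * r * (N z * N k * i * r)) + D * (2e * (p * q̂) * i * r * (2e * (p * q̂) * i * r))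
          ≡⟨ lem₂ e k z D i r ⟩
        e * P² * i * r * (e * P² * i * r)
          ≡⟨ cong (λ u → u * u) (sym Cs) ⟩
        C′ * s * (C′ * s)
          ≡⟨ lem₃ C′ s ⟩
        C′ * (s * s) * C′ ∎)
        where
        open ≡-Reasoning
        P² = p * p + D * (q̂ * q̂)
        AC : A′ * C′ ≡ e * e
        AC = trans (sym (ι-* a c)) (trans (cong ι ac≡t²) (ι-* t t))
        lem₁ : ∀ A B C x y → (A * (x * x) + B * (y * y)) * C ≡ A * C * (x * x) + B * C * (y * y)
        lem₁ = solve-∀ ℚ-ring
        lem₂ : ∀ e k z D i r → e * e * ((z * z - D) * (k * k - D) * i * r * ((z * z - D) * (k * k - D) * i * r))
            + D * ((e + e) * ((k * z + D) * (k + z)) * i * r * ((e + e) * ((k * z + D) * (k + z)) * i * r))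
          ≡ e * ((k * z + D) * (k * z + D) + D * ((k + z) * (k + z))) * i * r *
              (e * ((k * z + D) * (k * z + D) + D * ((k + z) * (k + z))) * i * r)
        lem₂ = solve-∀ ℚ-ring
        lem₃ : ∀ c s → c * s * (c * s) ≡ c * (s * s) * c
        lem₃ = solve-∀ ℚ-ring
        Cs : C′ * s ≡ e * P² * i * r
        Cs = trans (lem₄ C′ (e * P² * i) (inv C′) r) (trans (cong (_* (e * P² * i * r)) (*-invʳ (ι≢0 c≢0))) (*-identityˡ (e * P² * i * r)))
          where
          lem₄ : ∀ c a j r → c * (a * j * r) ≡ c * j * (a * r)
          lem₄ = solve-∀ ℚ-ring

    points : (ℚ × ℚ) × ℚ → List ℚ
    points ((k , z) , r) = xᵖ k z r ∷ yᵖ k z r ∷ zᵖ k z r ∷ []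

    edges : List ((ℚ × ℚ) × ℚ)
    edges = cartesianProductWith _,_ KZ (proj₁ (Finite-Supp ℛ))

    W : ℤ.ℤ
    W = proj₁ (common-denominator (concat (map points edges)))

    W≢0 : W ≢ ℤ.0ℤ
    W≢0 = proj₁ (proj₂ (common-denominator (concat (map points edges))))

    cleared : ∀ {ed x} → ed ∈ edges → x ∈ points ed → Σ[ i ∈ ℤ.ℤ ] ι W * x ≡ ι i
    cleared i∈ x∈ = proj₂ (proj₂ (common-denominator (concat (map points edges)))) (∈-concat⁺′ x∈ (∈-map⁺ points i∈))

    -- `W` clears the denominators of the finitely many vertices in play, where this is the positive
    -- integer ∣W x∣; at other rationals the numerator serves as a default. Signs are lost, which is
    -- why `Valid` excludes x = - y as well as x = y.
    magnitude : ℚ → ℕ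
    magnitude x = ℤ.∣ ↥ (ι W * x) ∣

    magnitude-≡ : ∀ {x i} → ι W * x ≡ ι i → magnitude x ≡ ℤ.∣ i ∣
    magnitude-≡ e′ = cong (λ y → ℤ.∣ ↥ y ∣) e′

    χ̂ : ℚ → Fin (suc q)
    χ̂ x = χ (magnitude x)

    to-solution : ∀ {k z r i j l} → Valid k z → r ≢ 0ℚ → ι W * xᵖ k z r ≡ ι i → ι W * yᵖ k z r ≡ ι j → ι W * zᵖ k z r ≡ ι l →
      χ̂ (xᵖ k z r) ≡ χ̂ (yᵖ k z r) → Solution
    to-solution {k} {z} {r} {i} {j} {l} v r≢0 Wx Wy Ws mono =
      ℤ.∣ i ∣ , ℤ.∣ j ∣ , ℤ.∣ l ∣ , positive-∣∣ {x} {i} Wx (x≢0 v r≢0) , positive-∣∣ {y} {j} Wy (y≢0 v r≢0) , positive-∣∣ {s} {l}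
          Ws (s≢0 v r≢0) , distinct ,
      subst₂ (λ m n → χ m ≡ χ n) (magnitude-≡ {x} {i} Wx) (magnitude-≡ {y} {j} Wy) mono , equation
      where
      x = xᵖ k z r
      y = yᵖ k z r
      s = zᵖ k z r
      positive-∣∣ : ∀ {x i} → ι W * x ≡ ι i → x ≢ 0ℚ → ℤ.∣ i ∣ ℕ.≥ 1
      positive-∣∣ {x} {i} e′ x≢0 = ℕ.n≢0⇒n>0 (λ z → *≢0 (ι≢0 W≢0) x≢0 (trans e′ (cong ι (ℤ.∣i∣≡0⇒i≡0 {i} z))))
      ι-neg : ∀ i → ι (ℤ.- i) ≡ - ι i
      ι-neg (ℤ.+ zero) = refl
      ι-neg ℤ.+[1+ n ] = refl
      ι-neg ℤ.-[1+ n ] = refl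
      distinct : ℤ.∣ i ∣ ≢ ℤ.∣ j ∣
      distinct e′ with ∣∣-≡⇒± i j e′
      ... | inj₁ i≡j = x≢y v r≢0 (W-cancel {x} {y} (trans Wx (trans (cong ι i≡j) (sym Wy))))
        where
        W-cancel : ∀ {u v} → ι W * u ≡ ι W * v → u ≡ v
        W-cancel {u} {v} e″ = *-cancelʳ (ι≢0 W≢0) (trans (*-comm u (ι W)) (trans e″ (*-comm (ι W) v)))
      ... | inj₂ i≡-j = x≢-y v r≢0 (*-cancelʳ (ι≢0 W≢0) (trans (*-comm x (ι W))
          (trans Wx (trans (cong ι i≡-j) (trans (ι-neg j) (trans (cong -_ (sym Wy)) (lem (ι W) y)))))))
        where
        lem : ∀ w y → - (w * y) ≡ - y * w
        lem = solve-∀ ℚ-ring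
      equation : Eqn a b c ℤ.∣ i ∣ ℤ.∣ j ∣ ℤ.∣ l ∣
      equation = trans (cong₂ ℤ._+_ (cong (a ℤ.*_) (∣i∣²≡i² i)) (cong (b ℤ.*_) (∣i∣²≡i² j)))
        (trans (ι-injective (begin
          ι (a ℤ.* (i ℤ.* i) ℤ.+ b ℤ.* (j ℤ.* j))                    ≡⟨ trans (ι-+ (a ℤ.* (i ℤ.* i)) (b ℤ.* (j ℤ.* j)))
              (cong₂ _+_ (ι-sq a i) (ι-sq b j)) ⟩
          A′ * (ι i * ι i) + B′ * (ι j * ι j)                        ≡⟨ cong₂ (λ u v → A′ * (u * u) + B′ * (v * v)) (sym Wx) (sym Wy) ⟩
          A′ * (ι W * x * (ι W * x)) + B′ * (ι W * y * (ι W * y))    ≡⟨ lem A′ B′ (ι W) x y ⟩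
          ι W * ι W * (A′ * (x * x) + B′ * (y * y))                  ≡⟨ cong (ι W * ι W *_) (conic v r≢0) ⟩
          ι W * ι W * (C′ * (s * s))                                 ≡⟨ lem₂ (ι W) C′ s ⟩
          C′ * (ι W * s * (ι W * s))                                 ≡⟨ cong (λ u → C′ * (u * u)) Ws ⟩
          C′ * (ι l * ι l)                                           ≡⟨ sym (ι-sq c l) ⟩
          ι (c ℤ.* (l ℤ.* l))                                        ∎))
        (cong (c ℤ.*_) (sym (∣i∣²≡i² l))))
        where
        open ≡-Reasoning
        ι-sq : ∀ a i → ι (a ℤ.* (i ℤ.* i)) ≡ ι a * (ι i * ι i)
        ι-sq a i = trans (ι-* a (i ℤ.* i)) (cong (ι a *_) (ι-* i i))
        lem : ∀ A B w x y → A * (w * x * (w * x)) + B * (w * y * (w * y)) ≡ w * w * (A * (x * x) + B * (y * y))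
        lem = solve-∀ ℚ-ring
        lem₂ : ∀ w c s → w * w * (c * (s * s)) ≡ c * (w * s * (w * s))
        lem₂ = solve-∀ ℚ-ring

    Monochromatic : (ℚ × ℚ) × ℚ → Set
    Monochromatic ((k , z) , r) = χ̂ (xᵖ k z r) ≡ χ̂ (yᵖ k z r)

    monochromatic? : ∀ ed → Dec (Monochromatic ed)
    monochromatic? ((k , z) , r) = χ̂ (xᵖ k z r) FinP.≟ χ̂ (yᵖ k z r)

    from-edge : ∀ ed → ed ∈ edges → Monochromatic ed → Solution
    from-edge ((k , z) , r) ed∈ mono = to-solution {k} {z} {r} (proj₁ (sound (∈-cartesianProductWith⁻ _,_ KZ (proj₁ (Finite-Supp ℛ)) ed∈)))
        (proj₂ (sound (∈-cartesianProductWith⁻ _,_ KZ (proj₁ (Finite-Supp ℛ)) ed∈)))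
        (proj₂ (cleared ed∈ (here refl))) (proj₂ (cleared ed∈ (there (here refl)))) (proj₂ (cleared ed∈ (there (there (here refl))))) mono
      where
      sound : (∃[ kz ] ∃[ r′ ] (kz ∈ KZ × r′ ∈ proj₁ (Finite-Supp ℛ) × ((k , z) , r) ≡ (kz , r′))) → Valid k z × r ≢ 0ℚ
      sound (_ , _ , kz∈ , r∈ , refl) = valid kz∈ , ℛ≢0 (Supp-support ℛ r∈)

    free : (∀ ed → ed ∈ edges → ¬ Monochromatic ed) → Free (λ x → indicator (χ̂ x)) KZ ℛ
    free none {k} {z} kz∈ {r} sr c = indicator-disjoint {a = χ̂ (xᵖ k z r)} {b = χ̂ (yᵖ k z r)}
      (none ((k , z) , r) (∈-cartesianProductWith⁺ _,_ kz∈ (proj₂ (Finite-Supp ℛ) sr))) c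

    solution : Solution
    solution = [ (λ { (ed , ed∈ , mono) → from-edge ed ed∈ mono }) , (λ none → ⊥-elim (no-free-colouring χ̂ (free none))) ]′
        (search monochromatic? edges)

  swap-solution : ∀ {a b c q} {χ : ℕ → Fin q} →
    (∃[ x ] ∃[ y ] ∃[ z ] (x ℕ.≥ 1 × y ℕ.≥ 1 × z ℕ.≥ 1 × x ≢ y × χ x ≡ χ y × Eqn b a c x y z)) →
    ∃[ x ] ∃[ y ] ∃[ z ] (x ℕ.≥ 1 × y ℕ.≥ 1 × z ℕ.≥ 1 × x ≢ y × χ x ≡ χ y × Eqn a b c x y z)
  swap-solution {a} {b} (y , x , z , y≥1 , x≥1 , z≥1 , y≢x , same , eqn) =
    x , y , z , x≥1 , y≥1 , z≥1 , y≢x ∘ sym , sym same ,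
    trans (ℤ.+-comm (a ℤ.* (ℤ.+ x ℤ.* ℤ.+ x)) (b ℤ.* (ℤ.+ y ℤ.* ℤ.+ y))) eqn

open import Data.Nat using (ℕ; zero; suc; _≥_)
open import Data.Integer using (ℤ; _*_; 0ℤ)
open import Data.Product using (∃; ∃-syntax; _×_; _,_)
open import Data.Sum using (_⊎_; inj₁; inj₂)
open import Data.Empty using (⊥-elim)
open import Data.Fin.Properties using (¬Fin0)
open import Relation.Binary.PropositionalEquality using (_≡_; _≢_)

theorem1p4 : (a b c : ℤ) → a ≢ 0ℤ → b ≢ 0ℤ → c ≢ 0ℤ →
    IsSquare (a * c) ⊎ IsSquare (b * c) →
    (r : ℕ) (χ : Coloring r) →
    ∃[ x ] ∃[ y ] ∃[ z ]
    (x ≥ 1 × y ≥ 1 × z ≥ 1 × x ≢ y × χ x ≡ χ y × Eqn a b c x y z)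
theorem1p4 a b c a≢0 b≢0 c≢0 _ zero χ = ⊥-elim (¬Fin0 (χ 0))
theorem1p4 a b c a≢0 b≢0 c≢0 (inj₁ (t , ac≡t²)) (suc q) χ = PartitionRegularity.Solutions.solution a b c t a≢0 b≢0 c≢0 ac≡t² q χ
theorem1p4 a b c a≢0 b≢0 c≢0 (inj₂ (t , bc≡t²)) (suc q) χ = PartitionRegularity.swap-solution {a} {b} {c} {suc q} {χ}
    (PartitionRegularity.Solutions.solution b a c t b≢0 a≢0 c≢0 bc≡t² q χ)
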